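{- Let $(K,\prec)$ be an abstract elementary class with amalgamation, joint embedding and no maximal models, let $\downarrow^{(1)}$ and $\downarrow^{(2)}$ be independence relations on $K$, and let $M \in K$. Assume: - $\downarrow^{(1)}$ has $(E)_M$ and $(U)_M$; - $\downarrow^{(2)}$ has $(E)_M$, $(U)$ and $(L)$. Then $\downarrow^{(1)}_M = \downarrow^{(2)}_M$. In particular, there can be at most one independence relation on $K$ satisfying existence, extension, uniqueness and local character (i.e. $(E)$, $(U)$ and $(L)$).
   Context: Setting. $(K,\prec)$ is an abstract elementary class (AEC) with amalgamation, joint embedding and no maximal models; "model" means member of $K$. We work in a monster model $\mathfrak{C}$: the union of a strictly increasing continuous chain $(\mathfrak{C}_i)_i$ of models with $\mathfrak{C}_{i+1}$ universal over $\mathfrak{C}_i$, of length $\mathrm{OR}$ (or a cardinal much bigger than the sizes of all objects considered). Every set is a subset of $\mathfrak{C}$ and every model is a $\prec$-submodel of $\mathfrak{C}$ (so for models, $M\subseteq N$ implies $M \prec N$). For sequences of sets $\bar A=(A_i)_{i\in I}$, $\bar B=(B_i)_{i \in I}$ and a set $C$, $f:\bar A\equiv_C \bar B$ means that $f$ is an automorphism of $\mathfrak{C}$ fixing $C$ pointwise with $f[A_i]=B_i$ for all $i\in I$; $\bar A\equiv_C\bar B$ means such an $f$ exists; $C$ is omitted when empty. Independence relation. An independence relation $\downarrow$ on $K$ is a set of triples $(A,M,N)$, written $A\downarrow_M N$, with $A$ a set, $M\prec N$ models, such that: (I) invariance: if $(A,M,N)\equiv(A',M',N')$ then $A\downarrow_M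 N$ iff $A'\downarrow_{M'}N'$; (M) monotonicity: if $A\downarrow_M N$, $A'\subseteq A$, $M\prec N'\prec N$, then $A'\downarrow_M N'$; (B) base monotonicity: if $A\downarrow_M N$ and $M\prec M'\prec N$ then $A\downarrow_{M'}N$. $\downarrow_M$ denotes the restriction of $\downarrow$ to triples with base $M$. Properties. $(E)$ is the conjunction of: $(E_0)$ existence: $A\downarrow_M M$ for all sets $A$ and models $M$; $(E_1)$ extension: for a set $A$ and $M\prec N\prec N'$, if $A\downarrow_M N$ then there is $A'\equiv_N A$ with $A'\downarrow_M N'$. $(U)$ uniqueness: if $A\downarrow_M N$, $A'\downarrow_M N$ and $f:A\equiv_M A'$, then there is $g:A\equiv_N A'$ with $g\upharpoonright A=f\upharpoonright A$. $(L)$ local character: $\kappa_\alpha(\downarrow)<\infty$ for every cardinal $\alpha$, where $\kappa_\alpha(\downarrow)$ is the least $\lambda$ which is a regular cardinal or $\infty$ such that for every regular cardinal $\mu\ge\lambda$, every increasing continuous chain of models $\langle M_i: i\le\mu\rangle$ and every set $A$ of size $\alpha$, there is $i_0<\mu$ with $A\downarrow_{M_{i_0}}M_\mu$. For a property $(P)$ other than $(L)$, $(P)_M$ means that $(P)$ holds when the base model is restricted to be $M$. -}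

module Defs where

open import Level using (Level; _⊔_; suc)
open import Data.Empty.Polymorphic using (⊥; ⊥-elim)
open import Data.Nat.Base using (ℕ)
open import Data.Product.Base using (Σ-syntax; ∃; ∃-syntax; _×_; _,_)
open import Data.Sum.Base using (_⊎_)
open import Data.Vec.Base using (Vec; map)
open import Data.Vec.Properties using (map-∘)
open import Data.Vec.Functional using ([]; _∷_)
open import Function.Base using (_∘_)
open import Function.Bundles using (_⇔_; _↣_; _↔_; module Injection)
open import Function.Construct.Composition using (_⇔-∘_)
open import Function.Definitions using (Injective; StrictlySurjective)
open import Induction.WellFounded using (WellFounded)
open import Relation.Binary.Core using (Rel)
open import Relation.Binary.Structures using (IsStrictTotalOrder)
open import Relation.Binary.PropositionalEquality using (_≡_; _≗_; sym; trans; cong; subst)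
open import Relation.Nullary.Negation using (¬_)
open import Relation.Unary using (Pred)

-- Size convention: types in `Set ℓ` play the role of sets, types in
-- `Set (suc ℓ)` that of (proper) classes.  In particular OR is the order type
-- of the well-orders carried by types in `Set ℓ`.

------------------------------------------------------------------------
-- Well-orders and regular cardinals

record WellOrder (a : Level) : Set (suc a) where
  field
    Carrier            : Set a
    _<_                : Rel Carrier a
    isStrictTotalOrder : IsStrictTotalOrder _≡_ _<_
    wellFounded        : WellFounded _<_

module _ {a : Level} (W : WellOrder a) where
  open WellOrder W

  IsLimitElement : Carrier → Set a
  IsLimitElement i = (∃[ j ] j < i) × (∀ j → j < i → ∃[ k ] (j < k × k < i))

  IsSuccessorOf : Carrier → Carrier → Set a
  IsSuccessorOf j i = i < j × (∀ k → i < k → ¬ (k < j))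

  -- The order type of the whole of W is a limit ordinal.
  IsLimitOrder : Set a
  IsLimitOrder = Carrier × (∀ i → ∃[ j ] i < j)

  -- The order type of W is a limit ordinal equal to its own cofinality: no map
  -- from a proper initial segment is cofinal.  Such an ordinal is
  -- automatically an (infinite) cardinal.
  IsRegular : Set a
  IsRegular =
    IsLimitOrder ×
    (∀ i (f : Carrier → Carrier) → ∃[ b ] (∀ j → j < i → f j < b))

record RegularCardinal (ℓ : Level) : Set (suc ℓ) where
  field
    wellOrder : WellOrder ℓ
    isRegular : IsRegular wellOrder
  open WellOrder wellOrder public

_≤ᶜ_ : ∀ {ℓ} → RegularCardinal ℓ → RegularCardinal ℓ → Set ℓ
λ₁ ≤ᶜ λ₂ = RegularCardinal.Carrier λ₁ ↣ RegularCardinal.Carrier λ₂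

IsSmall : ∀ {ℓ} {I : Set (suc ℓ)} → Pred I (suc ℓ) → Set (suc ℓ)
IsSmall {ℓ} {I} P =
  Σ[ S ∈ Set ℓ ] Σ[ e ∈ (S → I) ] (∀ i → P i → ∃[ s ] e s ≡ i)

-- W has order type OR: it is a proper class all of whose proper initial
-- segments are sets.
IsOR : ∀ {ℓ} → WellOrder (suc ℓ) → Set (suc ℓ)
IsOR W = (∀ i → IsSmall (λ j → j < i)) × ¬ IsSmall (λ (i : Carrier) → i ≡ i)
  where open WellOrder W

------------------------------------------------------------------------
-- Structures in a finitary vocabulary

record Vocabulary (ℓ : Level) : Set (suc ℓ) where
  field
    FunSym   : Set ℓ
    RelSym   : Set ℓ
    funArity : FunSym → ℕ
    relArity : RelSym → ℕ

module _ {ℓ : Level} (τ : Vocabulary ℓ) where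
  open Vocabulary τ

  record Structure (a : Level) : Set (ℓ ⊔ suc a) where
    field
      Carrier : Set a
      fun     : ∀ F → Vec Carrier (funArity F) → Carrier
      rel     : ∀ R → Vec Carrier (relArity R) → Set a

open Structure using (Carrier)

module _ {ℓ : Level} {τ : Vocabulary ℓ} where
  open Vocabulary τ
  open Structure using (fun; rel)

  record _↪_ {a b} (M : Structure τ a) (N : Structure τ b) : Set (ℓ ⊔ a ⊔ b) where
    field
      to        : Carrier M → Carrier N
      injective : Injective _≡_ _≡_ to
      fun-hom   : ∀ F xs → to (fun M F xs) ≡ fun N F (map to xs)
      rel-iff   : ∀ R xs → rel M R xs ⇔ rel N R (map to xs)

  open _↪_ public using (to)

  infixr 9 _∘ᵉ_

  _∘ᵉ_ : ∀ {a b c} {M : Structure τ a} {N : Structure τ b} {P : Structure τ c} →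
         N ↪ P → M ↪ N → M ↪ P
  _∘ᵉ_ {N = N} {P = P} g f = record
    { to        = to g ∘ to f
    ; injective = _↪_.injective f ∘ _↪_.injective g
    ; fun-hom   = λ F xs → trans (cong (to g) (_↪_.fun-hom f F xs))
                   (trans (_↪_.fun-hom g F (map (to f) xs))
                          (cong (fun P F) (sym (map-∘ (to g) (to f) xs))))
    ; rel-iff   = λ R xs →
        subst (λ ys → _ ⇔ rel P R ys) (sym (map-∘ (to g) (to f) xs))
          (_↪_.rel-iff g R (map (to f) xs) ⇔-∘ _↪_.rel-iff f R xs)
    }

  IsSurjective : ∀ {a b} {M : Structure τ a} {N : Structure τ b} → M ↪ N → Set (a ⊔ b)
  IsSurjective f = StrictlySurjective _≡_ (to f)

  -- A ⊆-increasing W-indexed chain of (set-sized) structures inside U.  The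
  -- maps `incl` stand for the inclusions; `step` is determined by them.
  record Chain {w u} (W : WellOrder w) (U : Structure τ u) : Set (suc ℓ ⊔ w ⊔ u) where
    open WellOrder W using (_<_) renaming (Carrier to I)
    field
      obj     : I → Structure τ ℓ
      incl    : ∀ i → obj i ↪ U
      step    : ∀ {i j} → i < j → obj i ↪ obj j
      commute : ∀ {i j} (p : i < j) → to (incl j) ∘ to (step p) ≗ to (incl i)

    IsContinuous : Set (ℓ ⊔ w ⊔ u)
    IsContinuous = ∀ i → IsLimitElement W i → ∀ x →
      ∃[ j ] (j < i × (∃[ y ] to (incl j) y ≡ to (incl i) x))

    HasUnion : Set (ℓ ⊔ w ⊔ u)
    HasUnion = ∀ x → ∃[ i ] ∃[ y ] to (incl i) y ≡ x

------------------------------------------------------------------------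
-- Abstract elementary classes

-- Since there is no literal inclusion between types, the strong substructure
-- relation is given on embeddings: `IsStrong f`, for f : M ↪ N, means
-- f[M] ≺ N (with M, N ∈ K).  Thus f is what is usually called a K-embedding.
record AEC (ℓ : Level) : Set (suc (suc ℓ)) where
  field
    τ        : Vocabulary ℓ
    K        : Structure τ ℓ → Set (suc ℓ)
    IsStrong : {M N : Structure τ ℓ} → M ↪ N → Set (suc ℓ)

    strong-dom  : ∀ {M N} {f : M ↪ N} → IsStrong f → K M
    strong-cod  : ∀ {M N} {f : M ↪ N} → IsStrong f → K N
    strong-resp : ∀ {M N} {f g : M ↪ N} → to f ≗ to g → IsStrong f → IsStrong g

    -- Closure of K and ≺ under isomorphism, and reflexivity of ≺.
    strong-iso   : ∀ {M N} (f : M ↪ N) → K M → IsSurjective f → IsStrong f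
    strong-trans : ∀ {M N P} {f : M ↪ N} {g : N ↪ P} →
                   IsStrong f → IsStrong g → IsStrong (g ∘ᵉ f)
    coherence    : ∀ {M N P} {f : M ↪ N} {g : N ↪ P} →
                   IsStrong (g ∘ᵉ f) → IsStrong g → IsStrong f

    -- Tarski–Vaught axioms for a continuous ≺-chain of limit length δ with
    -- union U: U ∈ K and every member is ≺ U; and if every member is ≺ N, for
    -- some N ⊇ U, then U ≺ N.
    chain-union : ∀ (δ : WellOrder ℓ) → IsLimitOrder δ →
      ∀ {U} (C : Chain δ U) →
      (∀ {i j} (p : WellOrder._<_ δ i j) → IsStrong (Chain.step C p)) →
      Chain.IsContinuous C → Chain.HasUnion C →
      (∀ i → IsStrong (Chain.incl C i)) ×
      (∀ {N} (h : U ↪ N) → (∀ i → IsStrong (h ∘ᵉ Chain.incl C i)) → IsStrong h)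

    -- Löwenheim–Skolem–Tarski axiom.
    LS       : Set ℓ
    LS≥ℵ₀    : ℕ ↣ LS
    LS≥Fun   : Vocabulary.FunSym τ ↣ LS
    LS≥Rel   : Vocabulary.RelSym τ ↣ LS
    downward : ∀ {N} → K N → ∀ {A : Set ℓ} (a : A ↣ Carrier N) →
      ∃[ M ] Σ[ f ∈ M ↪ N ] IsStrong f ×
        (∀ x → ∃[ m ] to f m ≡ Injection.to a x) ×
        (Carrier M ↣ (A ⊎ LS))

  Amalgamation : Set (suc ℓ)
  Amalgamation = ∀ {M₀ M₁ M₂} (f₁ : M₀ ↪ M₁) (f₂ : M₀ ↪ M₂) →
    IsStrong f₁ → IsStrong f₂ →
    ∃[ N ] Σ[ g₁ ∈ M₁ ↪ N ] Σ[ g₂ ∈ M₂ ↪ N ]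
      IsStrong g₁ × IsStrong g₂ × (to g₁ ∘ to f₁ ≗ to g₂ ∘ to f₂)

  JointEmbedding : Set (suc ℓ)
  JointEmbedding = ∀ {M₁ M₂} → K M₁ → K M₂ →
    ∃[ N ] Σ[ g₁ ∈ M₁ ↪ N ] Σ[ g₂ ∈ M₂ ↪ N ] IsStrong g₁ × IsStrong g₂

  NoMaximalModels : Set (suc ℓ)
  NoMaximalModels = ∀ {M} → K M →
    ∃[ N ] Σ[ f ∈ M ↪ N ] IsStrong f × ¬ IsSurjective f

  -- N is universal over M (via f): every strong extension of M of the same
  -- cardinality as M embeds into N over M.
  IsUniversal : ∀ {M N} → M ↪ N → Set (suc ℓ)
  IsUniversal {M} {N} f = IsStrong f ×
    (∀ {M′} (g : M ↪ M′) → IsStrong g → (Carrier M′ ↔ Carrier M) →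
      Σ[ h ∈ M′ ↪ N ] IsStrong h × (to h ∘ to g ≗ to f))

------------------------------------------------------------------------
-- The monster model

record Monster {ℓ : Level} (𝒦 : AEC ℓ) : Set (suc (suc ℓ)) where
  open AEC 𝒦
  field
    length  : WellOrder (suc ℓ)
    isOR    : IsOR length
    ℭ       : Structure τ (suc ℓ)
    chain   : Chain length ℭ
  open WellOrder length public using (_<_) renaming (Carrier to Stage)
  open Chain chain public
  field
    step-strong    : ∀ {i j} (p : i < j) → IsStrong (step p)
    step-strict    : ∀ {i j} (p : i < j) → ¬ IsSurjective (step p)
    step-universal : ∀ {i j} (p : i < j) → IsSuccessorOf length j i → IsUniversal (step p)
    continuous     : IsContinuous
    union          : HasUnion

module InMonster {ℓ : Level} {𝒦 : AEC ℓ} (𝕄 : Monster 𝒦) where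
  open AEC 𝒦
  open Monster 𝕄

  -- A set A ⊆ ℭ is presented as the range of a family indexed by a type in
  -- `Set ℓ`; repetitions are allowed, and only the range matters.
  record Subset : Set (suc ℓ) where
    field
      {Index} : Set ℓ
      elem    : Index → Carrier ℭ

  infix 4 _∈_ _⊆_ _≐_

  _∈_ : Carrier ℭ → Subset → Set (suc ℓ)
  x ∈ A = ∃[ i ] Subset.elem A i ≡ x

  _⊆_ _≐_ : Subset → Subset → Set (suc ℓ)
  A ⊆ B = ∀ x → x ∈ A → x ∈ B
  A ≐ B = A ⊆ B × B ⊆ A

  ∅ : Subset
  ∅ = record { elem = λ (x : ⊥ {ℓ}) → ⊥-elim x }

  -- α, a type in `Set ℓ`, stands for its cardinality.
  HasSize : Subset → Set ℓ → Set (suc ℓ)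
  HasSize A α = Σ[ e ∈ (α → Carrier ℭ) ] Injective _≡_ _≡_ e × A ≐ record { elem = e }

  -- A model: the image in ℭ of a strong submodel of some ℭᵢ.
  record Model : Set (suc ℓ) where
    field
      {str}  : Structure τ ℓ
      stage  : Stage
      emb    : str ↪ obj stage
      strong : IsStrong emb

  ∣_∣ : Model → Subset
  ∣ M ∣ = record { elem = to (incl (Model.stage M)) ∘ to (Model.emb M) }

  -- By coherence, inclusion between ≺-submodels of ℭ is the same as ≺.
  infix 4 _≼_

  _≼_ : Model → Model → Set (suc ℓ)
  M ≼ N = ∣ M ∣ ⊆ ∣ N ∣

  -- Automorphisms of the vocabulary structure ℭ; these preserve ≺ because K and
  -- ≺ are closed under isomorphism and OR is regular.
  record Automorphism : Set (suc ℓ) where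
    field
      self-emb   : ℭ ↪ ℭ
      surjective : IsSurjective self-emb

    _⟨_⟩ : Carrier ℭ → Carrier ℭ
    _⟨_⟩ = to self-emb

    _[_] : Subset → Subset
    _[_] A = record { elem = _⟨_⟩ ∘ Subset.elem A }

  open Automorphism public using (_⟨_⟩; _[_])

  infix 4 _∶_≡[_]_ _≡[_]_

  _∶_≡[_]_ : ∀ {I : Set} → Automorphism → (I → Subset) → Subset → (I → Subset) → Set (suc ℓ)
  f ∶ Ā ≡[ C ] B̄ = (∀ x → x ∈ C → f ⟨ x ⟩ ≡ x) × (∀ i → f [ Ā i ] ≐ B̄ i)

  _≡[_]_ : ∀ {I : Set} → (I → Subset) → Subset → (I → Subset) → Set (suc ℓ)
  Ā ≡[ C ] B̄ = ∃[ f ] f ∶ Ā ≡[ C ] B̄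

  record IndependenceRelation : Set (suc (suc ℓ)) where
    infix 4 _↓[_]_
    field
      _↓[_]_ : Subset → Model → Model → Set (suc ℓ)

      base-≼ : ∀ {A M N} → A ↓[ M ] N → M ≼ N

      invariance : ∀ {A M N A′ M′ N′} → M ≼ N → M′ ≼ N′ →
        (A ∷ ∣ M ∣ ∷ ∣ N ∣ ∷ []) ≡[ ∅ ] (A′ ∷ ∣ M′ ∣ ∷ ∣ N′ ∣ ∷ []) →
        (A ↓[ M ] N) ⇔ (A′ ↓[ M′ ] N′)

      monotonicity : ∀ {A A′ M N N′} →
        A ↓[ M ] N → A′ ⊆ A → M ≼ N′ → N′ ≼ N → A′ ↓[ M ] N′

      base-monotonicity : ∀ {A M M′ N} →
        A ↓[ M ] N → M ≼ M′ → M′ ≼ N → A ↓[ M′ ] N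

    -- E₀-at M, E₁-at M, … are the properties with the base model fixed to be M.

    E₀-at : Model → Set (suc ℓ)
    E₀-at M = ∀ A → A ↓[ M ] M

    E₁-at : Model → Set (suc ℓ)
    E₁-at M = ∀ A N N′ → M ≼ N → N ≼ N′ → A ↓[ M ] N →
      ∃[ A′ ] (A′ ∷ []) ≡[ ∣ N ∣ ] (A ∷ []) × A′ ↓[ M ] N′

    E-at : Model → Set (suc ℓ)
    E-at M = E₀-at M × E₁-at M

    U-at : Model → Set (suc ℓ)
    U-at M = ∀ A A′ N → A ↓[ M ] N → A′ ↓[ M ] N →
      ∀ f → f ∶ (A ∷ []) ≡[ ∣ M ∣ ] (A′ ∷ []) →
      ∃[ g ] g ∶ (A ∷ []) ≡[ ∣ N ∣ ] (A′ ∷ []) × (∀ x → x ∈ A → g ⟨ x ⟩ ≡ f ⟨ x ⟩)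

    E U : Set (suc ℓ)
    E = ∀ M → E-at M
    U = ∀ M → U-at M

    -- The chain ⟨Mᵢ : i ≤ μ⟩ is split as ⟨Mᵢ : i < μ⟩ together with its last
    -- member M_μ, which by continuity at the limit μ is the union.
    LocalCharacterFrom : Set ℓ → RegularCardinal ℓ → Set (suc ℓ)
    LocalCharacterFrom α λ₀ =
      ∀ (μ : RegularCardinal ℓ) → λ₀ ≤ᶜ μ →
      let module μ = RegularCardinal μ in
      ∀ (M : μ.Carrier → Model) (Mμ : Model) →
      (∀ i j → i μ.< j → M i ≼ M j) →
      (∀ i → IsLimitElement μ.wellOrder i →
         ∀ x → x ∈ ∣ M i ∣ → ∃[ j ] (j μ.< i × x ∈ ∣ M j ∣)) →
      (∀ i → M i ≼ Mμ) →
      (∀ x → x ∈ ∣ Mμ ∣ → ∃[ j ] x ∈ ∣ M j ∣) →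
      ∀ A → HasSize A α → ∃[ i₀ ] A ↓[ M i₀ ] Mμ

    -- κ_α(↓) = λ₀ for a regular cardinal λ₀ (so κ_α(↓) ≠ ∞).
    κ[_]≡_ : Set ℓ → RegularCardinal ℓ → Set (suc ℓ)
    κ[ α ]≡ λ₀ = LocalCharacterFrom α λ₀ ×
      (∀ λ₁ → LocalCharacterFrom α λ₁ → λ₀ ≤ᶜ λ₁)

    L : Set (suc ℓ)
    L = ∀ α → ∃[ λ₀ ] κ[ α ]≡ λ₀

-- Suppose A ↓₁ N but not A ↓₂ N over M.  By (E)_M there are sequences of length OR of
-- copies Aᵢ of A and Nᵢ of N over M such that Aᵢ is free from everything chosen before
-- it, and Nᵢ is ↓₂-free from everything chosen before it and Aᵢ; here freeness of Aᵢ may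
-- be taken in the sense of ↓₁ or of ↓₂.  For i < j, uniqueness over M shows that Aⱼ ↓₂ Nᵢ
-- fails for the first choice and holds for the second, whereas the truth value of Aᵢ ↓₂ Nⱼ
-- depends neither on i and j nor on the choice.  Hence one of the two sequences is
-- ordered by ↓₂ or its negation.  By the Erdős–Rado theorem and Ehrenfeucht–Mostowski
-- models, so is a family of copies indexed by μ + 1 + μ*, for μ = κ_α(↓₂) and α the size
-- of A.  Let Qᵢ be the model generated by the points at distance < i from both ends.  By
-- (L) the middle copy of A is ↓₂-free over some Qᵢ from all the other points; but it
-- distinguishes the i-th points from the left and from the right, which have the same
-- type over Qᵢ, contradicting (U).  So ↓₁ ⊆ ↓₂ over M, and equality follows from (E)_M
-- for ↓₁ and (U)_M for ↓₂.
module Submission where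

open import Axiom.ExcludedMiddle using (ExcludedMiddle)
open import Axiom.Extensionality.Propositional using (Extensionality)
open import Data.Bool.Base using (Bool; true; false)
open import Data.Empty using (⊥; ⊥-elim)
open import Data.Fin.Base using () renaming (zero to fzero; suc to fsuc)
open import Data.Nat.Base using (ℕ; zero; suc; _≤′_; ≤′-refl; ≤′-step)
open import Data.Nat.Properties using (s≤′s)
open import Data.Product.Base using (Σ; Σ-syntax; ∃; ∃-syntax; _×_; _,_; proj₁; proj₂)
open import Data.Sum.Base using (_⊎_; inj₁; inj₂)
open import Data.Unit.Base using (⊤; tt)
open import Data.Vec.Base using (Vec; []; _∷_; map; head; tail; _++_)
open import Data.Vec.Properties using (map-∘; map-cong; map-id)
open import Data.Vec.Relation.Unary.All as All using (All; []; _∷_)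
open import Data.Vec.Relation.Unary.Any using (Any; here; there)
open import Function.Base using (_∘_; id)
open import Function.Bundles using (_⇔_; _↣_; _↔_; module Injection; module Equivalence; mk⇔; mk⤖; mk↣)
open import Function.Definitions using (Injective)
open import Function.Properties.Bijection using (⤖⇒↔)
open import Induction.WellFounded as WF using (Acc; acc)
open import Level using (Lift; lift; lower; _⊔_) renaming (suc to lsuc)
open import Relation.Binary.Definitions using (Tri; tri<; tri≈; tri>)
open import Relation.Binary.PropositionalEquality using (_≡_; refl; sym; trans; cong; cong₂; subst; subst₂)
  renaming (isEquivalence to ≡-isEquivalence)
open import Relation.Binary.Structures using (IsStrictTotalOrder)
open import Relation.Nullary using (¬_; Dec; yes; no)
open import Relation.Nullary.Decidable using (True; toWitness; fromWitness; ⌊_⌋)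

open import Defs
open Structure using () renaming (Carrier to ⟦_⟧)

-- OR is well-ordered and contains no copy of μ*, while the splitting argument needs points
-- converging from both sides of a middle one. This forces the passage to an Ehrenfeucht-Mostowski
-- family over another linear order, of which only the types of pairs over M are compared with the
-- original sequence. An AEC has no syntax. Skolem hulls are replaced by Löwenheim-Skolem hulls,
-- enumerated by a type depending only on the length of the tuple, and types by Boolean diagrams of
-- these enumerations, which are small enough to serve as colours for Erdős-Rado. The colimit over
-- finite subsets is not a well-ordered chain, so strongness of the generated submodels is proved by
-- induction along a filtration with finite increments.

-- Classical logic, quotients, Cantor-Bernstein and well-founded recursion

module Classical (lem : ∀ {a} → ExcludedMiddle a) where

  -- Resizes a proposition of any level into Set₀ and makes it proof-irrelevant.
  abstract
    Squash : ∀ {a} → Set a → Set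
    Squash P = True (lem {P = P})

    squash : ∀ {a} {P : Set a} → P → Squash P
    squash = fromWitness

    unsquash : ∀ {a} {P : Set a} → Squash P → P
    unsquash = toWitness

    Squash-irrelevant : ∀ {a} {P : Set a} (p q : Squash P) → p ≡ q
    Squash-irrelevant {P = P} p q with lem {P = P}
    Squash-irrelevant tt tt | yes _ = refl

  Σ-Squash-≡ : ∀ {a p} {A : Set a} {P : A → Set p} {x y : Σ A (λ z → Squash (P z))} →
               proj₁ x ≡ proj₁ y → x ≡ y
  Σ-Squash-≡ {x = x , p} {y = .x , q} refl = cong (x ,_) (Squash-irrelevant p q)

  dne : ∀ {a} {P : Set a} → ¬ ¬ P → P
  dne {P = P} ¬¬p with lem {P = P}
  ... | yes p = p
  ... | no ¬p = ⊥-elim (¬¬p ¬p)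

  ¬∀⇒∃¬ : ∀ {a b} {A : Set a} {P : A → Set b} → ¬ (∀ x → P x) → ∃[ x ] ¬ P x
  ¬∀⇒∃¬ ¬all = dne λ ¬ex → ¬all λ x → dne λ ¬px → ¬ex (x , ¬px)

  abstract
    -- Boolean codes resize propositions: a predicate on a type in `Set ℓ` then lives in `Set ℓ`,
    -- whatever its level, and two predicates are compared by equality of functions.
    decide : ∀ {a} → Set a → Bool
    decide P = ⌊ lem {P = P} ⌋

    decide-true : ∀ {a} {P : Set a} → P → decide P ≡ true
    decide-true {P = P} p with lem {P = P}
    ... | yes _ = refl
    ... | no ¬p = ⊥-elim (¬p p)

    decide-false : ∀ {a} {P : Set a} → ¬ P → decide P ≡ false
    decide-false {P = P} ¬p with lem {P = P}
    ... | yes p = ⊥-elim (¬p p)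
    ... | no _  = refl

    decide⁻ : ∀ {a} {P : Set a} → decide P ≡ true → P
    decide⁻ {P = P} eq with lem {P = P}
    ... | yes p = p

    decide-transfer : ∀ {a b} {P : Set a} {Q : Set b} → decide P ≡ decide Q → P → Q
    decide-transfer eq p = decide⁻ (trans (sym eq) (decide-true p))

    decide-cong : ∀ {a b} {P : Set a} {Q : Set b} → (P → Q) → (Q → P) → decide P ≡ decide Q
    decide-cong {P = P} {Q = Q} f g with lem {P = P}
    ... | yes p = sym (decide-true (f p))
    ... | no ¬p = sym (decide-false (¬p ∘ g))

  -- A class is coded by its Boolean characteristic function. By extensionality related points have
  -- equal codes, so an element chosen from the code alone is a canonical representative; the
  -- default `d` of `element` is never reached for a nonempty class. `Quot` is the set of fixed
  -- points of `rep`.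
  module Quotient (fe : ∀ {a b} → Extensionality a b)
    {a b} {X : Set a} (_~_ : X → X → Set b)
    (~-refl : ∀ {x} → x ~ x) (~-sym : ∀ {x y} → x ~ y → y ~ x)
    (~-trans : ∀ {x y z} → x ~ y → y ~ z → x ~ z) where

    private
      element : (X → Bool) → X → X
      element c d with lem {P = ∃[ y ] c y ≡ true}
      ... | yes (y , _) = y
      ... | no _ = d

      element-spec : ∀ (c : X → Bool) {x} (d : X) → c x ≡ true → c (element c d) ≡ true
      element-spec c d cx with lem {P = ∃[ y ] c y ≡ true}
      ... | yes (_ , cy) = cy
      ... | no ¬e = ⊥-elim (¬e (_ , cx))

      element-const : ∀ (c : X → Bool) {x} (d d′ : X) → c x ≡ true → element c d ≡ element c d′
      element-const c d d′ cx with lem {P = ∃[ y ] c y ≡ true}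
      ... | yes _ = refl
      ... | no ¬e = ⊥-elim (¬e (_ , cx))

      class : X → X → Bool
      class x y = decide (x ~ y)

    abstract
      rep : X → X
      rep x = element (class x) x

      ~-rep : ∀ x → x ~ rep x
      ~-rep x = decide⁻ (element-spec (class x) {x} x (decide-true (~-refl {x})))

      rep-cong : ∀ {x y} → x ~ y → rep x ≡ rep y
      rep-cong {x} {y} x~y =
        trans (cong (λ c → element c x) (fe {f = class x} {g = class y} λ z →
                 decide-cong (~-trans (~-sym x~y)) (~-trans x~y)))
              (element-const (class y) {y} x y (decide-true (~-refl {y})))

    Quot : Set a
    Quot = Σ[ x ∈ X ] Squash (rep x ≡ x)

    [_] : X → Quot
    [ x ] = rep x , squash (sym (rep-cong (~-rep x)))

    []-cong : ∀ {x y} → x ~ y → [ x ] ≡ [ y ]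
    []-cong x~y = Σ-Squash-≡ (rep-cong x~y)

    []-injective : ∀ {x y} → [ x ] ≡ [ y ] → x ~ y
    []-injective {x} {y} eq =
      ~-trans (subst (x ~_) (cong proj₁ eq) (~-rep x)) (~-sym (~-rep y))

    []-surjective : ∀ q → ∃[ x ] [ x ] ≡ q
    []-surjective (x , p) = x , Σ-Squash-≡ (unsquash p)

  cantor-bernstein : ∀ {a b} {A : Set a} {B : Set b} → A ↣ B → B ↣ A → A ↔ B
  cantor-bernstein {A = A} {B = B} f↣ g↣ = ⤖⇒↔ (mk⤖ (h-injective , h-surjective))
    where
    open Injection f↣ using () renaming (to to f; injective to f-inj)
    open Injection g↣ using () renaming (to to g; injective to g-inj)

    orbit : A → ℕ → A
    orbit a zero = a
    orbit a (suc n) = g (f (orbit a n))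

    -- The forward orbits of points outside the range of `g`: on these `h` follows `f`, elsewhere it
    -- inverts `g`.
    Escapes : A → Set _
    Escapes x = ∃[ a ] ∃[ n ] ¬ (∃[ b ] g b ≡ a) × orbit a n ≡ x

    pull : ∀ x → ¬ Escapes x → ∃[ b ] g b ≡ x
    pull x ¬e = dne λ ¬b → ¬e (x , 0 , ¬b , refl)

    h : A → B
    h x with lem {P = Escapes x}
    ... | yes _ = f x
    ... | no ¬e = proj₁ (pull x ¬e)

    h-yes : ∀ x → Escapes x → h x ≡ f x
    h-yes x e with lem {P = Escapes x}
    ... | yes _ = refl
    ... | no ¬e = ⊥-elim (¬e e)

    h-no : ∀ x → ¬ Escapes x → g (h x) ≡ x
    h-no x ¬e with lem {P = Escapes x}
    ... | yes e = ⊥-elim (¬e e)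
    ... | no ¬e′ = proj₂ (pull x ¬e′)

    step : ∀ x → Escapes x → Escapes (g (f x))
    step x (a , n , ¬b , eq) = a , suc n , ¬b , cong (g ∘ f) eq

    step⁻ : ∀ x → Escapes (g (f x)) → Escapes x
    step⁻ x (a , zero , ¬b , eq) = ⊥-elim (¬b (f x , sym eq))
    step⁻ x (a , suc n , ¬b , eq) = a , n , ¬b , f-inj (g-inj eq)

    h-injective : Injective _≡_ _≡_ h
    h-injective {x} {y} eq with lem {P = Escapes x} | lem {P = Escapes y}
    ... | yes ex | yes ey = f-inj eq
    ... | yes ex | no ¬ey = ⊥-elim (¬ey (subst Escapes
            (trans (cong g eq) (proj₂ (pull y ¬ey))) (step x ex)))
    ... | no ¬ex | yes ey = ⊥-elim (¬ex (subst Escapes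
            (trans (cong g (sym eq)) (proj₂ (pull x ¬ex))) (step y ey)))
    ... | no ¬ex | no ¬ey = trans (sym (proj₂ (pull x ¬ex))) (trans (cong g eq) (proj₂ (pull y ¬ey)))

    h-surjective : ∀ y → ∃[ x ] (∀ {z} → z ≡ x → h z ≡ y)
    h-surjective y with lem {P = Escapes (g y)}
    ... | no ¬e = g y , λ { refl → g-inj (h-no (g y) ¬e) }
    ... | yes (a , zero , ¬b , eq) = ⊥-elim (¬b (y , sym eq))
    ... | yes (a , suc n , ¬b , eq) =
          orbit a n , λ { refl → trans (h-yes _ (a , n , ¬b , refl)) (g-inj eq) }

  module WellOrders {w} (W : WellOrder w) where
    open WellOrder W
    open IsStrictTotalOrder isStrictTotalOrder public
      using (compare) renaming (trans to <-trans)

    <-irrefl : ∀ {x} → ¬ (x < x)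
    <-irrefl = IsStrictTotalOrder.irrefl isStrictTotalOrder refl

    _≤_ : Carrier → Carrier → Set w
    x ≤ y = ¬ (y < x)

    ≤⇒<⊎≡ : ∀ {x y} → x ≤ y → x < y ⊎ x ≡ y
    ≤⇒<⊎≡ {x} {y} x≤y with compare x y
    ... | tri< l _ _ = inj₁ l
    ... | tri≈ _ e _ = inj₂ e
    ... | tri> _ _ g = ⊥-elim (x≤y g)

    <⇒≤ : ∀ {x y} → x < y → x ≤ y
    <⇒≤ x<y y<x = <-irrefl (<-trans x<y y<x)

    ≤-<-trans : ∀ {x y z} → x ≤ y → y < z → x < z
    ≤-<-trans x≤y y<z with ≤⇒<⊎≡ x≤y
    ... | inj₁ x<y = <-trans x<y y<z
    ... | inj₂ refl = y<z

    <-≤-trans : ∀ {x y z} → x < y → y ≤ z → x < z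
    <-≤-trans x<y y≤z with ≤⇒<⊎≡ y≤z
    ... | inj₁ y<z = <-trans x<y y<z
    ... | inj₂ refl = x<y

    ≤-refl : ∀ {x} → x ≤ x
    ≤-refl = <-irrefl

    ≤-trans : ∀ {x y z} → x ≤ y → y ≤ z → x ≤ z
    ≤-trans x≤y y≤z z<x = y≤z (<-≤-trans z<x x≤y)

    ≤-antisym : ∀ {x y} → x ≤ y → y ≤ x → x ≡ y
    ≤-antisym x≤y y≤x with ≤⇒<⊎≡ x≤y
    ... | inj₁ x<y = ⊥-elim (y≤x x<y)
    ... | inj₂ eq = eq

    <-ind : ∀ {p} (P : Carrier → Set p) → (∀ x → (∀ y → y < x → P y) → P x) → ∀ x → P x
    <-ind P step x = go x (wellFounded x)
      where
      go : ∀ x → Acc _<_ x → P x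
      go x (acc rs) = step x λ y y<x → go y (rs y<x)

    IsLeast : ∀ {p} → (Carrier → Set p) → Carrier → Set _
    IsLeast P x = P x × (∀ y → P y → x ≤ y)

    abstract
      least : ∀ {p} (P : Carrier → Set p) → ∃ P → ∃ (IsLeast P)
      least P (x , px) = <-ind (λ x → P x → ∃ (IsLeast P)) step x px
        where
        step : ∀ x → (∀ y → y < x → P y → ∃ (IsLeast P)) → P x → ∃ (IsLeast P)
        step x ih px with lem {P = ∃[ y ] y < x × P y}
        ... | yes (y , y<x , py) = ih y y<x py
        ... | no ¬e = x , px , λ y py y<x → ¬e (y , y<x , py)

    -- Values of `b` outside the segment below i are replaced by the junk value d.
    abstract
      below : ∀ {c} {C : Set c} → C → Carrier → (Carrier → C) → Carrier → C
      below d i b j with lem {P = j < i}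
      ... | yes _ = b j
      ... | no _  = d

      below-< : ∀ {c} {C : Set c} (d : C) {i} b {j} → j < i → below d i b j ≡ b j
      below-< d {i} b {j} j<i with lem {P = j < i}
      ... | yes _ = refl
      ... | no ¬l = ⊥-elim (¬l j<i)

    -- `step` takes a total function instead of a dependent one on the predecessors; `rec-unfold`
    -- shows that it sees the values below i, and `d` elsewhere.
    module Recursion (fe : ∀ {a b} → Extensionality a b) {c} {C : Set c} (d : C)
                     (step : Carrier → (Carrier → C) → C) where
      private
        extend : ∀ i → (∀ {j} → j < i → C) → Carrier → C
        extend i b j with lem {P = j < i}
        ... | yes j<i = b j<i
        ... | no _    = d

        extend-cong : ∀ i {b b′ : ∀ {j} → j < i → C} →
                      (∀ {j} (p : j < i) → b p ≡ b′ p) → ∀ j → extend i b j ≡ extend i b′ j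
        extend-cong i eq j with lem {P = j < i}
        ... | yes j<i = eq j<i
        ... | no _    = refl

        abstract
          extend-below : ∀ i (b : Carrier → C) j → extend i (λ {j} _ → b j) j ≡ below d i b j
          extend-below i b j with lem {P = j < i}
          ... | yes _ = refl
          ... | no _  = refl

        body : ∀ i → (∀ {j} → j < i → C) → C
        body i b = step i (extend i b)

        body-cong : ∀ i {b b′ : ∀ {j} → j < i → C} →
                    (∀ {j} (p : j < i) → b p ≡ b′ p) → body i b ≡ body i b′
        body-cong i eq = cong (step i) (fe (extend-cong i eq))

        module Fix = WF.FixPoint wellFounded (λ _ → C) body body-cong

      abstract
        rec : Carrier → C
        rec = WF.All.wfRec wellFounded c (λ _ → C) body

        rec-unfold : ∀ i → rec i ≡ step i (below d i rec)
        rec-unfold i = trans Fix.unfold-wfRec (cong (step i) (fe (extend-below i rec)))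

-- Ordinals in OR: bounds, suprema, Hartogs numbers

module Ordinals (lem : ∀ {a} → ExcludedMiddle a) (fe : ∀ {a b} → Extensionality a b)
                {ℓ} (W : WellOrder (lsuc ℓ)) (isOR : IsOR W) where
  open Classical lem
  open WellOrder W using (_<_) renaming (Carrier to Ord)
  open WellOrders W

  Seg : Ord → Set ℓ
  Seg i = proj₁ (proj₁ isOR i)

  seg : ∀ i → Seg i → Ord
  seg i = proj₁ (proj₂ (proj₁ isOR i))

  seg-cover : ∀ i {j} → j < i → ∃[ s ] seg i s ≡ j
  seg-cover i = proj₂ (proj₂ (proj₁ isOR i)) _

  abstract
    inhabitant : Ord
    inhabitant = dne λ ¬o → proj₂ isOR (Lift ℓ ⊥ , (λ ()) , λ i _ → ⊥-elim (¬o i))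

    -- Regularity of OR. If `f` were unbounded, every ordinal would be some `f s` or lie below one,
    -- so OR would be covered by a union, indexed by `S`, of small initial segments.
    bound : {S : Set ℓ} (f : S → Ord) → ∃[ b ] (∀ s → f s < b)
    bound {S} f = dne λ ¬b → proj₂ isOR (all-small ¬b)
      where
      all-small : ¬ (∃[ b ] (∀ s → f s < b)) → IsSmall (λ (i : Ord) → i ≡ i)
      all-small ¬b = (Σ[ s ∈ S ] (⊤ ⊎ Seg (f s))) , e , cover
        where
        e : (Σ[ s ∈ S ] (⊤ ⊎ Seg (f s))) → Ord
        e (s , inj₁ _) = f s
        e (s , inj₂ x) = seg (f s) x
        cover : ∀ i → i ≡ i → ∃[ x ] e x ≡ i
        cover i _ with ¬∀⇒∃¬ (λ all → ¬b (i , all))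
        ... | s , i≤fs with ≤⇒<⊎≡ i≤fs
        ... | inj₂ refl = (s , inj₁ tt) , refl
        ... | inj₁ i<fs with seg-cover (f s) i<fs
        ... | x , refl = (s , inj₂ x) , refl

    bound-below : ∀ i (f : Ord → Ord) → ∃[ b ] (∀ j → j < i → f j < b)
    bound-below i f with bound (f ∘ seg i)
    ... | b , f<b = b , λ j j<i → let (s , eq) = seg-cover i j<i in subst (λ k → f k < b) eq (f<b s)

  abstract
    bound₂ : ∀ i j → ∃[ b ] (i < b × j < b)
    bound₂ i j with bound {S = Lift ℓ Bool} (λ { (lift true) → i ; (lift false) → j })
    ... | b , p = b , p (lift true) , p (lift false)

  private
    abstract
      successor : ∀ i → ∃ (IsLeast (i <_))
      successor i = least (i <_) (let (b , p , _) = bound₂ i i in b , p)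

  next : Ord → Ord
  next i = proj₁ (successor i)

  <-next : ∀ i → i < next i
  <-next i = proj₁ (proj₂ (successor i))

  next-≤ : ∀ {i j} → i < j → next i ≤ j
  next-≤ = proj₂ (proj₂ (successor _)) _

  <-next⁻ : ∀ {i j} → j < next i → j ≤ i
  <-next⁻ j<ni i<j = next-≤ i<j j<ni

  next-isSuccessor : ∀ i → IsSuccessorOf W (next i) i
  next-isSuccessor i = <-next i , λ k i<k → next-≤ i<k

  module Supremum {a} {S : Set a} (f : S → Ord) (bounded : ∃[ b ] (∀ s → f s < b)) where
    private
      abstract
        least-bound : ∃ (IsLeast (λ b → ∀ s → f s ≤ b))
        least-bound = least _ (let (b , p) = bounded in b , λ s → <⇒≤ (p s))

    sup : Ord
    sup = proj₁ least-bound

    ≤-sup : ∀ s → f s ≤ sup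
    ≤-sup = proj₁ (proj₂ least-bound)

    <-sup⁻ : ∀ {k} → k < sup → ∃[ s ] k < f s
    <-sup⁻ {k} k<sup = dne λ ¬e →
      proj₂ (proj₂ least-bound) k (λ s k<fs → ¬e (s , k<fs)) k<sup

    sup-limit : S → (∀ s → f s < sup) → IsLimitElement W sup
    sup-limit s₀ f<sup = (f s₀ , f<sup s₀) , λ k k<sup →
      let (s , k<fs) = <-sup⁻ k<sup in f s , k<fs , f<sup s

  data Position (i : Ord) : Set (lsuc ℓ) where
    is-zero : (∀ j → ¬ (j < i)) → Position i
    is-next : ∀ j → i ≡ next j → Position i
    is-lim  : (∃[ j ] j < i) → (∀ {j} → j < i → next j < i) → Position i

  abstract
    position : ∀ i → Position i
    position i with lem {P = ∃[ j ] j < i} | lem {P = ∃[ j ] i ≡ next j}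
    ... | no ¬e | _ = is-zero λ j j<i → ¬e (j , j<i)
    ... | yes _ | yes (j , eq) = is-next j eq
    ... | yes e | no ¬s = is-lim e λ {j} j<i → lemma j j<i (≤⇒<⊎≡ (next-≤ j<i))
      where
      lemma : ∀ j → j < i → next j < i ⊎ next j ≡ i → next j < i
      lemma j _ (inj₁ l) = l
      lemma j _ (inj₂ eq) = ⊥-elim (¬s (j , sym eq))

    -- Later used to thin OR until all that is built at one selected index lies below the next one.
    sparse : (f : Ord → Ord) → Σ[ u ∈ (Ord → Ord) ] (∀ {i j} → i < j → f (u i) < u j)
    sparse f = rec , λ {i} {j} i<j →
      subst (f (rec i) <_) (sym (rec-unfold j))
        (subst (λ k → f k < _) (below-< inhabitant rec i<j)
          (proj₂ (bound-below j (f ∘ below inhabitant j rec)) i i<j))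
      where open Recursion fe inhabitant (λ i u → proj₁ (bound-below i (f ∘ u)))

  increasing-≤ : ∀ {k} (h : Ord → Ord) →
                 (∀ i j → i < j → j < k → h i < h j) → ∀ i → i < k → i ≤ h i
  increasing-≤ {k} h inc = <-ind _ λ i ih i<k hi<i →
    ih (h i) hi<i (<-trans hi<i i<k) (inc (h i) i hi<i i<k)

  InjectiveBelow : ∀ {a} {A : Set a} → Ord → (Ord → A) → Set _
  InjectiveBelow i f = ∀ x y → x < i → y < i → f x ≡ f y → x ≡ y

  injection-small : ∀ {S : Set ℓ} (f : Ord → S) → ¬ (∀ {x y} → f x ≡ f y → x ≡ y)
  injection-small {S} f inj = proj₂ isOR (S , e , cover)
    where
    e : S → Ord
    e s with lem {P = ∃[ i ] f i ≡ s}
    ... | yes (i , _) = i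
    ... | no _ = inhabitant
    cover : ∀ i → i ≡ i → ∃[ s ] e s ≡ i
    cover i _ with lem {P = ∃[ j ] f j ≡ f i} in eq
    ... | yes (j , p) = f i , trans (lemma eq) (inj p)
      where
      lemma : lem {P = ∃[ j ] f j ≡ f i} ≡ yes (j , p) → e (f i) ≡ j
      lemma eq rewrite eq = refl
    ... | no ¬e = ⊥-elim (¬e (i , refl))

  private
    -- A failing bound would code every ordinal by a well-ordering of a subset of S.
    hartogs′ : (S : Set ℓ) → ∃[ Λ ] (∀ (f : Ord → S) → ¬ InjectiveBelow Λ f)
    hartogs′ S = dne λ none →
      let f : ∀ Λ → ∃[ f ] InjectiveBelow Λ f
          f Λ = dne λ ¬f → none (Λ , λ f inj → ¬f (f , inj))
      in injection-small (code f) (code-injective f)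
      where
      module _ (F : ∀ Λ → Σ[ f ∈ (Ord → S) ] InjectiveBelow Λ f) where
        D : Ord → S → Set (lsuc ℓ)
        D Λ s = ∃[ x ] (x < Λ × proj₁ (F Λ) x ≡ s)

        R : Ord → S → S → Set (lsuc ℓ)
        R Λ s s′ = ∃[ x ] ∃[ y ] (x < y × y < Λ × proj₁ (F Λ) x ≡ s × proj₁ (F Λ) y ≡ s′)

        code : Ord → (S → Bool) × (S → S → Bool)
        code Λ = (λ s → decide (D Λ s)) , (λ s s′ → decide (R Λ s s′))

        -- Equal codes match each y < Λ′ with the `h y` < Λ that names the same element of `S`. This
        -- `h` is increasing, so Λ ≤ `h Λ`, against `h Λ` < Λ.
        code-≮ : ∀ {Λ Λ′} → code Λ ≡ code Λ′ → ¬ (Λ < Λ′)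
        code-≮ {Λ} {Λ′} eq Λ<Λ′ =
          increasing-≤ h inc Λ Λ<Λ′ (proj₁ (h-spec Λ Λ<Λ′))
          where
          f = proj₁ (F Λ)
          f′ = proj₁ (F Λ′)

          H : ∀ y → y < Λ′ → D Λ (f′ y)
          H y y<Λ′ = decide-transfer (sym (cong (λ c → proj₁ c (f′ y)) eq)) (y , y<Λ′ , refl)

          h : Ord → Ord
          h y with lem {P = y < Λ′}
          ... | yes p = proj₁ (H y p)
          ... | no _ = y

          h-spec : ∀ y → y < Λ′ → h y < Λ × f (h y) ≡ f′ y
          h-spec y p with lem {P = y < Λ′}
          ... | yes p = proj₂ (H y p)
          ... | no ¬p = ⊥-elim (¬p p)

          inc : ∀ y y′ → y < y′ → y′ < Λ′ → h y < h y′
          inc y y′ y<y′ y′<Λ′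
            with decide-transfer {Q = R Λ (f′ y) (f′ y′)}
                   (sym (cong (λ c → proj₂ c (f′ y) (f′ y′)) eq)) (y , y′ , y<y′ , y′<Λ′ , refl , refl)
               | h-spec y (<-trans y<y′ y′<Λ′) | h-spec y′ y′<Λ′
          ... | x , x′ , x<x′ , x′<Λ , e , e′ | hy< , he | hy′< , he′
            with refl ← proj₂ (F Λ) x (h y) (<-trans x<x′ x′<Λ) hy< (trans e (sym he))
               | refl ← proj₂ (F Λ) x′ (h y′) x′<Λ hy′< (trans e′ (sym he′)) = x<x′

        code-injective : ∀ {Λ Λ′} → code Λ ≡ code Λ′ → Λ ≡ Λ′
        code-injective eq = ≤-antisym (code-≮ (sym eq)) (code-≮ eq)

    -- Zermelo's argument: `g` lists new elements of `Z` while there are any. Were it never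
    -- exhausted, it would inject OR into a type in `Set ℓ`; so every element has an index.
    embed′ : (Z : Set ℓ) → Σ[ f ∈ (Z → Ord) ] (∀ {x y} → f x ≡ f y → x ≡ y)
    embed′ Z with lem {P = Z}
    ... | no ¬z = (λ z → ⊥-elim (¬z z)) , λ {z} _ → ⊥-elim (¬z z)
    ... | yes z₀ = (λ z → proj₁ (index z)) , λ {x} {y} eq →
          trans (sym (proj₂ (index x))) (trans (cong g eq) (proj₂ (index y)))
      where
      New : Ord → (Ord → Z) → Set (lsuc ℓ)
      New i g = ∃[ z ] (∀ j → j < i → ¬ (g j ≡ z))

      choose : Ord → (Ord → Z) → Z
      choose i g with lem {P = New i g}
      ... | yes (z , _) = z
      ... | no _ = z₀

      choose-new : ∀ i g → New i g → ∀ j → j < i → ¬ (g j ≡ choose i g)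
      choose-new i g new with lem {P = New i g}
      ... | yes (_ , p) = p
      ... | no ¬new = ⊥-elim (¬new new)

      open Recursion fe z₀ choose renaming (rec to g; rec-unfold to g-unfold)

      g-new : ∀ i → New i g → ∀ j → j < i → ¬ (g j ≡ g i)
      g-new i (z , new) j j<i eq =
        choose-new i (below z₀ i g)
          (z , λ k k<i e → new k k<i (trans (sym (below-< z₀ g k<i)) e)) j j<i
          (trans (below-< z₀ g j<i) (trans eq (g-unfold i)))

      exhausted : ∃[ i ] ¬ New i g
      exhausted = ¬∀⇒∃¬ λ new → injection-small g λ {x} {y} eq → case-compare new x y eq
        where
        case-compare : (∀ i → New i g) → ∀ x y → g x ≡ g y → x ≡ y
        case-compare new x y eq with compare x y
        ... | tri< l _ _ = ⊥-elim (g-new y (new y) x l eq)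
        ... | tri≈ _ e _ = e
        ... | tri> _ _ l = ⊥-elim (g-new x (new x) y l (sym eq))

      index : ∀ z → ∃[ j ] g j ≡ z
      index z = dne λ ¬j → proj₂ exhausted (z , λ j _ e → ¬j (j , e))

  abstract
    hartogs : (S : Set ℓ) → ∃[ Λ ] (∀ (f : Ord → S) → ¬ InjectiveBelow Λ f)
    hartogs = hartogs′

    embed : (Z : Set ℓ) → Σ[ f ∈ (Z → Ord) ] (∀ {x y} → f x ≡ f y → x ≡ y)
    embed = embed′

-- Finite order embeddings acting on vectors

infix 4 _⊑_

-- Order-preserving injections from an m-element to an n-element chain.
data _⊑_ : ℕ → ℕ → Set where
  end  : 0 ⊑ 0
  keep : ∀ {m n} → m ⊑ n → suc m ⊑ suc n
  drop : ∀ {m n} → m ⊑ n → m ⊑ suc n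

select : ∀ {a} {A : Set a} {m n} → m ⊑ n → Vec A n → Vec A m
select end [] = []
select (keep f) (x ∷ v) = x ∷ select f v
select (drop f) (x ∷ v) = select f v

⊑-refl : ∀ {n} → n ⊑ n
⊑-refl {zero} = end
⊑-refl {suc n} = keep ⊑-refl

select-refl : ∀ {a} {A : Set a} {n} (v : Vec A n) → select ⊑-refl v ≡ v
select-refl [] = refl
select-refl (x ∷ v) = cong (x ∷_) (select-refl v)

⊑-trans : ∀ {k m n} → k ⊑ m → m ⊑ n → k ⊑ n
⊑-trans f end = f
⊑-trans f (drop g) = drop (⊑-trans f g)
⊑-trans (keep f) (keep g) = keep (⊑-trans f g)
⊑-trans (drop f) (keep g) = drop (⊑-trans f g)

select-trans : ∀ {a} {A : Set a} {k m n} (f : k ⊑ m) (g : m ⊑ n) (v : Vec A n) →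
               select (⊑-trans f g) v ≡ select f (select g v)
select-trans f end [] = refl
select-trans f (drop g) (x ∷ v) = select-trans f g v
select-trans (keep f) (keep g) (x ∷ v) = cong (x ∷_) (select-trans f g v)
select-trans (drop f) (keep g) (x ∷ v) = select-trans f g v

select-map : ∀ {a b} {A : Set a} {B : Set b} (h : A → B) {m n} (f : m ⊑ n) v →
             select f (map h v) ≡ map h (select f v)
select-map h end [] = refl
select-map h (keep f) (x ∷ v) = cong (h x ∷_) (select-map h f v)
select-map h (drop f) (x ∷ v) = select-map h f v

select-All : ∀ {a p} {A : Set a} {P : A → Set p} {m n} (f : m ⊑ n) {v : Vec A n} →
             All P v → All P (select f v)
select-All end [] = []
select-All (keep f) (px ∷ pv) = px ∷ select-All f pv
select-All (drop f) (px ∷ pv) = select-All f pv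

map-preimage : ∀ {a b p} {A : Set a} {B : Set b} (g : A → B) {P : B → Set p} →
               (∀ {y} → P y → ∃[ x ] g x ≡ y) → ∀ {n} {ys : Vec B n} → All P ys → ∃[ xs ] map g xs ≡ ys
map-preimage g pre [] = [] , refl
map-preimage g pre (py ∷ pys) with pre py | map-preimage g pre pys
... | x , refl | xs , refl = x ∷ xs , refl

map-cong-All : ∀ {a b p} {A : Set a} {B : Set b} {P : A → Set p} {f g : A → B} →
               (∀ {x} → P x → f x ≡ g x) → ∀ {n} {xs : Vec A n} → All P xs → map f xs ≡ map g xs
map-cong-All eq [] = refl
map-cong-All eq (px ∷ pxs) = cong₂ _∷_ (eq px) (map-cong-All eq pxs)

All-map : ∀ {a b p q} {A : Set a} {B : Set b} {P : A → Set p} {Q : B → Set q} (f : A → B) →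
          (∀ {x} → P x → Q (f x)) → ∀ {n} {xs : Vec A n} → All P xs → All Q (map f xs)
All-map f h [] = []
All-map f h (px ∷ pxs) = h px ∷ All-map f h pxs

module Descending {a r} {A : Set a} (_<_ : A → A → Set r) where
  data Desc : ∀ {n} → Vec A n → Set (a ⊔ r) where
    []  : Desc []
    _∷_ : ∀ {n x} {v : Vec A n} → All (_< x) v → Desc v → Desc (x ∷ v)

  select-Desc : ∀ {m n} (f : m ⊑ n) {v : Vec A n} → Desc v → Desc (select f v)
  select-Desc end [] = []
  select-Desc (keep f) (p ∷ d) = select-All f p ∷ select-Desc f d
  select-Desc (drop f) (p ∷ d) = select-Desc f d

-- The Erdős-Rado theorem and templates of indiscernibles

module Partition (lem : ∀ {a} → ExcludedMiddle a) (fe : ∀ {a b} → Extensionality a b)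
                 {ℓ} (W : WellOrder (lsuc ℓ)) (isOR : IsOR W) where
  open Classical lem
  open Ordinals lem fe W isOR
  open WellOrder W using (_<_) renaming (Carrier to Ord)
  open WellOrders W
  open Descending _<_ public

  IncreasingBelow : Ord → (Ord → Ord) → Set (lsuc ℓ)
  IncreasingBelow k e = ∀ {i j} → i < j → j < k → e i < e j

  Desc-map : ∀ {k e n} {v : Vec Ord n} → IncreasingBelow k e →
             All (_< k) v → Desc v → Desc (map e v)
  Desc-map inc [] [] = []
  Desc-map {k} {e} inc (x<k ∷ v<k) (v<x ∷ d) = All-map e (λ y<x → inc y<x x<k) v<x ∷ Desc-map inc v<k d

  MonochromaticBelow : ∀ {n} {C : Set ℓ} → (Vec Ord n → C) → C → Ord → (Ord → Ord) → Set (lsuc ℓ)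
  MonochromaticBelow χ t k e = ∀ {v} → Desc v → All (_< k) v → χ (map e v) ≡ t

  -- Tuples list their largest entry first. Along `e` the colour does not depend on that entry,
  -- which may therefore be replaced by the extra last point `e k`; hence the domain `next k`.
  EndHomogeneous : ∀ n → Set ℓ → Ord → Ord → Set (lsuc ℓ)
  EndHomogeneous n C k Λ = ∀ (χ : Vec Ord (suc n) → C) →
    ∃[ e ] (IncreasingBelow (next k) e × (∀ {i} → i ≤ k → e i < Λ) ×
      (∀ {i v} → i ≤ k → All (_< i) v → χ (e i ∷ map e v) ≡ χ (e k ∷ map e v)))

  -- The branch b of x in the Erdős–Rado tree of χ; a branch which reaches x
  -- determines x from its length and the colours seen by x on it.
  end-homogeneous : ∀ n (C : Set ℓ) (k : Ord) → ∃ (EndHomogeneous n C k)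
  end-homogeneous n C k = Λ , branch-exists
    where
    S : Set ℓ
    S = Seg (next k) × (Vec (Seg (next k)) n → C)

    abstract
      Λ : Ord
      Λ = proj₁ (hartogs S)

      no-code : ∀ (f : Ord → S) → ¬ InjectiveBelow Λ f
      no-code = proj₂ (hartogs S)

    module _ (χ : Vec Ord (suc n) → C) where
      Candidate : Ord → Ord → (Ord → Ord) → Ord → Set (lsuc ℓ)
      Candidate x i b y = (∀ {j} → j < i → b j < y) ×
        (∀ {v} → All (_< i) v → χ (y ∷ map b v) ≡ χ (x ∷ map b v))

      pick : Ord → Ord → (Ord → Ord) → Ord
      pick x i b with lem {P = ∃ (Candidate x i b)}
      ... | yes c = proj₁ (least _ c)
      ... | no _ = x

      pick-least : ∀ x i b → ∃ (Candidate x i b) → IsLeast (Candidate x i b) (pick x i b)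
      pick-least x i b c with lem {P = ∃ (Candidate x i b)}
      ... | yes c = proj₂ (least _ c)
      ... | no ¬c = ⊥-elim (¬c c)

      module Branch (x : Ord) = Recursion fe inhabitant (pick x)

      b : Ord → Ord → Ord
      b x = Branch.rec x

      candidate-cong : ∀ {x i b b′ y} → (∀ {j} → j < i → b j ≡ b′ j) →
                       Candidate x i b y → Candidate x i b′ y
      candidate-cong {x} {y = y} eq (p , q) =
        (λ j<i → subst (_< _) (eq j<i) (p j<i)) ,
        λ {v} v<i → subst (λ w → χ (y ∷ w) ≡ χ (x ∷ w)) (map-cong-All eq v<i) (q v<i)

      b-least : ∀ x i → (∀ {j} → j < i → b x j < x) → IsLeast (Candidate x i (b x)) (b x i)
      b-least x i b<x with pick-least x i (below inhabitant i (b x))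
                             (x , (λ j<i → subst (_< x) (sym (below-< _ (b x) j<i)) (b<x j<i)) , λ _ → refl)
      ... | c , l = subst (Candidate x i (b x)) (sym (Branch.rec-unfold x i)) (candidate-cong (below-< _ (b x)) c) ,
                    λ y cy → subst (_≤ y) (sym (Branch.rec-unfold x i))
                      (l y (candidate-cong (λ j<i → sym (below-< _ (b x) j<i)) cy))

      Stops : Ord → Ord → Set (lsuc ℓ)
      Stops x i = i ≤ k × ¬ (b x i < x)

      FirstStop : Ord → Set (lsuc ℓ)
      FirstStop x = ∃[ i ] (i ≤ k × b x i ≡ x × (∀ {j} → j < i → b x j < x))

      first-stop : ∀ x → ∃ (Stops x) → FirstStop x
      first-stop x s with least _ s
      ... | i , (i≤k , b≮x) , l = i , i≤k , ≤-antisym (proj₂ (b-least x i b<x) x self) b≮x , b<x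
        where
        b<x : ∀ {j} → j < i → b x j < x
        b<x j<i = dne λ b≮x → l _ (≤-trans (<⇒≤ j<i) i≤k , b≮x) j<i
        self : Candidate x i (b x) x
        self = b<x , λ _ → refl

      module _ (stop : ∀ x → x < Λ → FirstStop x) where
        stop-seg : ∀ x p → ∃[ s ] seg (next k) s ≡ proj₁ (stop x p)
        stop-seg x p = seg-cover (next k) (≤-<-trans (proj₁ (proj₂ (stop x p))) (<-next k))

        code : Ord → S
        code x with lem {P = x < Λ}
        ... | yes p = proj₁ (stop-seg x p) , λ w → χ (x ∷ map (b x) (map (seg (next k)) w))
        ... | no _ = proj₁ (seg-cover (next k) (<-next k)) , λ w → χ (x ∷ map (b x) (map (seg (next k)) w))

        code-yes : ∀ x → x < Λ → Σ[ p ∈ x < Λ ] code x ≡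
          (proj₁ (stop-seg x p) , λ w → χ (x ∷ map (b x) (map (seg (next k)) w)))
        code-yes x x<Λ with lem {P = x < Λ}
        ... | yes p = p , refl
        ... | no ¬p = ⊥-elim (¬p x<Λ)

        code-injective : InjectiveBelow Λ code
        code-injective x y x<Λ y<Λ eq with code-yes x x<Λ | code-yes y y<Λ
        ... | p , ex | q , ey = go (stop x p) (stop y q)
                (trans (sym (proj₂ (stop-seg x p)))
                  (trans (cong (seg (next k)) (cong proj₁ eq′)) (proj₂ (stop-seg y q))))
                (λ w → cong (λ s → proj₂ s w) eq′)
          where
          eq′ = trans (sym ex) (trans eq ey)
          go : (s : FirstStop x) (s′ : FirstStop y) → proj₁ s ≡ proj₁ s′ →
               (∀ w → χ (x ∷ map (b x) (map (seg (next k)) w)) ≡ χ (y ∷ map (b y) (map (seg (next k)) w))) →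
               x ≡ y
          go (i , i≤k , bi , b<x) (_ , _ , bi′ , b<y) refl colours =
            trans (sym bi) (trans (agree i ≤-refl) bi′)
            where
            -- Once the branches agree below j, equal colours give both points the same candidates
            -- at j, and the least candidates coincide.
            agree : ∀ j → j ≤ i → b x j ≡ b y j
            agree = <-ind _ λ j ih j≤i →
              let same : ∀ {j′} → j′ < j → b x j′ ≡ b y j′
                  same j′<j = ih _ j′<j (<⇒≤ (<-≤-trans j′<j j≤i))
                  ≤i : ∀ {j′} → j′ < j → j′ < i
                  ≤i j′<j = <-≤-trans j′<j j≤i
                  col : ∀ {v} → All (_< j) v → χ (x ∷ map (b x) v) ≡ χ (y ∷ map (b y) v)
                  col {v} v<j =
                    let (w , e) = map-preimage (seg (next k)) {P = _< j}
                                    (λ l → seg-cover (next k) (<-trans (<-≤-trans l (≤-trans j≤i i≤k)) (<-next k))) v<j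
                    in subst (λ v → χ (x ∷ map (b x) v) ≡ χ (y ∷ map (b y) v)) e (colours w)
                  Lx = b-least x j (λ l → b<x (≤i l))
                  Ly = b-least y j (λ l → b<y (≤i l))
                  x→y : ∀ {z} → Candidate x j (b x) z → Candidate y j (b y) z
                  x→y {z} (c , d) = (λ l → subst (_< z) (same l) (c l)) ,
                    λ {v} v<j → trans (cong (λ w → χ (z ∷ w)) (sym (map-cong-All same v<j)))
                                      (trans (d v<j) (col v<j))
                  y→x : ∀ {z} → Candidate y j (b y) z → Candidate x j (b x) z
                  y→x {z} (c , d) = (λ l → subst (_< z) (sym (same l)) (c l)) ,
                    λ {v} v<j → trans (cong (λ w → χ (z ∷ w)) (map-cong-All same v<j))
                                      (trans (d v<j) (sym (col v<j)))
              in ≤-antisym (proj₂ Lx _ (y→x (proj₁ Ly))) (proj₂ Ly _ (x→y (proj₁ Lx)))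

      branch-exists : ∃[ e ] (IncreasingBelow (next k) e × (∀ {i} → i ≤ k → e i < Λ) ×
        (∀ {i v} → i ≤ k → All (_< i) v → χ (e i ∷ map e v) ≡ χ (e k ∷ map e v)))
      -- If the branch of every x < Λ reached x at an index ≤ k, `code` would be injective below the
      -- Hartogs bound. So the branch of some x < Λ stays below x up to k.
      branch-exists = long (dne λ none → no-code
                        (code λ x x<Λ → first-stop x (dne λ ¬s → none (x , x<Λ , λ i i≤k → dne λ b≮x → ¬s (i , i≤k , b≮x))))
                        (code-injective _))
        where
        long : ∃[ x ] (x < Λ × (∀ i → i ≤ k → b x i < x)) → _
        long (x , x<Λ , b<x) = b x ,
          (λ {i} {j} i<j j<nk → proj₁ (cand j (<-next⁻ j<nk)) i<j) ,
          (λ {i} i≤k → <-trans (b<x i i≤k) x<Λ) ,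
          λ {i} {v} i≤k v<i → trans (proj₂ (cand i i≤k) v<i)
            (sym (proj₂ (cand k ≤-refl) (All.map (λ l → <-≤-trans l i≤k) v<i)))
          where
          cand : ∀ i → i ≤ k → Candidate x i (b x) (b x i)
          cand i i≤k = proj₁ (b-least x i λ j<i → b<x _ (≤-trans (<⇒≤ j<i) i≤k))

  Homogeneous : ∀ n → Set ℓ → Ord → Ord → Set (lsuc ℓ)
  Homogeneous n C k Λ = ∀ (χ : Vec Ord n → C) →
    ∃[ e ] ∃[ t ] (IncreasingBelow k e × (∀ {i} → i < k → e i < Λ) × MonochromaticBelow χ t k e)

  -- With the head fixed as `e k′`, χ becomes a colouring of n-tuples; end-homogeneity makes the
  -- colour found for it the colour of all (n + 1)-tuples along the composed sequence.
  homogeneous-suc : ∀ {n C k k′ Λ} → Homogeneous n C k k′ → EndHomogeneous n C k′ Λ →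
                    Homogeneous (suc n) C k Λ
  homogeneous-suc {k = k} {k′} {Λ} er eh χ with eh χ
  ... | e , inc , e<Λ , hom with er (λ v → χ (e k′ ∷ map e v))
  ... | e′ , t , inc′ , e′<k′ , mono =
        e ∘ e′ , t ,
        (λ {_} {_} i<j j<k → inc (inc′ i<j j<k) (<-trans (e′<k′ j<k) (<-next k′))) ,
        (λ {i} i<k → e<Λ (<⇒≤ (e′<k′ i<k))) ,
        mono′
    where
    mono′ : MonochromaticBelow χ t k (e ∘ e′)
    mono′ {x ∷ v} (v<x ∷ d) (x<k ∷ v<k) =
      trans (cong (λ w → χ (e (e′ x) ∷ w)) (map-∘ e e′ v))
      (trans (hom {e′ x} (<⇒≤ (e′<k′ x<k)) (All-map e′ (λ y<x → inc′ y<x x<k) v<x))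
             (mono d v<k))

  homogeneous-zero : ∀ C k → Homogeneous zero C k k
  homogeneous-zero C k χ = (λ i → i) , χ [] , (λ {i} {j} i<j _ → i<j) , (λ {i} p → p) , mono
    where
    mono : MonochromaticBelow χ (χ []) k (λ i → i)
    mono [] [] = refl

  abstract
    erdős-rado : ∀ n (C : Set ℓ) (k : Ord) → ∃ (Homogeneous n C k)
    erdős-rado zero C k = k , homogeneous-zero C k
    erdős-rado (suc n) C k =
      let (k′ , er) = erdős-rado n C k
          (Λ , eh) = end-homogeneous n C k′
      in Λ , homogeneous-suc {n} {C} {k} {k′} {Λ} er eh

  -- A single homogeneous sequence of length OR would require a form of weak compactness. Instead a
  -- whole class of sequences, with members of every length and closed under subsequences, is
  -- refined one arity at a time.
  record Family : Set (lsuc (lsuc ℓ)) where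
    field
      Mem      : Ord → (Ord → Ord) → Set (lsuc ℓ)
      mem-inc  : ∀ {k e} → Mem k e → IncreasingBelow k e
      long     : ∀ k → ∃ (Mem k)
      restrict : ∀ {k Λ e e′} → Mem Λ e → IncreasingBelow k e′ → (∀ {i} → i < k → e′ i < Λ) → Mem k (e ∘ e′)

  open Family

  -- If each colour failed at some length, there would be a length k beyond all of these, as the
  -- colours form a type in `Set ℓ`. Erdős-Rado for k, applied along a long member of the family,
  -- yields a colour that does not fail.
  homogenize : (𝓕 : Family) → ∀ {n} {C : Set ℓ} (χ : Vec Ord n → C) →
               ∃[ t ] ∀ k → ∃[ e ] (Mem 𝓕 k e × MonochromaticBelow χ t k e)
  homogenize 𝓕 {n} {C} χ = dne contradiction
    where
    Good : C → Ord → Set (lsuc ℓ)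
    Good t k = ∃[ e ] (Mem 𝓕 k e × MonochromaticBelow χ t k e)

    contradiction : ¬ ¬ (∃[ t ] ∀ k → Good t k)
    contradiction none = refute (bound (proj₁ ∘ bad))
      where
      bad : ∀ t → ∃[ k ] ¬ Good t k
      bad t = ¬∀⇒∃¬ λ all → none (t , all)

      refute : ¬ (∃[ k ] ∀ t → proj₁ (bad t) < k)
      refute (k , bad<k) with erdős-rado n C k
      ... | Λ , er with long 𝓕 Λ
      ... | e , mem with er (χ ∘ map e)
      ... | e′ , t , inc′ , e′<Λ , mono = proj₂ (bad t) (e ∘ e′ ,
            restrict 𝓕 mem (λ i<j j<k → inc′ i<j (<-trans j<k (bad<k t))) (λ i<k → e′<Λ (<-trans i<k (bad<k t))) ,
            λ {v} d v<k → trans (cong χ (map-∘ e e′ v)) (mono d (All.map (λ l → <-trans l (bad<k t)) v<k)))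

  refine : (𝓕 : Family) → ∀ {n} {C : Set ℓ} (χ : Vec Ord n → C) (t : C) →
           (∀ k → ∃[ e ] (Mem 𝓕 k e × MonochromaticBelow χ t k e)) → Family
  refine 𝓕 χ t all = record
    { Mem      = λ k e → Mem 𝓕 k e × MonochromaticBelow χ t k e
    ; mem-inc  = λ m → mem-inc 𝓕 (proj₁ m)
    ; long     = all
    ; restrict = λ { {k} {Λ} {e} {e′} (m , mono) inc e′<Λ → restrict 𝓕 m inc e′<Λ ,
        λ {v} d v<k → trans (cong χ (map-∘ e e′ v)) (mono (Desc-map inc v<k d) (All-map e′ e′<Λ v<k)) }
    }

  ⊑⇒≤′ : ∀ {m n} → m ⊑ n → m ≤′ n
  ⊑⇒≤′ end = ≤′-refl
  ⊑⇒≤′ (keep f) = s≤′s (⊑⇒≤′ f)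
  ⊑⇒≤′ (drop f) = ≤′-step (⊑⇒≤′ f)

  increasing : Family
  increasing = record
    { Mem      = IncreasingBelow
    ; mem-inc  = λ inc → inc
    ; long     = λ k → (λ i → i) , λ i<j _ → i<j
    ; restrict = λ inc inc′ e′<Λ i<j j<k → inc (inc′ i<j j<k) (e′<Λ j<k)
    }

  chain-of-length : ∀ n → ∃[ k ] Σ[ v ∈ Vec Ord n ] (Desc v × All (_< k) v)
  chain-of-length zero = inhabitant , [] , [] , []
  chain-of-length (suc n) with chain-of-length n
  ... | k , v , d , v<k = next k , k ∷ v , v<k ∷ d , <-next k ∷ All.map (λ l → <-trans l (<-next k)) v<k

  module _ {C : ℕ → Set ℓ} (χ : ∀ n → Vec Ord n → C n) where
    private
      𝓕 : ℕ → Family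
      𝓕 zero = increasing
      𝓕 (suc n) = refine (𝓕 n) (χ n) (proj₁ (homogenize (𝓕 n) (χ n))) (proj₂ (homogenize (𝓕 n) (χ n)))

      colour : ∀ n → C n
      colour n = proj₁ (homogenize (𝓕 n) (χ n))

      mono : ∀ {m n k e} → m ≤′ n → Mem (𝓕 (suc n)) k e → MonochromaticBelow (χ m) (colour m) k e
      mono ≤′-refl mem = proj₂ mem
      mono (≤′-step m≤n) mem = mono m≤n (proj₁ mem)

    private
      template′ : Σ[ t ∈ (∀ n → C n) ] Σ[ s ∈ (∀ n → Vec Ord n) ]
        ((∀ n → Desc (s n)) × (∀ {m n} (f : m ⊑ n) → χ m (select f (s n)) ≡ t m))
      template′ = colour , s , s-desc , s-colour
        where
        base : ∀ n → ∃[ k ] Σ[ v ∈ Vec Ord n ] (Desc v × All (_< k) v)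
        base = chain-of-length

        e : ∀ n → ∃ (Mem (𝓕 (suc n)) (proj₁ (base n)))
        e n = long (𝓕 (suc n)) (proj₁ (base n))

        s : ∀ n → Vec Ord n
        s n = map (proj₁ (e n)) (proj₁ (proj₂ (base n)))

        s-desc : ∀ n → Desc (s n)
        s-desc n with base n | e n
        ... | k , v , d , v<k | e , mem = Desc-map (mem-inc (𝓕 (suc n)) mem) v<k d

        s-colour : ∀ {m n} (f : m ⊑ n) → χ m (select f (s n)) ≡ colour m
        s-colour {m} {n} f with base n | e n
        ... | k , v , d , v<k | e , mem = trans (cong (χ m) (select-map e f v))
                (mono (⊑⇒≤′ f) mem (select-Desc f d) (select-All f v<k))

    abstract
      -- Along a member of `𝓕 (suc n)` every arity up to n is monochromatic in its final colour, so
      -- `s n` is read off such a member. For different n the `s n` are unrelated: what is uniform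
      -- is the colour of the subtuples of each arity.
      template : Σ[ t ∈ (∀ n → C n) ] Σ[ s ∈ (∀ n → Vec Ord n) ]
        ((∀ n → Desc (s n)) × (∀ {m n} (f : m ⊑ n) → χ m (select f (s n)) ≡ t m))
      template = template′

All-directed : ∀ {i x p} {I : Set i} {X : Set x} (D : I → X → Set p) → I →
               (∀ i j → ∃[ k ] ((∀ {x} → D i x → D k x) × (∀ {x} → D j x → D k x))) →
               ∀ {n} {xs : Vec X n} → All (λ x → ∃[ i ] D i x) xs → ∃[ i ] All (D i) xs
All-directed D i₀ dir [] = i₀ , []
All-directed D i₀ dir ((i , d) ∷ ds) with All-directed D i₀ dir ds
... | j , ds′ with dir i j
... | k , i⊆k , j⊆k = k , i⊆k d ∷ All.map j⊆k ds′

All-universal : ∀ {a p} {A : Set a} {P : A → Set p} → (∀ x → P x) → ∀ {n} (xs : Vec A n) → All P xs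
All-universal h [] = []
All-universal h (x ∷ xs) = h x ∷ All-universal h xs

-- Embeddings of structures

module Embeddings {ℓ} {τ : Vocabulary ℓ} where
  open Vocabulary τ
  open Structure using (fun; rel)
  open _↪_ using (injective; fun-hom; rel-iff)

  idᵉ : ∀ {a} {M : Structure τ a} → M ↪ M
  idᵉ {M = M} = record
    { to = id ; injective = id
    ; fun-hom = λ F xs → cong (fun M F) (sym (map-id xs))
    ; rel-iff = λ R xs → subst (λ ys → rel M R xs ⇔ rel M R ys) (sym (map-id xs)) (mk⇔ id id) }

  module _ {a b c} {P : Structure τ a} {Q : Structure τ b} {V : Structure τ c}
           (α : P ↪ V) (β : Q ↪ V) (γ : ⟦ P ⟧ → ⟦ Q ⟧) (βγ≗α : ∀ x → to β (γ x) ≡ to α x) where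
    private
      map-γ : ∀ {n} (xs : Vec ⟦ P ⟧ n) → map (to β) (map γ xs) ≡ map (to α) xs
      map-γ xs = trans (sym (map-∘ (to β) γ xs)) (map-cong βγ≗α xs)

    factor : P ↪ Q
    factor = record
      { to = γ
      ; injective = λ {x} {y} eq → injective α
          (trans (sym (βγ≗α x)) (trans (cong (to β) eq) (βγ≗α y)))
      ; fun-hom = λ F xs → injective β (trans (βγ≗α _) (trans (fun-hom α F xs)
          (trans (cong (fun V F) (sym (map-γ xs))) (sym (fun-hom β F (map γ xs))))))
      ; rel-iff = λ R xs → mk⇔
          (λ r → Equivalence.from (rel-iff β R (map γ xs)) (subst (rel V R) (sym (map-γ xs))
                   (Equivalence.to (rel-iff α R xs) r)))
          (λ r → Equivalence.from (rel-iff α R xs) (subst (rel V R) (map-γ xs)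
                   (Equivalence.to (rel-iff β R (map γ xs)) r)))
      }

  module _ {a b} {P : Structure τ a} {Q : Structure τ b} (f : P ↪ Q) (surj : IsSurjective f) where
    inverse : Q ↪ P
    inverse = factor idᵉ f (proj₁ ∘ surj) (proj₂ ∘ surj)

    inverse-surjective : IsSurjective inverse
    inverse-surjective x = to f x , injective f (proj₂ (surj (to f x)))

-- Models, extensions and automorphisms inside the monster

module MonsterModel (lem : ∀ {a} → ExcludedMiddle a) (fe : ∀ {a b} → Extensionality a b)
                    {ℓ} (𝒦 : AEC ℓ) (𝕄 : Monster 𝒦) where
  open Classical lem public
  open AEC 𝒦 public
  open Monster 𝕄 public
  open Ordinals lem fe length isOR public
  open WellOrders length public
  open InMonster 𝕄 public
  open Embeddings {τ = τ} public
  open _↪_ using (injective)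

  K-obj : ∀ i → K (obj i)
  K-obj i = strong-dom (step-strong (<-next i))

  id-strong : ∀ {M} → K M → IsStrong (idᵉ {M = M})
  id-strong k = strong-iso idᵉ k (λ x → x , refl)

  factor-strong : ∀ {P Q V : Structure τ ℓ} {α : P ↪ V} {β : Q ↪ V} {γ : ⟦ P ⟧ → ⟦ Q ⟧}
                  (βγ≗α : ∀ x → to β (γ x) ≡ to α x) → IsStrong α → IsStrong β → IsStrong (factor α β γ βγ≗α)
  factor-strong βγ≗α sα sβ = coherence (strong-resp (λ x → sym (βγ≗α x)) sα) sβ

  In : Stage → ⟦ ℭ ⟧ → Set (lsuc ℓ)
  In i x = ∃[ y ] to (incl i) y ≡ x

  abstract
    lift-≤ : ∀ {i j} → i ≤ j → Σ[ e ∈ obj i ↪ obj j ] IsStrong e × (∀ x → to (incl j) (to e x) ≡ to (incl i) x)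
    lift-≤ {i} i≤j with ≤⇒<⊎≡ i≤j
    ... | inj₁ i<j = step i<j , step-strong i<j , commute i<j
    ... | inj₂ refl = idᵉ , id-strong (K-obj i) , λ _ → refl

  In-≤ : ∀ {i j x} → i ≤ j → In i x → In j x
  In-≤ i≤j (y , eq) = let (e , _ , c) = lift-≤ i≤j in to e y , trans (c y) eq

  In-bounded : ∀ {S : Set ℓ} (f : S → ⟦ ℭ ⟧) → ∃[ i ] ∀ {j} → i ≤ j → ∀ s → In j (f s)
  In-bounded f = let (b , p) = bound (λ s → proj₁ (union (f s)))
    in b , λ b≤j s → In-≤ (<⇒≤ (<-≤-trans (p s) b≤j)) (proj₂ (union (f s)))

  In-sup : ∀ {a} {S : Set a} (f : S → Stage) bdd → S → let open Supremum f bdd in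
           ∀ {x} → In sup x → ∃[ s ] In (f s) x
  In-sup f bdd s₀ {x} (y , refl) with lem {P = ∃[ s ] f s ≡ Supremum.sup f bdd}
  ... | yes (s , eq) = s , subst (λ i → In i x) (sym eq) (y , refl)
  ... | no ¬e =
    let open Supremum f bdd
        f<sup : ∀ s → f s < sup
        f<sup s = case-≤ s (≤⇒<⊎≡ (≤-sup s))
        (j , j<sup , z , eq) = continuous sup (sup-limit s₀ f<sup) y
        (s , j<fs) = <-sup⁻ j<sup
    in s , In-≤ (<⇒≤ j<fs) (z , eq)
    where
    case-≤ : ∀ s → f s < Supremum.sup f bdd ⊎ f s ≡ Supremum.sup f bdd → f s < Supremum.sup f bdd
    case-≤ s (inj₁ l) = l
    case-≤ s (inj₂ eq) = ⊥-elim (¬e (s , eq))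

  elem : (P : Model) → ⟦ Model.str P ⟧ → ⟦ ℭ ⟧
  elem P = to (incl (Model.stage P)) ∘ to (Model.emb P)

  elemᵉ : (P : Model) → Model.str P ↪ ℭ
  elemᵉ P = incl (Model.stage P) ∘ᵉ Model.emb P

  abstract
    raise : (P : Model) → ∀ {s} → Model.stage P ≤ s →
            Σ[ e ∈ Model.str P ↪ obj s ] IsStrong e × (∀ x → to (incl s) (to e x) ≡ elem P x)
    raise P le = let (f , sf , c) = lift-≤ le
      in f ∘ᵉ Model.emb P , strong-trans (Model.strong P) sf , λ x → c _

  stageModel : Stage → Model
  stageModel i = record { emb = idᵉ ; strong = id-strong (K-obj i) }

  ⊆-stage : (P : Model) → ∀ {s} → Model.stage P ≤ s → P ≼ stageModel s
  ⊆-stage P le _ (x , refl) = let (e , _ , c) = raise P le in to e x , c x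

  mono-stage : ∀ {i j} → i ≤ j → stageModel i ≼ stageModel j
  mono-stage i≤j _ = In-≤ i≤j

  ≼-refl : ∀ {P} → P ≼ P
  ≼-refl _ x∈ = x∈

  ≼-trans : ∀ {P Q R} → P ≼ Q → Q ≼ R → P ≼ R
  ≼-trans p q x x∈ = q x (p x x∈)

  module _ (P Q : Model) (γ : ⟦ Model.str P ⟧ → ⟦ Model.str Q ⟧) (c : ∀ x → elem Q (γ x) ≡ elem P x) where
    ≼-emb : Model.str P ↪ Model.str Q
    ≼-emb = factor (elemᵉ P) (elemᵉ Q) γ c

    -- Both models are strong in a common stage, where coherence applies.
    ≼-emb-strong : IsStrong ≼-emb
    ≼-emb-strong =
      let (s , p<s , q<s) = bound₂ (Model.stage P) (Model.stage Q)
          (e , se , ce) = raise P (<⇒≤ p<s)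
          (f , sf , cf) = raise Q (<⇒≤ q<s)
      in strong-resp (λ _ → refl) (factor-strong {α = e} {β = f} {γ = γ}
           (λ x → injective (incl s) (trans (cf _) (trans (c x) (sym (ce x))))) se sf)

  module Extension (amalg : Amalgamation) where
    private
      new : ∀ i → ∃[ y ] ¬ (∃[ x ] to (step (<-next i)) x ≡ y)
      new i = ¬∀⇒∃¬ (step-strict (<-next i))

      -- One new element from each strict step gives an injection of OR into ℭ, so late stages
      -- contain a copy of any given type in `Set ℓ`.
      ψ : Stage → ⟦ ℭ ⟧
      ψ i = to (incl (next i)) (proj₁ (new i))

      ψ-≢ : ∀ {i j} → i < j → ¬ (ψ i ≡ ψ j)
      ψ-≢ {i} {j} i<j eq with In-≤ {x = ψ i} (next-≤ i<j) (_ , refl)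
      ... | y , eq′ = proj₂ (new j) (y , injective (incl (next j))
              (trans (commute (<-next j) y) (trans eq′ eq)))

      ψ-injective : ∀ {i j} → ψ i ≡ ψ j → i ≡ j
      ψ-injective {i} {j} eq with compare i j
      ... | tri< l _ _ = ⊥-elim (ψ-≢ l eq)
      ... | tri≈ _ e _ = e
      ... | tri> _ _ l = ⊥-elim (ψ-≢ l (sym eq))

    point : ⟦ ℭ ⟧
    point = ψ inhabitant

    -- The cardinal inequality |obj j| + |Z| ≤ |obj j|. Universality of a step concerns extensions
    -- of the same cardinality, so an amalgam over a stage must not outgrow that stage.
    Absorbs : Set ℓ → Stage → Set ℓ
    Absorbs Z j = Σ[ f ∈ (⟦ obj j ⟧ ⊎ Z → ⟦ obj j ⟧) ] Injective _≡_ _≡_ f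

    -- Hilbert's hotel: a stage containing a copy of Z × ℕ absorbs Z.
    absorbs : (Z : Set ℓ) → ∃[ b ] ∀ {j} → b ≤ j → Absorbs Z j
    absorbs Z = b , λ {j} b≤j → hotel (λ s → proj₁ (inb b≤j s))
                  (λ {s} {t} eq → f-inj (ψ-injective (trans (sym (proj₂ (inb b≤j s)))
                    (trans (cong (to (incl j)) eq) (proj₂ (inb b≤j t))))))
      where
      f : Z × ℕ → Stage
      f = proj₁ (embed (Z × ℕ))
      f-inj : ∀ {x y} → f x ≡ f y → x ≡ y
      f-inj = proj₂ (embed (Z × ℕ))
      b = proj₁ (In-bounded (ψ ∘ f))
      inb : ∀ {j} → b ≤ j → ∀ s → In j (ψ (f s))
      inb = proj₂ (In-bounded (ψ ∘ f))
      hotel : ∀ {j} (g : Z × ℕ → ⟦ obj j ⟧) → (∀ {s t} → g s ≡ g t → s ≡ t) → Absorbs Z j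
      hotel {j} g g-inj = shift , shift-inj
        where
        move : ∀ x → Dec (∃[ s ] g s ≡ x) → ⟦ obj j ⟧
        move x (yes ((z , n) , _)) = g (z , suc n)
        move x (no _) = x

        shift : ⟦ obj j ⟧ ⊎ Z → ⟦ obj j ⟧
        shift (inj₁ x) = move x lem
        shift (inj₂ z) = g (z , 0)

        move-inj : ∀ x y p q → move x p ≡ move y q → x ≡ y
        move-inj x y (yes (s , refl)) (yes (t , refl)) eq with refl ← g-inj eq = refl
        move-inj x y (yes (s , refl)) (no ¬t) eq = ⊥-elim (¬t (_ , eq))
        move-inj x y (no ¬s) (yes (t , refl)) eq = ⊥-elim (¬s (_ , sym eq))
        move-inj x y (no _) (no _) eq = eq

        move-≢ : ∀ x p z → ¬ (move x p ≡ g (z , 0))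
        move-≢ x (yes (s , refl)) z eq with () ← g-inj eq
        move-≢ x (no ¬s) z eq = ¬s (_ , sym eq)

        shift-inj : Injective _≡_ _≡_ shift
        shift-inj {inj₁ x} {inj₁ y} eq = cong inj₁ (move-inj x y lem lem eq)
        shift-inj {inj₁ x} {inj₂ z} eq = ⊥-elim (move-≢ x lem z eq)
        shift-inj {inj₂ z} {inj₁ x} eq = ⊥-elim (move-≢ x lem z (sym eq))
        shift-inj {inj₂ z} {inj₂ z′} eq with refl ← g-inj eq = refl

    private
      -- The amalgam of a stage and P′ may be too large for universality. Cut down by
      -- Löwenheim-Skolem to a model containing both images, it has the cardinality of a stage that
      -- absorbs `⟦ P′ ⟧ ⊎ LS`, so it embeds into the next stage by universality of the step.
      extension′ : (P : Model) {P′ : Structure τ ℓ} (g : Model.str P ↪ P′) → IsStrong g →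
        ∃[ s ] Σ[ e ∈ P′ ↪ obj s ] IsStrong e × (∀ x → to (incl s) (to e (to g x)) ≡ elem P x)
      extension′ P {P′} g sg =
        let (b , abs) = absorbs (⟦ P′ ⟧ ⊎ LS)
            (j , p<j , b<j) = bound₂ (Model.stage P) b
            (f₁ , sf₁ , c₁) = raise P (<⇒≤ p<j)
            (N , g₁ , g₂ , sg₁ , sg₂ , sq) = amalg f₁ g sf₁ sg
        in embed-amalgam j f₁ c₁ (abs (<⇒≤ b<j)) N g₁ g₂ sg₁ sg₂ sq
        where
        embed-amalgam : ∀ j (f₁ : Model.str P ↪ obj j) → (∀ x → to (incl j) (to f₁ x) ≡ elem P x) →
          Absorbs (⟦ P′ ⟧ ⊎ LS) j →
          ∀ N (g₁ : obj j ↪ N) (g₂ : P′ ↪ N) → IsStrong g₁ → IsStrong g₂ →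
          (∀ x → to g₁ (to f₁ x) ≡ to g₂ (to g x)) →
          ∃[ s ] Σ[ e ∈ P′ ↪ obj s ] IsStrong e × (∀ x → to (incl s) (to e (to g x)) ≡ elem P x)
        embed-amalgam j f₁ c₁ (h , h-inj) N g₁ g₂ sg₁ sg₂ sq =
          let (M , f , sf , covers , small) = downward (strong-cod sg₁) a
              k∃ = λ x → covers (g₁x x)
              l∃ = λ x → covers (g₂x x)
              k = factor g₁ f (proj₁ ∘ k∃) (proj₂ ∘ k∃)
              l = factor g₂ f (proj₁ ∘ l∃) (proj₂ ∘ l∃)
              sk = factor-strong {α = g₁} {β = f} (proj₂ ∘ k∃) sg₁ sf
              sl = factor-strong {α = g₂} {β = f} (proj₂ ∘ l∃) sg₂ sf
              M↔ = cantor-bernstein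
                     (mk↣ {to = h ∘ regroup ∘ Injection.to small}
                       (λ eq → Injection.injective small (regroup-inj (h-inj eq))))
                     (mk↣ {to = to k} (injective k))
              (u , su , cu) = proj₂ (step-universal (<-next j) (next-isSuccessor j)) k sk M↔
          in next j , u ∘ᵉ l , strong-trans sl su , λ x →
             trans (cong (to (incl (next j)) ∘ to u)
                      (injective f (trans (proj₂ (l∃ (to g x))) (trans (sym (sq x)) (sym (proj₂ (k∃ (to f₁ x))))))))
             (trans (cong (to (incl (next j))) (cu (to f₁ x)))
             (trans (commute (<-next j) _) (c₁ x)))
          where
          from : ⟦ obj j ⟧ ⊎ ⟦ P′ ⟧ → ⟦ N ⟧
          from (inj₁ x) = to g₁ x
          from (inj₂ x) = to g₂ x

          A : Set ℓ
          A = Σ[ n ∈ ⟦ N ⟧ ] Squash (∃[ x ] from x ≡ n)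

          a : A ↣ ⟦ N ⟧
          a = mk↣ {to = proj₁} Σ-Squash-≡

          g₁x : ⟦ obj j ⟧ → A
          g₁x x = to g₁ x , squash (inj₁ x , refl)

          g₂x : ⟦ P′ ⟧ → A
          g₂x x = to g₂ x , squash (inj₂ x , refl)

          tag : ⟦ obj j ⟧ ⊎ ⟦ P′ ⟧ → ⟦ obj j ⟧ ⊎ (⟦ P′ ⟧ ⊎ LS)
          tag (inj₁ x) = inj₁ x
          tag (inj₂ x) = inj₂ (inj₁ x)

          regroup : A ⊎ LS → ⟦ obj j ⟧ ⊎ (⟦ P′ ⟧ ⊎ LS)
          regroup (inj₁ (_ , p)) = tag (proj₁ (unsquash p))
          regroup (inj₂ z) = inj₂ (inj₂ z)

          tag-inj : ∀ x y → tag x ≡ tag y → x ≡ y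
          tag-inj (inj₁ x) (inj₁ _) refl = refl
          tag-inj (inj₂ x) (inj₂ _) refl = refl

          tag-≢ : ∀ x z → ¬ (tag x ≡ inj₂ (inj₂ z))
          tag-≢ (inj₁ x) z ()
          tag-≢ (inj₂ x) z ()

          regroup-inj : ∀ {x y} → regroup x ≡ regroup y → x ≡ y
          regroup-inj {inj₁ (_ , p)} {inj₁ (_ , q)} eq = cong inj₁ (Σ-Squash-≡
            (trans (sym (proj₂ (unsquash p))) (trans (cong from (tag-inj _ _ eq)) (proj₂ (unsquash q)))))
          regroup-inj {inj₁ (_ , p)} {inj₂ z} eq = ⊥-elim (tag-≢ _ z eq)
          regroup-inj {inj₂ z} {inj₁ (_ , p)} eq = ⊥-elim (tag-≢ _ z (sym eq))
          regroup-inj {inj₂ z} {inj₂ _} refl = refl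

    abstract
      extension : (P : Model) {P′ : Structure τ ℓ} (g : Model.str P ↪ P′) → IsStrong g →
        ∃[ s ] Σ[ e ∈ P′ ↪ obj s ] IsStrong e × (∀ x → to (incl s) (to e (to g x)) ≡ elem P x)
      extension = extension′

  infixr 9 _∘ᵃ_

  _∘ᵃ_ : Automorphism → Automorphism → Automorphism
  g ∘ᵃ f = record
    { self-emb = Automorphism.self-emb g ∘ᵉ Automorphism.self-emb f
    ; surjective = λ z → let (y , q) = Automorphism.surjective g z
                             (x , p) = Automorphism.surjective f y
                         in x , trans (cong (g ⟨_⟩) p) q }

  infix 21 _⁻¹

  _⁻¹ : Automorphism → Automorphism
  f ⁻¹ = record
    { self-emb = inverse (Automorphism.self-emb f) (Automorphism.surjective f)
    ; surjective = inverse-surjective (Automorphism.self-emb f) (Automorphism.surjective f) }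

  ⟨⟩-injective : ∀ f {x y} → f ⟨ x ⟩ ≡ f ⟨ y ⟩ → x ≡ y
  ⟨⟩-injective f = injective (Automorphism.self-emb f)

  ⁻¹-right : ∀ f x → f ⟨ f ⁻¹ ⟨ x ⟩ ⟩ ≡ x
  ⁻¹-right f x = proj₂ (Automorphism.surjective f x)

  ⁻¹-left : ∀ f x → f ⁻¹ ⟨ f ⟨ x ⟩ ⟩ ≡ x
  ⁻¹-left f x = ⟨⟩-injective f (⁻¹-right f (f ⟨ x ⟩))

  private
    -- Closing off ω times under f and its inverse suffices, since by continuity each element of the
    -- supremum lies in one of the earlier stages. On the resulting stage f restricts to an
    -- automorphism of a structure in `Set ℓ`, to which `strong-iso` applies; this is how models are
    -- moved by automorphisms.
    preserved-stage′ : ∀ f i → ∃[ s ] (i ≤ s × (∀ {x} → In s x → In s (f ⟨ x ⟩)) ×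
                                            (∀ {x} → In s x → In s (f ⁻¹ ⟨ x ⟩)))
    preserved-stage′ f i = sup , ≤-sup (lift 0) , closed f (proj₁ ∘ proj₂ ∘ more-spec) , closed (f ⁻¹) (proj₂ ∘ proj₂ ∘ more-spec)
      where
      more : ∀ j → ∃[ k ] (j ≤ k × (∀ {x} → In j x → In k (f ⟨ x ⟩)) × (∀ {x} → In j x → In k (f ⁻¹ ⟨ x ⟩)))
      more j = let (a , p) = In-bounded (λ y → f ⟨ to (incl j) y ⟩)
                   (b , q) = In-bounded (λ y → f ⁻¹ ⟨ to (incl j) y ⟩)
                   (c , a<c , b<c) = bound₂ a b
                   (k , j<k , c<k) = bound₂ j c
               in k , <⇒≤ j<k ,
                  (λ { {x} (y , refl) → p (<⇒≤ (<-trans a<c c<k)) y }) ,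
                  (λ { {x} (y , refl) → q (<⇒≤ (<-trans b<c c<k)) y })

      s : ℕ → Stage
      s zero = i
      s (suc n) = proj₁ (more (s n))

      more-spec : ∀ n → s n ≤ s (suc n) × (∀ {x} → In (s n) x → In (s (suc n)) (f ⟨ x ⟩)) ×
                        (∀ {x} → In (s n) x → In (s (suc n)) (f ⁻¹ ⟨ x ⟩))
      more-spec n = proj₂ (more (s n))

      open Supremum (λ (n : Lift ℓ ℕ) → s (lower n)) (bound (λ n → s (lower n)))

      closed : ∀ g → (∀ n {x} → In (s n) x → In (s (suc n)) (g ⟨ x ⟩)) → ∀ {x} → In sup x → In sup (g ⟨ x ⟩)
      closed g g-step x∈ = let (lift n , x∈n) = In-sup (λ (n : Lift ℓ ℕ) → s (lower n)) (bound (λ n → s (lower n))) (lift 0) x∈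
                      in In-≤ (≤-sup (lift (suc n))) (g-step n x∈n)

  abstract
    preserved-stage : ∀ f i → ∃[ s ] (i ≤ s × (∀ {x} → In s x → In s (f ⟨ x ⟩)) ×
                                            (∀ {x} → In s x → In s (f ⁻¹ ⟨ x ⟩)))
    preserved-stage = preserved-stage′

  image : Automorphism → Model → Model
  image f P =
    let (s , p≤s , f-closed , f⁻¹-closed) = preserved-stage f (Model.stage P)
        (e , se , ce) = raise P p≤s
        im = λ y → f-closed (y , refl)
        fₛ = factor (Automorphism.self-emb f ∘ᵉ incl s) (incl s) (proj₁ ∘ im) (proj₂ ∘ im)
    in record { stage = s ; emb = fₛ ∘ᵉ e ; strong = strong-trans se (strong-iso fₛ (K-obj s) λ y →
         let (x , eq) = f⁻¹-closed (y , refl)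
         in x , injective (incl s) (trans (proj₂ (im x)) (trans (cong (f ⟨_⟩) eq) (⁻¹-right f _)))) }

  image-elem : ∀ f P x → elem (image f P) x ≡ f ⟨ elem P x ⟩
  image-elem f P x =
    let (s , p≤s , f-closed , _) = preserved-stage f (Model.stage P)
        (e , se , ce) = raise P p≤s
    in trans (proj₂ (f-closed (to e x , refl))) (cong (f ⟨_⟩) (ce x))

-- Model homogeneity of the monster by back and forth

module Homogeneity (lem : ∀ {a} → ExcludedMiddle a) (fe : ∀ {a b} → Extensionality a b)
                   {ℓ} (𝒦 : AEC ℓ) (𝕄 : Monster 𝒦) (amalg : AEC.Amalgamation 𝒦) where
  open MonsterModel lem fe 𝒦 𝕄
  open Extension amalg
  open Structure using (fun; rel)
  open _↪_ using (injective; fun-hom; rel-iff)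

  -- An isomorphism between two models, presented by a common copy of them.
  record PartialIso : Set (lsuc ℓ) where
    field
      {str}      : Structure τ ℓ
      {stage}    : Stage
      dom cod    : str ↪ obj stage
      dom-strong : IsStrong dom
      cod-strong : IsStrong cod

    Dom Cod : Model
    Dom = record { emb = dom ; strong = dom-strong }
    Cod = record { emb = cod ; strong = cod-strong }

    Graph : ⟦ ℭ ⟧ → ⟦ ℭ ⟧ → Set (lsuc ℓ)
    Graph x y = ∃[ p ] (elem Dom p ≡ x × elem Cod p ≡ y)

    functional : ∀ {x y y′} → Graph x y → Graph x y′ → y ≡ y′
    functional (p , refl , refl) (q , e , refl) =
      cong (elem Cod) (injective (elemᵉ Dom) (sym e))

    co-functional : ∀ {x x′ y} → Graph x y → Graph x′ y → x ≡ x′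
    co-functional (p , refl , refl) (q , refl , e) =
      cong (elem Dom) (injective (elemᵉ Cod) (sym e))

    in-dom : ∀ {x y} → Graph x y → In stage x
    in-dom (p , refl , _) = to dom p , refl

    in-cod : ∀ {x y} → Graph x y → In stage y
    in-cod (p , _ , refl) = to cod p , refl

    module _ {a} {A : Set a} (f g : A → ⟦ ℭ ⟧) where
      points : ∀ {n} {xs : Vec A n} → All (λ x → Graph (f x) (g x)) xs →
               ∃[ ps ] (map (to (elemᵉ Dom)) ps ≡ map f xs × map (to (elemᵉ Cod)) ps ≡ map g xs)
      points [] = [] , refl , refl
      points ((p , e , e′) ∷ hs) with points hs
      ... | ps , q , q′ = p ∷ ps , cong₂ _∷_ e q , cong₂ _∷_ e′ q′

      graph-fun : ∀ F {xs} → All (λ x → Graph (f x) (g x)) xs →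
                  Graph (fun ℭ F (map f xs)) (fun ℭ F (map g xs))
      graph-fun F hs with points hs
      ... | ps , e , e′ = fun str F ps , trans (fun-hom (elemᵉ Dom) F ps) (cong (fun ℭ F) e)
                                     , trans (fun-hom (elemᵉ Cod) F ps) (cong (fun ℭ F) e′)

      graph-rel : ∀ R {xs} → All (λ x → Graph (f x) (g x)) xs →
                  rel ℭ R (map f xs) ⇔ rel ℭ R (map g xs)
      graph-rel R hs with points hs
      ... | ps , e , e′ = mk⇔
        (λ r → subst (rel ℭ R) e′ (Equivalence.to (rel-iff (elemᵉ Cod) R ps)
                 (Equivalence.from (rel-iff (elemᵉ Dom) R ps) (subst (rel ℭ R) (sym e) r))))
        (λ r → subst (rel ℭ R) e (Equivalence.to (rel-iff (elemᵉ Dom) R ps)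
                 (Equivalence.from (rel-iff (elemᵉ Cod) R ps) (subst (rel ℭ R) (sym e′) r))))

  open PartialIso using (Graph; Dom; Cod)

  _⊑ᵍ_ : PartialIso → PartialIso → Set (lsuc ℓ)
  π ⊑ᵍ ρ = ∀ {x y} → Graph π x y → Graph ρ x y

  -- Every finite tuple lies in one member of the directed family, so the pointwise union is an
  -- embedding. It serves twice: with `V` a stage at limit steps, and with `V` = ℭ for the final
  -- automorphism.
  module _ {k} {I : Set k} (π : I → PartialIso) (i₀ : I)
           (directed : ∀ i j → ∃[ k ] (π i ⊑ᵍ π k × π j ⊑ᵍ π k))
           {v} {V : Structure τ v} (e : V ↪ ℭ) (φ : ⟦ V ⟧ → ⟦ V ⟧)
           (φ-graph : ∀ x → ∃[ i ] Graph (π i) (to e x) (to e (φ x))) where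
    private
      common-functional : ∀ {i j x y y′} → Graph (π i) x y → Graph (π j) x y′ → y ≡ y′
      common-functional {i} {j} g h = let (k , p , q) = directed i j
        in PartialIso.functional (π k) (p g) (q h)

      common-graph : ∀ {n} (xs : Vec ⟦ V ⟧ n) → ∃[ i ] All (λ x → Graph (π i) (to e x) (to e (φ x))) xs
      common-graph xs = All-directed (λ i x → Graph (π i) (to e x) (to e (φ x))) i₀
        (λ i j → let (k , p , q) = directed i j in k , p , q) (All-universal φ-graph xs)

      map-eφ : ∀ {n} (xs : Vec ⟦ V ⟧ n) → map (to e) (map φ xs) ≡ map (to e ∘ φ) xs
      map-eφ xs = sym (map-∘ (to e) φ xs)

    union-emb : V ↪ V
    union-emb = record
      { to = φ
      ; injective = λ {x} {y} eq →
          let (i , g) = φ-graph x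
              (j , h) = φ-graph y
              (k , p , q) = directed i j
          in injective e (PartialIso.co-functional (π k) (p g)
               (subst (Graph (π k) (to e y)) (cong (to e) (sym eq)) (q h)))
      ; fun-hom = λ F xs →
          let (i , g) = φ-graph (fun V F xs)
              (j , hs) = common-graph xs
          in injective e (common-functional g
               (subst (λ z → Graph (π j) z (to e (fun V F (map φ xs)))) (sym (fun-hom e F xs))
                 (subst (Graph (π j) (fun ℭ F (map (to e) xs)))
                   (trans (cong (fun ℭ F) (sym (map-eφ xs))) (sym (fun-hom e F (map φ xs))))
                   (PartialIso.graph-fun (π j) (to e) (to e ∘ φ) F hs))))
      ; rel-iff = λ R xs →
          let (j , hs) = common-graph xs
              r = PartialIso.graph-rel (π j) (to e) (to e ∘ φ) R hs
          in mk⇔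
            (λ a → Equivalence.from (rel-iff e R (map φ xs)) (subst (rel ℭ R) (sym (map-eφ xs))
                     (Equivalence.to r (Equivalence.to (rel-iff e R xs) a))))
            (λ a → Equivalence.from (rel-iff e R xs) (Equivalence.from r
                     (subst (rel ℭ R) (map-eφ xs) (Equivalence.to (rel-iff e R (map φ xs)) a))))
      }

    union-value : ∀ {i x y} → Graph (π i) (to e x) (to e y) → φ x ≡ y
    union-value {x = x} g = injective e (common-functional (proj₂ (φ-graph x)) g)

  Covers : PartialIso → Stage → Set (lsuc ℓ)
  Covers π i = (∀ {x} → In i x → ∃[ y ] Graph π x y) × (∀ {y} → In i y → ∃[ x ] Graph π x y)

  flip : PartialIso → PartialIso
  flip π = record { dom = cod ; cod = dom ; dom-strong = cod-strong ; cod-strong = dom-strong }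
    where open PartialIso π

  flip-graph : ∀ π {x y} → Graph π x y → Graph (flip π) y x
  flip-graph π (p , e , e′) = p , e′ , e

  abstract
    -- A stage above i extends the common copy through `dom`; `extension` embeds this stage over
    -- `cod`, and the stage becomes the new common copy.
    forth : ∀ π i → Σ[ ρ ∈ PartialIso ] (π ⊑ᵍ ρ × (∀ {x} → In i x → ∃[ y ] Graph ρ x y))
    forth π i =
      let (s , π<s , i<s) = bound₂ (PartialIso.stage π) i
          (g , sg , cg) = raise (Dom π) (<⇒≤ π<s)
          (s′ , e , se , ce) = extension (Cod π) g sg
          (t , s<t , s′<t) = bound₂ s s′
          (l , sl , cl) = lift-≤ (<⇒≤ s<t)
          (l′ , sl′ , cl′) = lift-≤ (<⇒≤ s′<t)
      in record { dom = l ; cod = l′ ∘ᵉ e ; dom-strong = sl ; cod-strong = strong-trans se sl′ } ,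
         (λ { (p , e₁ , e₂) → to g p , trans (cl _) (trans (cg p) e₁) , trans (cl′ _) (trans (ce p) e₂) }) ,
         (λ x∈ → let (z , eq) = In-≤ (<⇒≤ i<s) x∈ in _ , z , trans (cl z) eq , refl)

    extend : ∀ π i → Σ[ ρ ∈ PartialIso ] (π ⊑ᵍ ρ × Covers ρ i)
    extend π i =
      let (ρ , π⊑ρ , dom-covers) = forth π i
          (σ , ρ⊑σ , cod-covers) = forth (flip ρ) i
      in flip σ ,
         (λ g → flip-graph σ (ρ⊑σ (flip-graph ρ (π⊑ρ g)))) ,
         (λ x∈ → let (y , g) = dom-covers x∈ in y , flip-graph σ (ρ⊑σ (flip-graph ρ g))) ,
         (λ y∈ → let (x , g) = cod-covers y∈ in x , flip-graph σ g)

  module BackAndForth (π₀ : PartialIso) where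
    Union : Stage → (Stage → PartialIso) → ⟦ ℭ ⟧ → ⟦ ℭ ⟧ → Set (lsuc ℓ)
    Union i b x y = Graph π₀ x y ⊎ (∃[ j ] (j < i × Graph (b j) x y))

    IsUnion : Stage → (Stage → PartialIso) → PartialIso → Set (lsuc ℓ)
    IsUnion i b π = (∀ {x y} → Graph π x y → Union i b x y) × (∀ {x y} → Union i b x y → Graph π x y)

    level : Stage → (Stage → PartialIso) → Stage
    level i b = proj₁ (bound₂ i (proj₁ (bound-below i (PartialIso.stage ∘ b))))

    abstract
      -- That a union exists is known only when the earlier steps are stable, which the recursion
      -- cannot express. `π₀` is a placeholder, excluded by `union-exists` and `all-stable`.
      amalgam : Stage → (Stage → PartialIso) → PartialIso
      amalgam i b with lem {P = ∃ (IsUnion i b)}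
      ... | yes (π , _) = π
      ... | no _ = π₀

      amalgam-isUnion : ∀ i b → ∃ (IsUnion i b) → IsUnion i b (amalgam i b)
      amalgam-isUnion i b u with lem {P = ∃ (IsUnion i b)}
      ... | yes (_ , u) = u
      ... | no ¬u = ⊥-elim (¬u u)

    G-step : Stage → (Stage → PartialIso) → PartialIso
    G-step i b = proj₁ (extend (amalgam i b) (level i b))

    open Recursion fe π₀ G-step renaming (rec to G; rec-unfold to G-unfold)

    -- `covers-before` gives the union at a limit one full stage as both domain and codomain; the
    -- union is then an automorphism of that stage, and strong by `strong-iso`.
    record StableAt (i : Stage) (ρ : PartialIso) : Set (lsuc ℓ) where
      field
        grows         : ∀ {x y} → Union i G x y → Graph ρ x y
        covers        : Covers ρ i
        covers-before : ∀ {j} → j < i → Covers ρ (PartialIso.stage (G j))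

    open StableAt

    Stable : Stage → Set (lsuc ℓ)
    Stable i = StableAt i (G i)

    Covers-≤ : ∀ {π i j} → i ≤ j → Covers π j → Covers π i
    Covers-≤ i≤j (d , c) = (λ x∈ → d (In-≤ i≤j x∈)) , (λ y∈ → c (In-≤ i≤j y∈))

    stable : ∀ i → ∃ (IsUnion i G) → Stable i
    stable i (π , π⊆ , π⊇) = subst (StableAt i) (sym (G-unfold i)) claim
      where
      b = below π₀ i G

      b≡ : ∀ {j} → j < i → b j ≡ G j
      b≡ j<i = below-< π₀ G j<i

      to-b : ∀ {x y} → Union i G x y → Union i b x y
      to-b (inj₁ g) = inj₁ g
      to-b {x} {y} (inj₂ (j , j<i , g)) = inj₂ (j , j<i , subst (λ ρ → Graph ρ x y) (sym (b≡ j<i)) g)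

      from-b : ∀ {x y} → Union i b x y → Union i G x y
      from-b (inj₁ g) = inj₁ g
      from-b {x} {y} (inj₂ (j , j<i , g)) = inj₂ (j , j<i , subst (λ ρ → Graph ρ x y) (b≡ j<i) g)

      step-extends : amalgam i b ⊑ᵍ G-step i b
      step-extends = proj₁ (proj₂ (extend (amalgam i b) (level i b)))

      step-covers : Covers (G-step i b) (level i b)
      step-covers = proj₂ (proj₂ (extend (amalgam i b) (level i b)))

      i<level : i < level i b
      i<level = proj₁ (proj₂ (bound₂ i _))

      stage<level : ∀ {j} → j < i → PartialIso.stage (G j) < level i b
      stage<level {j} j<i = subst (λ ρ → PartialIso.stage ρ < level i b) (b≡ j<i)
        (<-trans (proj₂ (bound-below i (PartialIso.stage ∘ b)) j j<i) (proj₂ (proj₂ (bound₂ i _))))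

      claim : StableAt i (G-step i b)
      claim = record
        { grows = λ u → step-extends (proj₂ (amalgam-isUnion i b
                    (π , (λ g → to-b (π⊆ g)) , (λ u → π⊇ (from-b u)))) (to-b u))
        ; covers = Covers-≤ {G-step i b} (<⇒≤ i<level) step-covers
        ; covers-before = λ j<i → Covers-≤ {G-step i b} (<⇒≤ (stage<level j<i)) step-covers
        }

    module _ (i : Stage) (st : ∀ j → j < i → Stable j) where
      chain-mono : ∀ {j k} → j < k → k < i → G j ⊑ᵍ G k
      chain-mono j<k k<i g = grows (st _ k<i) (inj₂ (_ , j<k , g))

      chain-mono-≤ : ∀ {j k} → j ≤ k → k < i → G j ⊑ᵍ G k
      chain-mono-≤ j≤k k<i g with ≤⇒<⊎≡ j≤k
      ... | inj₁ j<k = chain-mono j<k k<i g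
      ... | inj₂ refl = g

      start⊑ : ∀ {j} → j < i → π₀ ⊑ᵍ G j
      start⊑ j<i g = grows (st _ j<i) (inj₁ g)

      Below : Set (lsuc ℓ)
      Below = ∃[ j ] j < i

      Gᵇ : Below → PartialIso
      Gᵇ (j , _) = G j

      directed : ∀ (a b : Below) → ∃[ c ] (Gᵇ a ⊑ᵍ Gᵇ c × Gᵇ b ⊑ᵍ Gᵇ c)
      directed (j , j<i) (k , k<i) with compare j k
      ... | tri< l _ _ = (k , k<i) , chain-mono l k<i , λ g → g
      ... | tri≈ _ refl _ = (k , k<i) , (λ g → g) , λ g → g
      ... | tri> _ _ l = (j , j<i) , (λ g → g) , chain-mono l j<i

      module Limit (o : Below) (lim : ∀ {j} → j < i → next j < i) where
        stages : Below → Stage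
        stages (j , _) = PartialIso.stage (G j)

        bdd : ∃[ c ] (∀ a → stages a < c)
        bdd = let (c , p) = bound-below i (PartialIso.stage ∘ G) in c , λ { (j , j<i) → p j j<i }

        open Supremum stages bdd

        ⊑-sup : ∀ {x y} (a : Below) → Graph (Gᵇ a) x y → In sup x × In sup y
        ⊑-sup a g = In-≤ (≤-sup a) (PartialIso.in-dom (Gᵇ a) g) , In-≤ (≤-sup a) (PartialIso.in-cod (Gᵇ a) g)

        value : ∀ x → ∃[ a ] ∃[ y ] Graph (Gᵇ a) (to (incl sup) x) (to (incl sup) y)
        value x =
          let ((j , j<i) , x∈) = In-sup stages bdd o (x , refl)
              a = next j , lim j<i
              (y , g) = proj₁ (covers-before (st (next j) (lim j<i)) (<-next j)) x∈
              (z , eq) = proj₂ (⊑-sup a g)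
          in a , z , subst (Graph (Gᵇ a) _) (sym eq) g

        φ : ⟦ obj sup ⟧ → ⟦ obj sup ⟧
        φ x = proj₁ (proj₂ (value x))

        φ-graph : ∀ x → ∃[ a ] Graph (Gᵇ a) (to (incl sup) x) (to (incl sup) (φ x))
        φ-graph x = proj₁ (value x) , proj₂ (proj₂ (value x))

        φᵉ : obj sup ↪ obj sup
        φᵉ = union-emb Gᵇ o directed (incl sup) φ φ-graph

        φᵉ-surjective : IsSurjective φᵉ
        φᵉ-surjective y =
          let ((j , j<i) , y∈) = In-sup stages bdd o (y , refl)
              a = next j , lim j<i
              (x , g) = proj₂ (covers-before (st (next j) (lim j<i)) (<-next j)) y∈
              (z , eq) = proj₁ (⊑-sup a g)
          in z , union-value Gᵇ o directed (incl sup) φ φ-graph {a}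
                   (subst (λ x → Graph (Gᵇ a) x (to (incl sup) y)) (sym eq) g)

        union-iso : PartialIso
        union-iso = record { dom = idᵉ ; cod = φᵉ ; dom-strong = id-strong (K-obj sup)
                           ; cod-strong = strong-iso φᵉ (K-obj sup) φᵉ-surjective }

        union-isUnion : IsUnion i G union-iso
        union-isUnion =
          (λ { (p , refl , refl) → let ((j , j<i) , g) = φ-graph p in inj₂ (j , j<i , g) }) ,
          (λ { (inj₁ g) → from-chain o (start⊑ (proj₂ o) g)
             ; (inj₂ (j , j<i , g)) → from-chain (j , j<i) g })
          where
          from-chain : ∀ a {x y} → Graph (Gᵇ a) x y → Graph union-iso x y
          from-chain a {x} {y} g =
            let ((x′ , ex) , (y′ , ey)) = ⊑-sup a g
                g′ = subst (λ x → Graph (Gᵇ a) x (to (incl sup) y′)) (sym ex)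
                       (subst (Graph (Gᵇ a) x) (sym ey) g)
            in x′ , ex , trans (cong (to (incl sup)) (union-value Gᵇ o directed (incl sup) φ φ-graph {a} g′)) ey

      union-exists : ∃ (IsUnion i G)
      union-exists with position i
      ... | is-zero ¬j = π₀ , inj₁ , λ { (inj₁ g) → g ; (inj₂ (j , j<i , _)) → ⊥-elim (¬j j j<i) }
      ... | is-next j refl = G j , (λ g → inj₂ (j , <-next j , g)) ,
              λ { (inj₁ g) → start⊑ (<-next j) g
                ; (inj₂ (k , k<i , g)) → chain-mono-≤ (<-next⁻ k<i) (<-next j) g }
      ... | is-lim o lim = Limit.union-iso o lim , Limit.union-isUnion o lim

    all-stable : ∀ i → Stable i
    all-stable = <-ind _ λ i st → stable i (union-exists i st)

    G-mono : ∀ {i j} → i < j → G i ⊑ᵍ G j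
    G-mono i<j g = grows (all-stable _) (inj₂ (_ , i<j , g))

    G-directed : ∀ i j → ∃[ k ] (G i ⊑ᵍ G k × G j ⊑ᵍ G k)
    G-directed i j = let (k , i<k , j<k) = bound₂ i j in k , G-mono i<k , G-mono j<k

    private
      value : ∀ x → ∃[ i ] ∃[ y ] Graph (G i) x y
      value x = let (i , x∈) = union x in i , proj₁ (covers (all-stable i)) x∈

      φ-graph : ∀ x → ∃[ i ] Graph (G i) x (proj₁ (proj₂ (value x)))
      φ-graph x = proj₁ (value x) , proj₂ (proj₂ (value x))

      φ-value : ∀ {i x y} → Graph (G i) x y → proj₁ (proj₂ (value x)) ≡ y
      φ-value {i} = union-value G inhabitant G-directed idᵉ (λ x → proj₁ (proj₂ (value x))) φ-graph {i}

    automorphism : Automorphism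
    automorphism = record
      { self-emb = union-emb G inhabitant G-directed idᵉ (λ x → proj₁ (proj₂ (value x))) φ-graph
      ; surjective = λ y → let (i , y∈) = union y
                               (x , g) = proj₂ (covers (all-stable i)) y∈
                           in x , φ-value {i} g
      }

    automorphism-extends : ∀ {x y} → Graph π₀ x y → automorphism ⟨ x ⟩ ≡ y
    automorphism-extends g = φ-value {inhabitant} (grows (all-stable inhabitant) (inj₁ g))

  homogeneous : (P Q : Model) (φ : Model.str P ↪ Model.str Q) → IsSurjective φ →
                ∃[ h ] (∀ x → h ⟨ elem P x ⟩ ≡ elem Q (to φ x))
  homogeneous P Q φ surj = automorphism , λ x → automorphism-extends (x , ce x , cf (to φ x))
    where
    common = bound₂ (Model.stage P) (Model.stage Q)
    raised-P = raise P (<⇒≤ (proj₁ (proj₂ common)))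
    raised-Q = raise Q (<⇒≤ (proj₂ (proj₂ common)))
    ce = proj₂ (proj₂ raised-P)
    cf = proj₂ (proj₂ raised-Q)

    start : PartialIso
    start = record
      { dom = proj₁ raised-P ; cod = proj₁ raised-Q ∘ᵉ φ ; dom-strong = proj₁ (proj₂ raised-P)
      ; cod-strong = strong-trans (strong-iso φ (strong-dom (proj₁ (proj₂ raised-P))) surj) (proj₁ (proj₂ raised-Q)) }

    open BackAndForth start

-- Hulls of finite tuples and the Ehrenfeucht-Mostowski functor

⊑-trans-reflʳ : ∀ {m n} (f : m ⊑ n) → ⊑-trans f ⊑-refl ≡ f
⊑-trans-reflʳ end = refl
⊑-trans-reflʳ (keep f) = cong keep (⊑-trans-reflʳ f)
⊑-trans-reflʳ (drop f) = cong drop (⊑-trans-reflʳ f)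

-- An order embedding that is not onto misses a point and so factors through one of codimension one,
-- the kind for which the generators of a hull include the hull of the subtuple.
data Split : ∀ {m n} → m ⊑ n → Set where
  whole : ∀ {n} → Split (⊑-refl {n})
  part  : ∀ {m n} (g : n ⊑ suc n) (h : m ⊑ n) → Split (⊑-trans h g)

split : ∀ {m n} (f : m ⊑ n) → Split f
split end = whole
split (keep f) with split f
... | whole = whole
... | part g h = part (keep g) (keep h)
split (drop f) = subst Split (cong drop (⊑-trans-reflʳ f)) (part (drop ⊑-refl) f)

-- Finite sequences s of stages are assigned models H s ∋ c x (x in s), monotone under
-- subsequences and enumerated uniformly, so that homogeneity for isomorphism types of
-- the enumerated models yields a functor 𝓜 on finite linear orders.
module Hulls (lem : ∀ {a} → ExcludedMiddle a) (fe : ∀ {a b} → Extensionality a b)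
             {ℓ} (𝒦 : AEC ℓ) (𝕄 : Monster 𝒦) (amalg : AEC.Amalgamation 𝒦)
             (M : InMonster.Model 𝕄) {X : Set ℓ}
             (c : Monster.Stage 𝕄 → X → Structure.Carrier (Monster.ℭ 𝕄)) where
  open MonsterModel lem fe 𝒦 𝕄
  open Extension amalg using (point)
  open Partition lem fe length isOR using (template; Desc)
  open Structure using (fun; rel)
  open _↪_ using (injective; fun-hom; rel-iff)
  open Model using (str)

  -- Names for the elements of a hull: the first summand names the generators, the second enumerates
  -- everything through the Löwenheim-Skolem bound. As the type depends on `G` alone, hulls of
  -- different tuples can be compared name by name.
  Closure : Set ℓ → Set ℓ
  Closure G = G ⊎ (G ⊎ LS)

  record Hull (G : Set ℓ) (gen : G → ⟦ ℭ ⟧) : Set (lsuc ℓ) where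
    field
      model : Model
      enum  : Closure G → ⟦ str model ⟧
      enum-surjective : ∀ x → ∃[ t ] enum t ≡ x
      enum-gen : ∀ g → elem model (enum (inj₁ g)) ≡ gen g

  private
    hull-of′ : ∀ G gen → G → Hull G gen
    hull-of′ G gen g₀ = record
      { model = P ; enum = enum ; enum-surjective = surj
      ; enum-gen = λ g → trans (cong (to (incl s)) (proj₂ (covers (gₐ g)))) (proj₂ (pre g)) }
      where
      s = proj₁ (In-bounded gen)

      pre : ∀ g → In s (gen g)
      pre = proj₂ (In-bounded gen) ≤-refl

      A : Set ℓ
      A = Σ[ n ∈ ⟦ obj s ⟧ ] Squash (∃[ g ] proj₁ (pre g) ≡ n)

      gₐ : G → A
      gₐ g = proj₁ (pre g) , squash (g , refl)

      LST = downward (K-obj s) {A} (mk↣ {to = proj₁} Σ-Squash-≡)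
      f = proj₁ (proj₂ LST)
      covers = proj₁ (proj₂ (proj₂ (proj₂ LST)))
      small = proj₂ (proj₂ (proj₂ (proj₂ LST)))

      P : Model
      P = record { emb = f ; strong = proj₁ (proj₂ (proj₂ LST)) }

      index : G ⊎ LS → A ⊎ LS
      index (inj₁ g) = inj₁ (gₐ g)
      index (inj₂ z) = inj₂ z

      index-surjective : ∀ y → ∃[ z ] index z ≡ y
      index-surjective (inj₂ z) = inj₂ z , refl
      index-surjective (inj₁ (n , p)) = inj₁ (proj₁ (unsquash p)) , cong inj₁ (Σ-Squash-≡ (proj₂ (unsquash p)))

      pick : ∀ z → Dec (∃[ m ] Injection.to small m ≡ index z) → ⟦ str P ⟧
      pick z (yes (m , _)) = m
      pick z (no _) = proj₁ (covers (gₐ g₀))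

      pick-spec : ∀ z m → Injection.to small m ≡ index z → ∀ d → pick z d ≡ m
      pick-spec z m eq (yes (m′ , eq′)) = Injection.injective small (trans eq′ (sym eq))
      pick-spec z m eq (no ¬m) = ⊥-elim (¬m (m , eq))

      enum : Closure G → ⟦ str P ⟧
      enum (inj₁ g) = proj₁ (covers (gₐ g))
      enum (inj₂ z) = pick z lem

      surj : ∀ m → ∃[ t ] enum t ≡ m
      surj m = let (z , eq) = index-surjective (Injection.to small m) in inj₂ z , pick-spec z m (sym eq) lem

  abstract
    hull-of : ∀ G gen → G → Hull G gen
    hull-of = hull-of′

  -- Names depend on the length of the tuple only. Including the full hulls of the codimension-one
  -- subtuples makes hulls increase with the tuple. The summand ⊤ in `Gen zero` keeps the generators
  -- inhabited, as the default value in `hull-of` requires, even for an empty `M`.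
  T   : ℕ → Set ℓ
  Gen : ℕ → Set ℓ
  T n = Closure (Gen n)
  Gen zero = ⟦ str M ⟧ ⊎ ⊤
  Gen (suc n) = (n ⊑ suc n × T n) ⊎ X

  gen₀ : ∀ n → Gen n
  gen₀ zero = inj₂ tt
  gen₀ (suc n) = inj₁ (drop ⊑-refl , inj₁ (gen₀ n))

  gen  : ∀ n → Vec Stage n → Gen n → ⟦ ℭ ⟧
  hull : ∀ n v → Hull (Gen n) (gen n v)
  E    : ∀ n → Vec Stage n → T n → ⟦ ℭ ⟧
  gen zero v (inj₁ m) = elem M m
  gen zero v (inj₂ tt) = point
  gen (suc n) v (inj₁ (f , t)) = E n (select f v) t
  gen (suc n) (x ∷ v) (inj₂ ξ) = c x ξ
  hull n v = hull-of (Gen n) (gen n v) (gen₀ n)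
  E n v t = elem (Hull.model (hull n v)) (Hull.enum (hull n v) t)

  H : ∀ {n} → Vec Stage n → Model
  H {n} v = Hull.model (hull n v)

  enum : ∀ {n} (v : Vec Stage n) → T n → ⟦ str (H v) ⟧
  enum {n} v = Hull.enum (hull n v)

  enum-surjective : ∀ {n} (v : Vec Stage n) x → ∃[ t ] enum v t ≡ x
  enum-surjective {n} v = Hull.enum-surjective (hull n v)

  T-map : ∀ {m n} (f : m ⊑ n) → Σ[ φ ∈ (T m → T n) ] ∀ v t → E n v (φ t) ≡ E m (select f v) t
  T-map f with split f
  ... | whole {n} = id , λ v t → cong (λ w → E n w t) (sym (select-refl v))
  ... | part {m} {n} g h = let (φ , eq) = T-map h in (λ t → inj₁ (inj₁ (g , φ t))) , λ v t →
        trans (Hull.enum-gen (hull (suc n) v) (inj₁ (g , φ t)))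
        (trans (eq (select g v) t) (cong (λ w → E m w t) (sym (select-trans h g v))))

  -- The quantifier-free diagram of an enumerated hull, coded by Booleans so that it is a colour in
  -- `Set ℓ` for `template`.
  Pattern : ℕ → Set ℓ
  Pattern n = (T n → T n → Bool) × (∀ F → Vec (T n) (funArity F) → T n → Bool) ×
              (∀ R → Vec (T n) (relArity R) → Bool)
    where open Vocabulary τ

  pattern-of : ∀ n → Vec Stage n → Pattern n
  pattern-of n v = (λ t t′ → decide (E n v t ≡ E n v t′)) ,
                (λ F ts t → decide (fun ℭ F (map (E n v) ts) ≡ E n v t)) ,
                (λ R ts → decide (rel ℭ R (map (E n v) ts)))

  module _ {n} (v w : Vec Stage n) (eq : pattern-of n v ≡ pattern-of n w) where
    private
      ≡-transfer : ∀ {t t′} → E n v t ≡ E n v t′ → E n w t ≡ E n w t′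
      ≡-transfer {t} {t′} = decide-transfer (cong (λ p → proj₁ p t t′) eq)

      ≡-transfer⁻ : ∀ {t t′} → E n w t ≡ E n w t′ → E n v t ≡ E n v t′
      ≡-transfer⁻ {t} {t′} = decide-transfer (sym (cong (λ p → proj₁ p t t′) eq))

      term : ⟦ str (H v) ⟧ → T n
      term x = proj₁ (enum-surjective v x)

      E-term : ∀ x → E n v (term x) ≡ elem (H v) x
      E-term x = cong (elem (H v)) (proj₂ (enum-surjective v x))

      γ : ⟦ str (H v) ⟧ → ⟦ str (H w) ⟧
      γ x = enum w (term x)

      map-term : ∀ {k} (xs : Vec ⟦ str (H v) ⟧ k) → map (E n v) (map term xs) ≡ map (elem (H v)) xs
      map-term xs = trans (sym (map-∘ (E n v) term xs)) (map-cong E-term xs)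

      map-γ : ∀ {k} (xs : Vec ⟦ str (H v) ⟧ k) → map (E n w) (map term xs) ≡ map (elem (H w)) (map γ xs)
      map-γ xs = trans (sym (map-∘ (E n w) term xs)) (map-∘ (elem (H w)) γ xs)

    pattern-iso : str (H v) ↪ str (H w)
    pattern-iso = record
      { to = γ
      ; injective = λ {x} {y} e → injective (elemᵉ (H v)) (trans (sym (E-term x))
          (trans (≡-transfer⁻ (cong (elem (H w)) e)) (E-term y)))
      ; fun-hom = λ F xs → injective (elemᵉ (H w)) (trans
          (sym (decide-transfer (cong (λ p → proj₁ (proj₂ p) F (map term xs) (term (fun (str (H v)) F xs))) eq)
            (trans (cong (fun ℭ F) (map-term xs)) (trans (sym (fun-hom (elemᵉ (H v)) F xs)) (sym (E-term _))))))
          (trans (cong (fun ℭ F) (map-γ xs)) (sym (fun-hom (elemᵉ (H w)) F (map γ xs)))))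
      ; rel-iff = λ R xs → mk⇔
          (λ r → Equivalence.from (rel-iff (elemᵉ (H w)) R (map γ xs)) (subst (rel ℭ R) (map-γ xs)
            (decide-transfer (cong (λ p → proj₂ (proj₂ p) R (map term xs)) eq)
              (subst (rel ℭ R) (sym (map-term xs)) (Equivalence.to (rel-iff (elemᵉ (H v)) R xs) r)))))
          (λ r → Equivalence.from (rel-iff (elemᵉ (H v)) R xs) (subst (rel ℭ R) (map-term xs)
            (decide-transfer (sym (cong (λ p → proj₂ (proj₂ p) R (map term xs)) eq))
              (subst (rel ℭ R) (sym (map-γ xs)) (Equivalence.to (rel-iff (elemᵉ (H w)) R (map γ xs)) r)))))
      }

    pattern-iso-enum : ∀ t → elem (H w) (to pattern-iso (enum v t)) ≡ E n w t
    pattern-iso-enum t = ≡-transfer (E-term (enum v t))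

    pattern-iso-surjective : IsSurjective pattern-iso
    pattern-iso-surjective y = let (t , e) = enum-surjective w y
      in enum v t , injective (elemᵉ (H w)) (trans (pattern-iso-enum t) (cong (elem (H w)) e))

  private
    tpl = template pattern-of

  abstract
    s : ∀ n → Vec Stage n
    s = proj₁ (proj₂ tpl)

    s-desc : ∀ n → Desc (s n)
    s-desc = proj₁ (proj₂ (proj₂ tpl))

    s-pattern : ∀ {m n} (f : m ⊑ n) → pattern-of m (select f (s n)) ≡ proj₁ tpl m
    s-pattern = proj₂ (proj₂ (proj₂ tpl))

  𝓜 : ℕ → Structure τ ℓ
  𝓜 n = str (H (s n))

  K-𝓜 : ∀ n → K (𝓜 n)
  K-𝓜 n = strong-dom (Model.strong (H (s n)))

  module _ {m n} (f : m ⊑ n) where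
    private
      same : pattern-of m (s m) ≡ pattern-of m (select f (s n))
      same = trans (cong (pattern-of m) (sym (select-refl (s m)))) (trans (s-pattern ⊑-refl) (sym (s-pattern f)))

      φ = proj₁ (T-map f)

      γ : ⟦ str (H (select f (s n))) ⟧ → 𝓜 n .Structure.Carrier
      γ x = enum (s n) (φ (proj₁ (enum-surjective (select f (s n)) x)))

      γ-elem : ∀ x → elem (H (s n)) (γ x) ≡ elem (H (select f (s n))) x
      γ-elem x = trans (proj₂ (T-map f) (s n) _) (cong (elem (H (select f (s n)))) (proj₂ (enum-surjective (select f (s n)) x)))

      sub : str (H (select f (s n))) ↪ 𝓜 n
      sub = ≼-emb (H (select f (s n))) (H (s n)) γ γ-elem

    abstract
      -- By `template` the tuple `s m` and the subtuple of `s n` at f have the same pattern, so the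
      -- hull of `s m` is isomorphic, name by name, to a submodel of the hull of `s n`.
      𝓜-map : 𝓜 m ↪ 𝓜 n
      𝓜-map = sub ∘ᵉ pattern-iso (s m) (select f (s n)) same

      𝓜-map-strong : IsStrong 𝓜-map
      𝓜-map-strong = strong-trans
        (strong-iso (pattern-iso (s m) (select f (s n)) same) (K-𝓜 m) (pattern-iso-surjective (s m) (select f (s n)) same))
        (≼-emb-strong (H (select f (s n))) (H (s n)) γ γ-elem)

      𝓜-map-enum : ∀ t → elem (H (s n)) (to 𝓜-map (enum (s m) t)) ≡ E m (select f (s n)) t
      𝓜-map-enum t = trans (γ-elem _) (pattern-iso-enum (s m) (select f (s n)) same t)

      𝓜-map-φ : ∀ t → to 𝓜-map (enum (s m) t) ≡ enum (s n) (φ t)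
      𝓜-map-φ t = injective (elemᵉ (H (s n))) (trans (𝓜-map-enum t) (sym (proj₂ (T-map f) (s n) t)))

  𝓜-map-refl : ∀ {n} x → to (𝓜-map (⊑-refl {n})) x ≡ x
  𝓜-map-refl {n} x with enum-surjective (s n) x
  ... | t , refl = injective (elemᵉ (H (s n))) (trans (𝓜-map-enum ⊑-refl t) (cong (λ v → E n v t) (select-refl (s n))))

  -- `T-map` is known to compose only up to evaluation, so both sides are compared as elements of ℭ.
  𝓜-map-trans : ∀ {k m n} (f : k ⊑ m) (g : m ⊑ n) x →
                to (𝓜-map g) (to (𝓜-map f) x) ≡ to (𝓜-map (⊑-trans f g)) x
  𝓜-map-trans {k} {m} {n} f g x with enum-surjective (s k) x
  ... | t , refl = injective (elemᵉ (H (s n)))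
        (trans (cong (elem (H (s n)) ∘ to (𝓜-map g)) (𝓜-map-φ f t))
        (trans (𝓜-map-enum g (proj₁ (T-map f) t))
        (trans (proj₂ (T-map f) (select g (s n)) t)
        (trans (cong (λ v → E k v t) (sym (select-trans f g (s n))))
               (sym (𝓜-map-enum (⊑-trans f g) t))))))

  base-point : ⟦ str M ⟧ → ⟦ 𝓜 0 ⟧
  base-point m = enum (s 0) (inj₁ (inj₁ m))

  base-elem : ∀ m → elem (H (s 0)) (base-point m) ≡ elem M m
  base-elem m = Hull.enum-gen (hull 0 (s 0)) (inj₁ m)

  base : str M ↪ 𝓜 0
  base = ≼-emb M (H (s 0)) base-point base-elem

  base-strong : IsStrong base
  base-strong = ≼-emb-strong M (H (s 0)) base-point base-elem

  base-map : ∀ {n} (f : 0 ⊑ n) m → elem (H (s n)) (to (𝓜-map f) (to base m)) ≡ elem M m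
  base-map {n} f m with select f (s n) | 𝓜-map-enum f (inj₁ (inj₁ m))
  ... | [] | eq = trans eq (Hull.enum-gen (hull 0 []) (inj₁ m))

  pt : X → ⟦ 𝓜 1 ⟧
  pt ξ = enum (s 1) (inj₁ (inj₂ ξ))

  pt-map : ∀ {n} (f : 1 ⊑ n) {x} → select f (s n) ≡ x ∷ [] → ∀ ξ → elem (H (s n)) (to (𝓜-map f) (pt ξ)) ≡ c x ξ
  pt-map {n} f {x} eq ξ = trans (𝓜-map-enum f (inj₁ (inj₂ ξ)))
    (trans (cong (λ v → E 1 v (inj₁ (inj₂ ξ))) eq) (Hull.enum-gen (hull 1 (x ∷ [])) (inj₂ ξ)))

-- Finite descending sequences in a linear order

module LinearOrders {a} {I : Set a} {_<_ : I → I → Set a} (sto : IsStrictTotalOrder _≡_ _<_) where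
  open IsStrictTotalOrder sto using (compare; irrefl) renaming (trans to <-trans)
  open Descending _<_

  record Join {m n} (u : Vec I m) (v : Vec I n) : Set (lsuc a) where
    constructor join
    field
      {size}      : ℕ
      seq         : Vec I size
      desc        : Desc seq
      left        : m ⊑ size
      right       : n ⊑ size
      left-eq     : select left seq ≡ u
      right-eq    : select right seq ≡ v
      joint       : ∀ {P : I → Set a} → All P u → All P v → All P seq

  ∅⊑ : ∀ n → 0 ⊑ n
  ∅⊑ zero = end
  ∅⊑ (suc n) = drop (∅⊑ n)

  select-∅ : ∀ {n} (f : 0 ⊑ n) (v : Vec I n) → select f v ≡ []
  select-∅ f v with select f v
  ... | [] = refl

  private
    merge : ∀ {m n} (u : Vec I m) (v : Vec I n) → Desc u → Desc v → Join u v
    merge [] v [] dv = join v dv (∅⊑ _) ⊑-refl (select-∅ (∅⊑ _) v) (select-refl v) λ _ pv → pv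
    merge u@(_ ∷ _) [] du [] = join u du ⊑-refl (∅⊑ _) (select-refl u) (select-∅ (∅⊑ _) u) λ pu _ → pu
    merge u@(x ∷ u′) v@(y ∷ v′) du@(u′<x ∷ du′) dv@(v′<y ∷ dv′) with compare x y
    ... | tri< x<y _ _ with merge u v′ du dv′
    ... | join w dw f g e e′ all =
          join (y ∷ w) (all (x<y ∷ All.map (λ l → <-trans l x<y) u′<x) v′<y ∷ dw) (drop f) (keep g) e (cong (y ∷_) e′)
          λ { pu (py ∷ pv) → py ∷ all pu pv }
    merge u@(x ∷ u′) v@(y ∷ v′) du@(u′<x ∷ du′) dv@(v′<y ∷ dv′) | tri> _ _ y<x with merge u′ v du′ dv
    ... | join w dw f g e e′ all =
          join (x ∷ w) (all u′<x (y<x ∷ All.map (λ l → <-trans l y<x) v′<y) ∷ dw) (keep f) (drop g) (cong (x ∷_) e) e′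
          λ { (px ∷ pu) pv → px ∷ all pu pv }
    merge u@(x ∷ u′) v@(x ∷ v′) du@(u′<x ∷ du′) dv@(v′<x ∷ dv′) | tri≈ _ refl _ with merge u′ v′ du′ dv′
    ... | join w dw f g e e′ all =
          join (x ∷ w) (all u′<x v′<x ∷ dw) (keep f) (keep g) (cong (x ∷_) e) (cong (x ∷_) e′)
          λ { (px ∷ pu) (_ ∷ pv) → px ∷ all pu pv }

  abstract
    joins : ∀ {m n} {u : Vec I m} {v : Vec I n} → Desc u → Desc v → Join u v
    joins du dv = merge _ _ du dv

  -- By strictness of `Desc` an embedding is determined by the subset that it selects, so the
  -- colimit diagram has at most one map between two finite subsets of `I`.
  select-injective : ∀ {m n} {f g : m ⊑ n} {w : Vec I n} → Desc w → select f w ≡ select g w → f ≡ g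
  select-injective {f = end} {end} d eq = refl
  select-injective {f = keep f} {keep g} (_ ∷ d) eq = cong keep (select-injective d (cong tail eq))
  select-injective {f = drop f} {drop g} (_ ∷ d) eq = cong drop (select-injective d eq)
  select-injective {f = keep f} {drop g} {x ∷ w} (w<x ∷ d) eq with select g w | select-All g w<x
  select-injective {f = keep f} {drop g} {x ∷ w} (w<x ∷ d) refl | _ | x<x ∷ _ = ⊥-elim (irrefl refl x<x)
  select-injective {f = drop f} {keep g} {x ∷ w} (w<x ∷ d) eq with select f w | select-All f w<x
  select-injective {f = drop f} {keep g} {x ∷ w} (w<x ∷ d) refl | _ | x<x ∷ _ = ⊥-elim (irrefl refl x<x)

  _∈ᵛ_ : ∀ {n} → I → Vec I n → Set a
  x ∈ᵛ v = Any (x ≡_) v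

  ∈ᵛ-self : ∀ {n} (v : Vec I n) → All (_∈ᵛ v) v
  ∈ᵛ-self [] = []
  ∈ᵛ-self (x ∷ v) = here refl ∷ All.map there (∈ᵛ-self v)

  ∈ᵛ-All : ∀ {n p} {P : I → Set p} {x} {v : Vec I n} → All P v → x ∈ᵛ v → P x
  ∈ᵛ-All (px ∷ _) (here refl) = px
  ∈ᵛ-All (_ ∷ pv) (there x∈) = ∈ᵛ-All pv x∈

  private
    ∈ᵛ-below : ∀ {n m x} {v : Vec I n} {w : Vec I m} → All (_< x) w → All (_∈ᵛ (x ∷ v)) w → All (_∈ᵛ v) w
    ∈ᵛ-below [] [] = []
    ∈ᵛ-below (x<x ∷ _) (here refl ∷ _) = ⊥-elim (irrefl refl x<x)
    ∈ᵛ-below (_ ∷ w<x) (there y∈ ∷ w∈) = y∈ ∷ ∈ᵛ-below w<x w∈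

  subsequence : ∀ {m n} {w : Vec I m} {v : Vec I n} → Desc w → Desc v → All (_∈ᵛ v) w →
                Σ[ f ∈ m ⊑ n ] select f v ≡ w
  subsequence {v = v} [] dv w∈ = ∅⊑ _ , select-∅ (∅⊑ _) v
  subsequence (w<x ∷ dw) (v<x ∷ dv) (here refl ∷ w∈) with subsequence dw dv (∈ᵛ-below w<x w∈)
  ... | f , eq = keep f , cong (_ ∷_) eq
  subsequence (w<x ∷ dw) (v<y ∷ dv) (there x∈ ∷ w∈)
    with subsequence (w<x ∷ dw) dv (x∈ ∷ ∈ᵛ-below (All.map (λ l → <-trans l (∈ᵛ-All v<y x∈)) w<x) w∈)
  ... | f , eq = drop f , eq

  sort : ∀ {n} (v : Vec I n) → ∃[ k ] Σ[ w ∈ Vec I k ] (Desc w × All (_∈ᵛ v) w × All (_∈ᵛ w) v)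
  sort [] = 0 , [] , [] , [] , []
  sort (x ∷ v) with sort v
  ... | k , w , dw , w∈v , v∈w with joins {u = x ∷ []} ([] ∷ []) dw
  ... | join z dz f g fe ge joint =
        _ , z , dz , joint (here refl ∷ []) (All.map there w∈v) ,
        All.head in-left ∷ All.map (∈ᵛ-All in-right) v∈w
    where
    in-left = subst (All (_∈ᵛ z)) fe (select-All f (∈ᵛ-self z))
    in-right = subst (All (_∈ᵛ z)) ge (select-All g (∈ᵛ-self z))

-- The colimit over the finite subsets of a linear order

module Colimit (lem : ∀ {a} → ExcludedMiddle a) (fe : ∀ {a b} → Extensionality a b)
               {ℓ} {τ : Vocabulary ℓ} (𝓜 : ℕ → Structure τ ℓ)
               (𝓜-map : ∀ {m n} → m ⊑ n → 𝓜 m ↪ 𝓜 n)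
               (𝓜-map-refl : ∀ {n} x → to (𝓜-map (⊑-refl {n})) x ≡ x)
               (𝓜-map-trans : ∀ {k m n} (f : k ⊑ m) (g : m ⊑ n) x →
                              to (𝓜-map g) (to (𝓜-map f) x) ≡ to (𝓜-map (⊑-trans f g)) x)
               {I : Set ℓ} {_<_ : I → I → Set ℓ} (sto : IsStrictTotalOrder _≡_ _<_) where
  open Classical lem
  open LinearOrders sto
  open Descending _<_
  open Structure using (fun; rel)
  open _↪_ using (injective; fun-hom; rel-iff)
  open Join

  Germ : Set ℓ
  Germ = Σ[ n ∈ ℕ ] Σ[ s ∈ Vec I n ] (Desc s × ⟦ 𝓜 n ⟧)

  record AgreeAt {m n k} (u : Vec I m) (x : ⟦ 𝓜 m ⟧) (v : Vec I n) (y : ⟦ 𝓜 n ⟧) (w : Vec I k) : Set ℓ where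
    constructor agree
    field
      {f}  : m ⊑ k
      {g}  : n ⊑ k
      f-eq : select f w ≡ u
      g-eq : select g w ≡ v
      eq   : to (𝓜-map f) x ≡ to (𝓜-map g) y

  _~_ : Germ → Germ → Set ℓ
  (m , u , _ , x) ~ (n , v , _ , y) = ∃[ k ] Σ[ w ∈ Vec I k ] (Desc w × AgreeAt u x v y w)

  module _ {m n k l} {u : Vec I m} {x : ⟦ 𝓜 m ⟧} {v : Vec I n} {y : ⟦ 𝓜 n ⟧} {w : Vec I k} {z : Vec I l} where
    agree-up : (h : k ⊑ l) → select h z ≡ w → AgreeAt u x v y w → AgreeAt u x v y z
    agree-up h refl (agree {f} {g} refl refl eq) = agree {f = ⊑-trans f h} {g = ⊑-trans g h}
      (select-trans f h z) (select-trans g h z)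
      (trans (sym (𝓜-map-trans f h x)) (trans (cong (to (𝓜-map h)) eq) (𝓜-map-trans g h y)))

  -- Both upper bounds embed in their join. There the embeddings are unique by `select-injective`,
  -- and injectivity of `𝓜-map` brings the equality back down; agreement at one upper bound is thus
  -- agreement at all.
  agree-at : ∀ {m n k} {u : Vec I m} {x : ⟦ 𝓜 m ⟧} {v : Vec I n} {y : ⟦ 𝓜 n ⟧} {du dv} →
             (m , u , du , x) ~ (n , v , dv , y) → {w : Vec I k} → Desc w →
             ∀ {f g} → select f w ≡ u → select g w ≡ v → to (𝓜-map f) x ≡ to (𝓜-map g) y
  agree-at {x = x} {y = y} (_ , w′ , dw′ , ag) {w} dw {f} {g} fe′ ge with joins dw′ dw
  ... | join z dz h h′ he he′ _ with agree-up h he ag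
  ... | agree {f′} {g′} f′e g′e eq = injective (𝓜-map h′)
          (trans (𝓜-map-trans f h′ x)
          (trans (cong (λ f → to (𝓜-map f) x) (select-injective dz (trans (trans (select-trans f h′ z) (trans (cong (select f) he′) fe′)) (sym f′e))))
          (trans eq
          (trans (cong (λ g → to (𝓜-map g) y) (select-injective dz (trans g′e (sym (trans (select-trans g h′ z) (trans (cong (select g) he′) ge))))))
                 (sym (𝓜-map-trans g h′ y))))))

  ~-refl : ∀ {p} → p ~ p
  ~-refl {_ , s , d , x} = _ , s , d , agree {f = ⊑-refl} {g = ⊑-refl} (select-refl s) (select-refl s) refl

  ~-sym : ∀ {p q} → p ~ q → q ~ p
  ~-sym (_ , w , d , agree fe ge eq) = _ , w , d , agree ge fe (sym eq)

  ~-trans : ∀ {p q r} → p ~ q → q ~ r → p ~ r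
  ~-trans {q = _ , _ , _ , y} (_ , w , d , a) (_ , w′ , d′ , a′) with joins d d′
  ... | join z dz h h′ he he′ _ with agree-up h he a | agree-up h′ he′ a′
  ... | agree fe ge eq | agree fe′ ge′ eq′ = _ , z , dz , agree fe ge′
          (trans eq (trans (cong (λ g → to (𝓜-map g) y) (select-injective dz (trans ge (sym fe′)))) eq′))

  open Quotient fe _~_ (λ {p} → ~-refl {p}) (λ {p} {q} → ~-sym {p} {q}) (λ {p} {q} {r} → ~-trans {p} {q} {r})

  private
    ι₀ : ∀ {n} (s : Vec I n) → Desc s → ⟦ 𝓜 n ⟧ → Quot
    ι₀ s d x = [ _ , s , d , x ]

    ι₀-injective : ∀ {n} {s : Vec I n} {d} {x y} → ι₀ s d x ≡ ι₀ s d y → x ≡ y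
    ι₀-injective {s = s} {d} {x} {y} eq = trans (sym (𝓜-map-refl x))
      (trans (agree-at {du = d} {d} ([]-injective eq) d (select-refl s) (select-refl s)) (𝓜-map-refl y))

    ι₀-map : ∀ {m n} {s : Vec I m} {d} (f : m ⊑ n) {w : Vec I n} (dw : Desc w) → select f w ≡ s →
             ∀ x → ι₀ s d x ≡ ι₀ w dw (to (𝓜-map f) x)
    ι₀-map f {w} dw e x = []-cong (_ , w , dw , agree e (select-refl w) (sym (𝓜-map-refl _)))

    record Lifting {k} (xs : Vec Quot k) : Set ℓ where
      constructor lifted
      field
        {lsize} : ℕ
        lseq    : Vec I lsize
        ldesc   : Desc lseq
        lvals   : Vec ⟦ 𝓜 lsize ⟧ k
        leq     : map (ι₀ lseq ldesc) lvals ≡ xs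

    map-ι₀-map : ∀ {m n k} {s : Vec I m} {d} (f : m ⊑ n) {w : Vec I n} (dw : Desc w) → select f w ≡ s →
                 (xs : Vec ⟦ 𝓜 m ⟧ k) → map (ι₀ w dw) (map (to (𝓜-map f)) xs) ≡ map (ι₀ s d) xs
    map-ι₀-map f {w} dw e xs = trans (sym (map-∘ (ι₀ w dw) (to (𝓜-map f)) xs))
      (map-cong (λ x → sym (ι₀-map f dw e x)) xs)

    lift-vec : ∀ {k} (xs : Vec Quot k) → Lifting xs
    lift-vec [] = lifted [] [] [] refl
    lift-vec (q ∷ xs) with []-surjective q | lift-vec xs
    ... | (_ , u , du , x) , refl | lifted v dv ys refl with joins du dv
    ... | join w dw f g fe ge _ = lifted w dw (to (𝓜-map f) x ∷ map (to (𝓜-map g)) ys)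
            (cong₂ _∷_ (sym (ι₀-map f dw fe x)) (map-ι₀-map g dw ge ys))

    map-ι₀-injective : ∀ {n k} {s : Vec I n} {d} {xs ys : Vec ⟦ 𝓜 n ⟧ k} →
                       map (ι₀ s d) xs ≡ map (ι₀ s d) ys → xs ≡ ys
    map-ι₀-injective {xs = []} {[]} eq = refl
    map-ι₀-injective {xs = x ∷ xs} {y ∷ ys} eq = cong₂ _∷_
      (ι₀-injective (cong head eq)) (map-ι₀-injective (cong tail eq))

  U : Structure τ ℓ
  U = record
    { Carrier = Quot
    ; fun = λ F xs → let open Lifting (lift-vec xs) in ι₀ lseq ldesc (fun (𝓜 lsize) F lvals)
    ; rel = λ R xs → let open Lifting (lift-vec xs) in rel (𝓜 lsize) R lvals
    }

  private
    -- Makes the operations of `U` independent of the lift chosen by `lift-vec`: two lifts of one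
    -- tuple become equal over the join of their index sequences.
    meet : ∀ {m n k} {s : Vec I m} {d} {v : Vec I n} {dv} (xs : Vec ⟦ 𝓜 m ⟧ k) (ys : Vec ⟦ 𝓜 n ⟧ k) →
           map (ι₀ v dv) ys ≡ map (ι₀ s d) xs → (j : Join s v) →
           map (to (𝓜-map (left j))) xs ≡ map (to (𝓜-map (right j))) ys
    meet xs ys eq j = map-ι₀-injective {d = desc j} (trans (map-ι₀-map (left j) (desc j) (left-eq j) xs)
      (trans (sym eq) (sym (map-ι₀-map (right j) (desc j) (right-eq j) ys))))

    ι₀-fun : ∀ {n} (s : Vec I n) d F xs → ι₀ s d (fun (𝓜 n) F xs) ≡ fun U F (map (ι₀ s d) xs)
    ι₀-fun {n} s d F xs with lift-vec (map (ι₀ s d) xs)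
    ... | lifted {m} v dv ys eq with joins d dv
    ... | j = trans (ι₀-map (left j) (desc j) (left-eq j) _)
             (trans (cong (ι₀ (seq j) (desc j))
               (trans (fun-hom (𝓜-map (left j)) F xs)
               (trans (cong (fun (𝓜 (size j)) F) (meet xs ys eq j))
                      (sym (fun-hom (𝓜-map (right j)) F ys)))))
              (sym (ι₀-map (right j) (desc j) (right-eq j) _)))

    ι₀-rel : ∀ {n} (s : Vec I n) d R xs → rel (𝓜 n) R xs ⇔ rel U R (map (ι₀ s d) xs)
    ι₀-rel {n} s d R xs with lift-vec (map (ι₀ s d) xs)
    ... | lifted {m} v dv ys eq with joins d dv
    ... | j = mk⇔
      (λ r → Equivalence.from (rel-iff (𝓜-map (right j)) R ys) (subst (rel (𝓜 (size j)) R) (meet xs ys eq j)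
               (Equivalence.to (rel-iff (𝓜-map (left j)) R xs) r)))
      (λ r → Equivalence.from (rel-iff (𝓜-map (left j)) R xs) (subst (rel (𝓜 (size j)) R) (sym (meet xs ys eq j))
               (Equivalence.to (rel-iff (𝓜-map (right j)) R ys) r)))

  ι : ∀ {n} (s : Vec I n) → Desc s → 𝓜 n ↪ U
  ι s d = record { to = ι₀ s d ; injective = ι₀-injective ; fun-hom = ι₀-fun s d ; rel-iff = ι₀-rel s d }

  ι-map : ∀ {m n} {s : Vec I m} (d : Desc s) (f : m ⊑ n) {w : Vec I n} (dw : Desc w) → select f w ≡ s →
          ∀ x → to (ι s d) x ≡ to (ι w dw) (to (𝓜-map f) x)
  ι-map d f dw e x = ι₀-map f dw e x

  ι-cover : ∀ u → ∃[ n ] Σ[ s ∈ Vec I n ] Σ[ d ∈ Desc s ] ∃[ x ] to (ι s d) x ≡ u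
  ι-cover u with []-surjective u
  ... | (n , s , d , x) , eq = n , s , d , x , eq

-- Strong submodels generated by subsets of the index order

-- Submodels of a colimit U of models over the finite subsets of a linear order I,
-- generated by subsets of I.
module Generation (lem : ∀ {a} → ExcludedMiddle a) {ℓ} (𝒦 : AEC ℓ)
                  (𝓜 : ℕ → Structure (AEC.τ 𝒦) ℓ)
                  (𝓜-map : ∀ {m n} → m ⊑ n → 𝓜 m ↪ 𝓜 n)
                  (𝓜-map-strong : ∀ {m n} (f : m ⊑ n) → AEC.IsStrong 𝒦 (𝓜-map f))
                  {I : Set ℓ} {_<_ : I → I → Set ℓ} (sto : IsStrictTotalOrder _≡_ _<_)
                  (U : Structure (AEC.τ 𝒦) ℓ) (ι : ∀ {n} (s : Vec I n) → Descending.Desc _<_ s → 𝓜 n ↪ U)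
                  (ι-map : ∀ {m n} {s : Vec I m} (d : Descending.Desc _<_ s) (f : m ⊑ n) {w : Vec I n}
                           (dw : Descending.Desc _<_ w) →
                           select f w ≡ s → ∀ x → to (ι s d) x ≡ to (ι w dw) (to (𝓜-map f) x)) where
  open AEC 𝒦
  open Descending _<_
  open Classical lem
  open Embeddings {τ = τ}
  open LinearOrders sto
  open Structure using (fun; rel)
  open _↪_ using (injective; fun-hom; rel-iff)

  Subset′ : Set (lsuc ℓ)
  Subset′ = I → Set ℓ

  infix 4 _⊆′_ _≺_

  _⊆′_ : Subset′ → Subset′ → Set ℓ
  S ⊆′ T = ∀ x → S x → T x

  Gen : Subset′ → ⟦ U ⟧ → Set ℓ
  Gen S u = ∃[ n ] Σ[ s ∈ Vec I n ] Σ[ d ∈ Desc s ] (All S s × (∃[ x ] to (ι s d) x ≡ u))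

  Gen-mono : ∀ {S T} → S ⊆′ T → ∀ {u} → Gen S u → Gen T u
  Gen-mono p (n , s , d , Ss , x) = n , s , d , All.map (p _) Ss , x

  Elem : Subset′ → Set ℓ
  Elem S = Σ[ u ∈ ⟦ U ⟧ ] Squash (Gen S u)

  private
    lift-vec : ∀ {S k} (xs : Vec (Elem S) k) →
      ∃[ n ] Σ[ s ∈ Vec I n ] Σ[ d ∈ Desc s ] (All S s × (∃[ ys ] map (to (ι s d)) ys ≡ map proj₁ xs))
    lift-vec [] = 0 , [] , [] , [] , [] , refl
    lift-vec ((u , g) ∷ xs) with unsquash g | lift-vec xs
    ... | _ , s , d , Ss , x , refl | _ , v , dv , Sv , ys , eq with joins d dv
    ... | join w dw f g fe ge joint = _ , w , dw , joint Ss Sv , to (𝓜-map f) x ∷ map (to (𝓜-map g)) ys ,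
          cong₂ _∷_ (sym (ι-map d f dw fe x))
            (trans (sym (map-∘ (to (ι w dw)) (to (𝓜-map g)) ys))
              (trans (map-cong (λ y → sym (ι-map dv g dw ge y)) ys) eq))

    closed : ∀ {S} F (xs : Vec (Elem S) _) → Gen S (fun U F (map proj₁ xs))
    closed F xs with lift-vec xs
    ... | n , s , d , Ss , ys , eq = n , s , d , Ss , fun (𝓜 n) F ys ,
          trans (fun-hom (ι s d) F ys) (cong (fun U F) eq)

  E : Subset′ → Structure τ ℓ
  E S = record
    { Carrier = Elem S
    ; fun = λ F xs → fun U F (map proj₁ xs) , squash (closed F xs)
    ; rel = λ R xs → rel U R (map proj₁ xs) }

  inU : ∀ S → E S ↪ U
  inU S = record { to = proj₁ ; injective = Σ-Squash-≡ ; fun-hom = λ F xs → refl ; rel-iff = λ R xs → mk⇔ id id }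

  mono : ∀ {S T} → S ⊆′ T → E S ↪ E T
  mono {S} {T} p = factor (inU S) (inU T) (λ (u , g) → u , squash (Gen-mono p (unsquash g))) (λ _ → refl)

  record _≺_ (S T : Subset′) : Set (lsuc ℓ) where
    constructor _,_
    field
      sub    : S ⊆′ T
      strong : IsStrong (mono {S} {T} sub)

  open _≺_

  K-E : ∀ {S T} → S ≺ T → K (E S)
  K-E (_ , st) = strong-dom st

  ≺-trans : ∀ {S T V} → S ≺ T → T ≺ V → S ≺ V
  ≺-trans (p , sp) (q , sq) = (λ x z → q x (p x z)) , strong-resp (λ _ → Σ-Squash-≡ refl) (strong-trans sp sq)

  ≺⇒strong : ∀ {S T} → S ≺ T → (p : S ⊆′ T) → IsStrong (mono {S} {T} p)
  ≺⇒strong (_ , st) p = strong-resp (λ _ → Σ-Squash-≡ refl) st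

  ≐-strong : ∀ {S T} → K (E S) → S ⊆′ T → T ⊆′ S → S ≺ T
  ≐-strong {S} {T} k p q = p , strong-iso (mono {S} {T} p) k λ (u , g) →
    (u , squash (Gen-mono q (unsquash g))) , Σ-Squash-≡ refl

  ≺-resp : ∀ {S S′ T T′} → S ⊆′ T → T ⊆′ S → S′ ⊆′ T′ → T′ ⊆′ S′ → S ≺ S′ → T ≺ T′
  ≺-resp {S} {S′} {T} {T′} p q p′ q′ st =
    ≺-trans {T} {S} {T′} (≐-strong {T} {S} (strong-cod (strong (≐-strong {S} {T} (K-E {S} {S′} st) p q))) q p)
      (≺-trans {S} {S′} {T′} st (≐-strong {S′} {T′} (strong-cod (strong st)) p′ q′))

  infixl 6 _∪ᵛ_

  _∪ᵛ_ : ∀ {n} → Subset′ → Vec I n → Subset′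
  (S ∪ᵛ F) x = S x ⊎ x ∈ᵛ F

  ∪ᵛ-mono : ∀ {m n S T} {F : Vec I m} {G : Vec I n} → S ⊆′ T → All (_∈ᵛ G) F → S ∪ᵛ F ⊆′ T ∪ᵛ G
  ∪ᵛ-mono p q x (inj₁ y) = inj₁ (p x y)
  ∪ᵛ-mono p q x (inj₂ y) = inj₂ (∈ᵛ-All q y)

  ∪ᵛ-left : ∀ {n S T} {F : Vec I n} → S ⊆′ T → S ∪ᵛ F ⊆′ T ∪ᵛ F
  ∪ᵛ-left p = ∪ᵛ-mono p (∈ᵛ-self _)

  -- The statement carried through the filtration. Finite sets stay adjoined because at a limit the
  -- submodels for F and G are first compared level by level, and then the chain axiom compares the
  -- unions.
  Fine : Subset′ → Set (lsuc ℓ)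
  Fine S = ∀ {m n} (F : Vec I m) (G : Vec I n) → All (_∈ᵛ G) F → S ∪ᵛ F ≺ S ∪ᵛ G

  Fine-resp : ∀ {S T} → S ⊆′ T → T ⊆′ S → Fine S → Fine T
  Fine-resp {S} {T} p q fine F G h =
    ≺-resp {S ∪ᵛ F} {S ∪ᵛ G} {T ∪ᵛ F} {T ∪ᵛ G} (∪ᵛ-left p) (∪ᵛ-left q) (∪ᵛ-left p) (∪ᵛ-left q) (fine F G h)

  ι-into : ∀ {n S} (s : Vec I n) (d : Desc s) → All S s → 𝓜 n ↪ E S
  ι-into {S = S} s d Ss = factor (ι s d) (inU S) (λ x → to (ι s d) x , squash (_ , s , d , Ss , x , refl)) (λ _ → refl)

  ι-into-strong : ∀ {n S} (s : Vec I n) (d : Desc s) (Ss : All S s) → (∀ {x} → S x → x ∈ᵛ s) →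
                  IsStrong (ι-into {S = S} s d Ss)
  ι-into-strong {S = S} s d Ss S⊆ = strong-iso (ι-into {S = S} s d Ss) (strong-dom (𝓜-map-strong (⊑-refl {_}))) surj
    where
    surj : IsSurjective (ι-into {S = S} s d Ss)
    surj (u , g) with unsquash g
    ... | _ , v , dv , Sv , x , refl with subsequence dv d (All.map S⊆ Sv)
    ... | f , eq = to (𝓜-map f) x , Σ-Squash-≡ (sym (ι-map dv f d eq x))

  -- After `sort` has removed repetitions, `E` of a finite set is a copy of some `𝓜 k`, and the
  -- inclusion becomes a map `𝓜-map f`.
  Fine-∅ : ∀ {S} → (∀ {x} → ¬ S x) → Fine S
  Fine-∅ {S} ¬S F G F⊆G with sort F | sort G
  ... | _ , s , ds , s∈F , F∈s | _ , v , dv , v∈G , G∈v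
    with subsequence ds dv (All.map (λ x∈ → ∈ᵛ-All G∈v (∈ᵛ-All F⊆G x∈)) s∈F)
  ... | f , eq = p , strong-resp {f = φ′ ∘ᵉ 𝓜-map f ∘ᵉ inverse φ φ-surj} {g = mono {S ∪ᵛ F} {S ∪ᵛ G} p} (λ (u , g) →
          Σ-Squash-≡ (trans (sym (ι-map ds f dv eq _)) (cong proj₁ (proj₂ (φ-surj (u , g))))))
          (strong-trans (strong-trans (strong-iso (inverse φ φ-surj) (strong-cod φ-strong) (inverse-surjective φ φ-surj))
            (𝓜-map-strong f)) φ′-strong)
    where
    p : S ∪ᵛ F ⊆′ S ∪ᵛ G
    p = ∪ᵛ-mono (λ _ z → z) F⊆G
    only : ∀ {k n} {H : Vec I k} {w : Vec I n} → All (_∈ᵛ w) H → ∀ {x} → (S ∪ᵛ H) x → x ∈ᵛ w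
    only H∈w (inj₁ Sx) = ⊥-elim (¬S Sx)
    only H∈w (inj₂ x∈) = ∈ᵛ-All H∈w x∈
    φ = ι-into {S = S ∪ᵛ F} s ds (All.map inj₂ s∈F)
    φ-strong = ι-into-strong {S = S ∪ᵛ F} s ds (All.map inj₂ s∈F) (only F∈s)
    φ′ = ι-into {S = S ∪ᵛ G} v dv (All.map inj₂ v∈G)
    φ′-strong = ι-into-strong {S = S ∪ᵛ G} v dv (All.map inj₂ v∈G) (only G∈v)
    φ-surj : IsSurjective φ
    φ-surj (u , g) with unsquash g
    ... | _ , w , dw , Sw , x , refl with subsequence dw ds (All.map (only F∈s) Sw)
    ... | h , eq = to (𝓜-map h) x , Σ-Squash-≡ (sym (ι-map dw h ds eq x))

  ∈ᵛ-++ˡ : ∀ {m n x} {F : Vec I m} (G : Vec I n) → x ∈ᵛ F → x ∈ᵛ (F ++ G)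
  ∈ᵛ-++ˡ G (here eq) = here eq
  ∈ᵛ-++ˡ G (there x∈) = there (∈ᵛ-++ˡ G x∈)

  ∈ᵛ-++ʳ : ∀ {m n x} (F : Vec I m) {G : Vec I n} → x ∈ᵛ G → x ∈ᵛ (F ++ G)
  ∈ᵛ-++ʳ [] x∈ = x∈
  ∈ᵛ-++ʳ (_ ∷ F) x∈ = there (∈ᵛ-++ʳ F x∈)

  ∈ᵛ-++⁻ : ∀ {m n x} (F : Vec I m) {G : Vec I n} → x ∈ᵛ (F ++ G) → x ∈ᵛ F ⊎ x ∈ᵛ G
  ∈ᵛ-++⁻ [] x∈ = inj₂ x∈
  ∈ᵛ-++⁻ (_ ∷ F) (here eq) = inj₁ (here eq)
  ∈ᵛ-++⁻ (_ ∷ F) (there x∈) with ∈ᵛ-++⁻ F x∈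
  ... | inj₁ x∈F = inj₁ (there x∈F)
  ... | inj₂ x∈G = inj₂ x∈G

  ∪ᵛ-assoc : ∀ {m n S} (F : Vec I m) {G : Vec I n} → S ∪ᵛ F ∪ᵛ G ⊆′ S ∪ᵛ (F ++ G)
  ∪ᵛ-assoc F _ (inj₁ (inj₁ x)) = inj₁ x
  ∪ᵛ-assoc F _ (inj₁ (inj₂ x)) = inj₂ (∈ᵛ-++ˡ _ x)
  ∪ᵛ-assoc F _ (inj₂ x) = inj₂ (∈ᵛ-++ʳ F x)

  ∪ᵛ-assoc⁻ : ∀ {m n S} (F : Vec I m) {G : Vec I n} → S ∪ᵛ (F ++ G) ⊆′ S ∪ᵛ F ∪ᵛ G
  ∪ᵛ-assoc⁻ F _ (inj₁ x) = inj₁ (inj₁ x)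
  ∪ᵛ-assoc⁻ F _ (inj₂ x) with ∈ᵛ-++⁻ F x
  ... | inj₁ y = inj₁ (inj₂ y)
  ... | inj₂ y = inj₂ y

  Fine-∪ᵛ : ∀ {k S} (H : Vec I k) → Fine S → Fine (S ∪ᵛ H)
  Fine-∪ᵛ {S = S} H fine F G h = ≺-resp {S ∪ᵛ (H ++ F)} {S ∪ᵛ (H ++ G)} {S ∪ᵛ H ∪ᵛ F} {S ∪ᵛ H ∪ᵛ G}
    (∪ᵛ-assoc⁻ H) (∪ᵛ-assoc H) (∪ᵛ-assoc⁻ H) (∪ᵛ-assoc H) (fine (H ++ F) (H ++ G) (prepend H))
    where
    prepend : ∀ {k} (H : Vec I k) → All (_∈ᵛ (H ++ G)) (H ++ F)
    prepend [] = h
    prepend (x ∷ H) = here refl ∷ All.map there (prepend H)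

  Fine-adjoin : ∀ {k n S} (H : Vec I k) → Fine S → (F : Vec I n) → S ∪ᵛ F ≺ S ∪ᵛ H ∪ᵛ F
  Fine-adjoin {S = S} H fine F = ≺-resp {S ∪ᵛ F} {S ∪ᵛ (H ++ F)} {S ∪ᵛ F} {S ∪ᵛ H ∪ᵛ F} (λ _ z → z) (λ _ z → z)
    (∪ᵛ-assoc⁻ H) (∪ᵛ-assoc H) (fine F (H ++ F) (All.map (∈ᵛ-++ʳ H) (∈ᵛ-self F)))

  -- `P` is either the property of being below a limit i or trivial, so one argument gives both
  -- continuity and the covering by the union.
  common-stage : (δ : WellOrder ℓ) (T : WellOrder.Carrier δ → Subset′) →
                 (∀ {i j} → WellOrder._<_ δ i j → T i ⊆′ T j) →
                 ∀ {p} (P : WellOrder.Carrier δ → Set p) {j₀} → P j₀ → ∀ {k} {F : Vec I k} {n} {s : Vec I n} →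
                 All (λ x → (∃[ j ] (P j × T j x)) ⊎ x ∈ᵛ F) s → ∃[ j ] (P j × All (T j ∪ᵛ F) s)
  common-stage δ T T-mono P p₀ [] = _ , p₀ , []
  common-stage δ T T-mono P p₀ {F = F} (inj₂ x∈ ∷ hs) with common-stage δ T T-mono P p₀ {F = F} hs
  ... | j , pj , hs′ = j , pj , inj₂ x∈ ∷ hs′
  common-stage δ T T-mono P p₀ {F = F} (inj₁ (i , pi , Tx) ∷ hs) with common-stage δ T T-mono P p₀ {F = F} hs
  ... | j , pj , hs′ with WellOrders.compare δ i j
  ... | tri< i<j _ _ = j , pj , inj₁ (T-mono i<j _ Tx) ∷ hs′
  ... | tri≈ _ refl _ = j , pj , inj₁ Tx ∷ hs′
  ... | tri> _ _ j<i = i , pi , inj₁ Tx ∷ All.map (∪ᵛ-left (T-mono j<i) _) hs′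

  module _ (δ : WellOrder ℓ) (lim : IsLimitOrder δ) (T : WellOrder.Carrier δ → Subset′) (T∞ : Subset′)
           (T-mono : ∀ {i j} → WellOrder._<_ δ i j → T i ⊆′ T j)
           (T-cont : ∀ {i} → IsLimitElement δ i → ∀ {x} → T i x → ∃[ j ] (WellOrder._<_ δ j i × T j x))
           (T-sub : ∀ {i} → T i ⊆′ T∞) (T-cover : ∀ {x} → T∞ x → ∃[ i ] T i x)
           (T-fine : ∀ i → Fine (T i))
           (T-strong : ∀ {i j} → WellOrder._<_ δ i j → ∀ {n} (F : Vec I n) → T i ∪ᵛ F ≺ T j ∪ᵛ F) where
    open WellOrder δ using () renaming (_<_ to _<ᴶ_)
    private
      chainᵛ : ∀ {n} (F : Vec I n) → Chain δ (E (T∞ ∪ᵛ F))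
      chainᵛ F = record
        { obj = λ i → E (T i ∪ᵛ F)
        ; incl = λ i → mono {T i ∪ᵛ F} {T∞ ∪ᵛ F} (∪ᵛ-left T-sub)
        ; step = λ {i} {j} i<j → mono {T i ∪ᵛ F} {T j ∪ᵛ F} (∪ᵛ-left (T-mono i<j))
        ; commute = λ _ _ → Σ-Squash-≡ refl }

      continuousᵛ : ∀ {n} (F : Vec I n) → Chain.IsContinuous (chainᵛ F)
      continuousᵛ F i lim (u , g) with unsquash g
      ... | n , s , d , Ss , x with common-stage δ T T-mono (_<ᴶ i) (proj₂ (proj₁ lim)) {F = F}
              (All.map (λ { (inj₁ Tx) → inj₁ (T-cont lim Tx) ; (inj₂ x∈) → inj₂ x∈ }) Ss)
      ... | j , j<i , Ss′ = j , j<i , (u , squash (n , s , d , Ss′ , x)) , Σ-Squash-≡ refl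

      hasUnion : ∀ {n} (F : Vec I n) → Chain.HasUnion (chainᵛ F)
      hasUnion F (u , g) with unsquash g
      ... | n , s , d , Ss , x with common-stage δ T T-mono (λ _ → ⊤) {proj₁ lim} tt {F = F}
              (All.map (λ { (inj₁ Tx) → let (i , Ti) = T-cover Tx in inj₁ (i , tt , Ti) ; (inj₂ x∈) → inj₂ x∈ }) Ss)
      ... | j , _ , Ss′ = j , (u , squash (n , s , d , Ss′ , x)) , Σ-Squash-≡ refl

      axiom = λ {n} (F : Vec I n) → chain-union δ lim (chainᵛ F)
        (λ {i} {j} i<j → ≺⇒strong {T i ∪ᵛ F} {T j ∪ᵛ F} (T-strong i<j F) (∪ᵛ-left (T-mono i<j))) (continuousᵛ F) (hasUnion F)

    limit-strong : ∀ i {n} (F : Vec I n) → T i ∪ᵛ F ≺ T∞ ∪ᵛ F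
    limit-strong i F = ∪ᵛ-left T-sub , proj₁ (axiom F) i

    -- Smoothness: each `T i ∪ᵛ F` is strong in `T i ∪ᵛ G` by fineness, hence in `T∞ ∪ᵛ G`, and so
    -- the union `T∞ ∪ᵛ F` is.
    limit-fine : Fine T∞
    limit-fine F G F⊆G = q , proj₂ (axiom F) (mono {T∞ ∪ᵛ F} {T∞ ∪ᵛ G} q) λ i →
      strong-resp (λ _ → Σ-Squash-≡ refl) (strong (≺-trans {T i ∪ᵛ F} {T i ∪ᵛ G} {T∞ ∪ᵛ G} (T-fine i F G F⊆G) (limit-strong i G)))
      where
      q : T∞ ∪ᵛ F ⊆′ T∞ ∪ᵛ G
      q = ∪ᵛ-mono (λ _ z → z) F⊆G

  -- Ehrenfeucht-Mostowski models are functorial in the order: the element given by x over s goes to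
  -- the one given by the same x over `map σ s`, as `𝓜 n` depends on the length only.
  module Relabelling {S T : Subset′} (σ : I → I) (σ-mono : ∀ {x y} → S x → S y → x < y → σ x < σ y)
                     (σ-into : ∀ {x} → S x → T (σ x)) where
    Desc-σ : ∀ {n} {s : Vec I n} → All S s → Desc s → Desc (map σ s)
    Desc-σ [] [] = []
    Desc-σ {s = x ∷ s} (Sx ∷ Ss) (s<x ∷ d) = below Ss s<x ∷ Desc-σ Ss d
      where
      below : ∀ {n} {v : Vec I n} → All S v → All (_< x) v → All (_< σ x) (map σ v)
      below [] [] = []
      below (Sy ∷ Sv) (y<x ∷ v<x) = σ-mono Sy Sx y<x ∷ below Sv v<x

    private
      value : ∀ {n} (s : Vec I n) → Desc s → All S s → ⟦ 𝓜 n ⟧ → Elem T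
      value s d Ss x = to (ι (map σ s) (Desc-σ Ss d)) x ,
        squash (_ , map σ s , Desc-σ Ss d , All-map σ σ-into Ss , x , refl)

      value-map : ∀ {m n} {s : Vec I m} {d} {Ss} (f : m ⊑ n) {w : Vec I n} dw Sw → select f w ≡ s →
                  ∀ x → value s d Ss x ≡ value w dw Sw (to (𝓜-map f) x)
      value-map f dw Sw refl x = Σ-Squash-≡ (ι-map _ f (Desc-σ Sw dw) (select-map σ f _) x)

      value-unique : ∀ {m n} {s : Vec I m} {d Ss x} {v : Vec I n} {dv Sv y} →
                     to (ι s d) x ≡ to (ι v dv) y → value s d Ss x ≡ value v dv Sv y
      value-unique {s = s} {d} {Ss} {x} {v} {dv} {Sv} {y} eq with joins d dv
      ... | join w dw f g fe ge joint =
            trans (value-map {d = d} {Ss} f dw (joint Ss Sv) fe x)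
            (trans (cong (value w dw (joint Ss Sv)) (injective (ι w dw)
                     (trans (sym (ι-map d f dw fe x)) (trans eq (ι-map dv g dw ge y)))))
                   (sym (value-map {d = dv} {Sv} g dw (joint Ss Sv) ge y)))

      γ : Elem S → Elem T
      γ (u , g) = let (_ , s , d , Ss , x , _) = unsquash g in value s d Ss x

    γ-value : ∀ {n} {s : Vec I n} {d} Ss {x u} → to (ι s d) x ≡ proj₁ u → γ u ≡ value s d Ss x
    γ-value Ss {u = u , g} eq = let (_ , _ , _ , Sv , _ , eq′) = unsquash g
      in value-unique {Ss = Sv} {Sv = Ss} (trans eq′ (sym eq))

    private
      map-γ : ∀ {k n} {s : Vec I n} {d} Ss (xs : Vec (Elem S) k) ys → map (to (ι s d)) ys ≡ map proj₁ xs →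
              map proj₁ (map γ xs) ≡ map (to (ι (map σ s) (Desc-σ Ss d))) ys
      map-γ Ss [] [] eq = refl
      map-γ {d = d} Ss (x ∷ xs) (y ∷ ys) eq = cong₂ _∷_ (cong proj₁ (γ-value {d = d} Ss (cong head eq))) (map-γ Ss xs ys (cong tail eq))

    relabel : E S ↪ E T
    relabel = record
      { to = γ
      ; injective = λ {(u , g)} {(v , h)} eq → Σ-Squash-≡ (inj (unsquash g) (unsquash h) eq)
      ; fun-hom = λ F xs → let (n , s , d , Ss , ys , eq) = lift-vec xs in Σ-Squash-≡
          (trans (cong proj₁ (γ-value {d = d} Ss (trans (fun-hom (ι s d) F ys) (cong (fun U F) eq))))
          (trans (fun-hom (ι (map σ s) (Desc-σ Ss d)) F ys) (cong (fun U F) (sym (map-γ Ss xs ys eq)))))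
      ; rel-iff = λ R xs → let (n , s , d , Ss , ys , eq) = lift-vec xs in mk⇔
          (λ r → subst (rel U R) (sym (map-γ Ss xs ys eq)) (Equivalence.to (rel-iff (ι (map σ s) (Desc-σ Ss d)) R ys)
                   (Equivalence.from (rel-iff (ι s d) R ys) (subst (rel U R) (sym eq) r))))
          (λ r → subst (rel U R) eq (Equivalence.to (rel-iff (ι s d) R ys)
                   (Equivalence.from (rel-iff (ι (map σ s) (Desc-σ Ss d)) R ys) (subst (rel U R) (map-γ Ss xs ys eq) r))))
      }
      where
      inj : ∀ {u v} (g : Gen S u) (h : Gen S v) →
            value (proj₁ (proj₂ g)) (proj₁ (proj₂ (proj₂ g))) (proj₁ (proj₂ (proj₂ (proj₂ g)))) (proj₁ (proj₂ (proj₂ (proj₂ (proj₂ g))))) ≡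
            value (proj₁ (proj₂ h)) (proj₁ (proj₂ (proj₂ h))) (proj₁ (proj₂ (proj₂ (proj₂ h)))) (proj₁ (proj₂ (proj₂ (proj₂ (proj₂ h))))) → u ≡ v
      inj (_ , s , d , Ss , x , refl) (_ , v , dv , Sv , y , refl) eq with joins d dv
      ... | join w dw f g fe ge joint =
            trans (ι-map d f dw fe x) (trans (cong (to (ι w dw)) (injective (ι (map σ w) (Desc-σ (joint Ss Sv) dw))
              (cong proj₁ (trans (sym (value-map {d = d} {Ss} f dw (joint Ss Sv) fe x))
                (trans eq (value-map {d = dv} {Sv} g dw (joint Ss Sv) ge y)))))) (sym (ι-map dv g dw ge y)))

    relabel-ι : ∀ {n} {s : Vec I n} {d} (Ss : All S s) x {u} → to (ι s d) x ≡ proj₁ u →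
                Σ[ d′ ∈ Desc (map σ s) ] proj₁ (to relabel u) ≡ to (ι (map σ s) d′) x
    relabel-ι {d = d} Ss x eq = Desc-σ Ss d , cong proj₁ (γ-value {d = d} Ss eq)

    relabel-surjective : (∀ {y} → T y → ∃[ x ] (S x × σ x ≡ y)) →
                         (∀ {x y} → S x → S y → σ x < σ y → x < y) → IsSurjective relabel
    relabel-surjective pre reflects (u , g) with unsquash g
    ... | n , v , dv , Tv , x , refl = preimage (preimages Tv)
      where
      preimages : ∀ {n} {v : Vec I n} → All T v → ∃[ s ] (All S s × map σ s ≡ v)
      preimages [] = [] , [] , refl
      preimages (Ty ∷ Tv) with pre Ty | preimages Tv
      ... | x , Sx , refl | s , Ss , refl = x ∷ s , Sx ∷ Ss , refl

      reflect : ∀ {n} {s : Vec I n} → All S s → Desc (map σ s) → Desc s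
      reflect [] [] = []
      reflect {s = x ∷ s} (Sx ∷ Ss) (s<x ∷ d) = below Ss s<x ∷ reflect Ss d
        where
        below : ∀ {n} {v : Vec I n} → All S v → All (_< σ x) (map σ v) → All (_< x) v
        below [] [] = []
        below (Sy ∷ Sv) (y<x ∷ v<x) = reflects Sy Sx y<x ∷ below Sv v<x

      preimage : ∃[ s ] (All S s × map σ s ≡ v) → ∃[ a ] γ a ≡ (u , g)
      preimage (s , Ss , refl) =
        let d = reflect Ss dv
        in (to (ι s d) x , squash (n , s , d , Ss , x , refl)) ,
           Σ-Squash-≡ (trans (cong proj₁ (γ-value {d = d} Ss refl))
             (trans (ι-map _ ⊑-refl dv (select-refl (map σ s)) x)
                    (sym (ι-map dv ⊑-refl dv (select-refl (map σ s)) x))))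

  -- A continuous filtration by finite increments turns an infinite index set into a well-ordered
  -- chain: successors are handled by `Fine-∪ᵛ` and `Fine-adjoin`, limits by the chain axiom.
  module Filtration (μ : WellOrder ℓ) (L : WellOrder.Carrier μ → Subset′)
           (L-mono : ∀ {i j} → WellOrder._<_ μ i j → L i ⊆′ L j)
           (L-zero : ∀ {i} → (∀ j → ¬ (WellOrder._<_ μ j i)) → ∀ {x} → ¬ L i x)
           (L-suc : ∀ {i j} → IsSuccessorOf μ i j → ∃[ n ] Σ[ H ∈ Vec I n ] (L i ⊆′ L j ∪ᵛ H × L j ∪ᵛ H ⊆′ L i))
           (L-lim : ∀ {i} → IsLimitElement μ i → ∀ {x} → L i x → ∃[ j ] (WellOrder._<_ μ j i × L j x)) where
    open WellOrder μ using () renaming (Carrier to J; _<_ to _<ᴶ_)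
    private
      module O = WellOrders μ

      Claim : J → Set (lsuc ℓ)
      Claim i = Fine (L i) × (∀ {j} → j <ᴶ i → ∀ {n} (F : Vec I n) → L j ∪ᵛ F ≺ L i ∪ᵛ F)

      segment : J → WellOrder ℓ
      segment i = record
        { Carrier = Σ[ j ∈ J ] Squash (j <ᴶ i)
        ; _<_ = λ a b → proj₁ a <ᴶ proj₁ b
        ; isStrictTotalOrder = record
          { isStrictPartialOrder = record
            { isEquivalence = ≡-isEquivalence
            ; irrefl = λ { refl → O.<-irrefl }
            ; trans = O.<-trans
            ; <-resp-≈ = (λ { refl l → l }) , (λ { refl l → l }) }
          ; compare = λ a b → cmp a b (O.compare (proj₁ a) (proj₁ b)) }
        ; wellFounded = λ a → wf a (WellOrder.wellFounded μ (proj₁ a)) }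
        where
        cmp : (a b : Σ[ j ∈ J ] Squash (j <ᴶ i)) → Tri (proj₁ a <ᴶ proj₁ b) (proj₁ a ≡ proj₁ b) (proj₁ b <ᴶ proj₁ a) →
              Tri (proj₁ a <ᴶ proj₁ b) (a ≡ b) (proj₁ b <ᴶ proj₁ a)
        cmp a b (tri< l n g) = tri< l (λ e → n (cong proj₁ e)) g
        cmp a b (tri≈ l e g) = tri≈ l (Σ-Squash-≡ e) g
        cmp a b (tri> l n g) = tri> l (λ e → n (cong proj₁ e)) g
        wf : ∀ a → Acc _<ᴶ_ (proj₁ a) → Acc (λ a b → proj₁ a <ᴶ proj₁ b) a
        wf a (acc rs) = acc λ {b} b<a → wf b (rs b<a)

      zero-case : ∀ i → (∀ j → ¬ (j <ᴶ i)) → Claim i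
      zero-case i none = Fine-∅ (L-zero none) , λ {j} j<i → ⊥-elim (none j j<i)

      suc-case : ∀ i j → IsSuccessorOf μ i j → (∀ k → k <ᴶ i → Claim k) → Claim i
      suc-case i j i-suc@(j<i , gap) ih with L-suc i-suc | ih j j<i
      ... | _ , H , p , q | fineⱼ , belowⱼ = Fine-resp {L j ∪ᵛ H} {L i} q p (Fine-∪ᵛ H fineⱼ) ,
            λ {k} k<i F → ≺-trans {L k ∪ᵛ F} {L j ∪ᵛ F} {L i ∪ᵛ F} (to-j k k<i F)
              (≺-resp {L j ∪ᵛ F} {L j ∪ᵛ H ∪ᵛ F} {L j ∪ᵛ F} {L i ∪ᵛ F} (λ _ z → z) (λ _ z → z) (∪ᵛ-left q) (∪ᵛ-left p) (Fine-adjoin H fineⱼ F))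
        where
        to-j : ∀ k → k <ᴶ i → ∀ {n} (F : Vec I n) → L k ∪ᵛ F ≺ L j ∪ᵛ F
        to-j k k<i F with O.compare k j
        ... | tri< k<j _ _ = belowⱼ k<j F
        ... | tri≈ _ refl _ = fineⱼ F F (∈ᵛ-self F)
        ... | tri> _ _ j<k = ⊥-elim (gap k j<k k<i)

      lim-case : ∀ i → IsLimitElement μ i → (∀ k → k <ᴶ i → Claim k) → Claim i
      lim-case i lim@((j₀ , j₀<i) , dense) ih =
        limit-fine δ δ-lim T (L i) (λ {a} {b} → T-mono {a} {b}) (λ {a} → T-cont {a})
          (λ {a} → T-sub {a}) T-cover T-fine (λ {a} {b} → T-strong {a} {b}) ,
        λ {j} j<i F → limit-strong δ δ-lim T (L i) (λ {a} {b} → T-mono {a} {b}) (λ {a} → T-cont {a})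
          (λ {a} → T-sub {a}) T-cover T-fine (λ {a} {b} → T-strong {a} {b}) (j , squash j<i) F
        where
        δ = segment i
        T : WellOrder.Carrier δ → Subset′
        T (j , _) = L j
        δ-lim : IsLimitOrder δ
        δ-lim = (j₀ , squash j₀<i) , λ (j , p) → let (k , j<k , k<i) = dense j (unsquash p) in (k , squash k<i) , j<k
        T-mono : ∀ {a b} → WellOrder._<_ δ a b → T a ⊆′ T b
        T-mono {a} {b} = L-mono {proj₁ a} {proj₁ b}
        T-cont : ∀ {a} → IsLimitElement δ a → ∀ {x} → T a x → ∃[ b ] (WellOrder._<_ δ b a × T b x)
        T-cont {j , p} (((k , _) , k<j) , dense′) Tx =
          let (m , m<j , Lm) = L-lim {j} ((k , k<j) , λ l l<j →
                let ((m , _) , l<m , m<j) = dense′ (l , squash (O.<-trans l<j (unsquash p))) l<j in m , l<m , m<j) Tx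
          in (m , squash (O.<-trans m<j (unsquash p))) , m<j , Lm
        T-sub : ∀ {a} → T a ⊆′ L i
        T-sub {j , p} = L-mono {j} {i} (unsquash p)
        T-cover : ∀ {x} → L i x → ∃[ a ] T a x
        T-cover Lx = let (j , j<i , Lj) = L-lim lim Lx in (j , squash j<i) , Lj
        T-fine : ∀ a → Fine (T a)
        T-fine (j , p) = proj₁ (ih j (unsquash p))
        T-strong : ∀ {a b} → WellOrder._<_ δ a b → ∀ {n} (F : Vec I n) → T a ∪ᵛ F ≺ T b ∪ᵛ F
        T-strong {a} {k , p} a<b F = proj₂ (ih k (unsquash p)) a<b F

      claim : ∀ i → Claim i
      claim = O.<-ind Claim step
        where
        step : ∀ i → (∀ k → k <ᴶ i → Claim k) → Claim i
        step i ih with lem {P = ∃[ j ] j <ᴶ i} | lem {P = ∃[ j ] IsSuccessorOf μ i j}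
        ... | no ¬e | _ = zero-case i (λ j j<i → ¬e (j , j<i))
        ... | yes _ | yes (j , i-suc) = suc-case i j i-suc ih
        ... | yes e | no ¬suc = lim-case i (e , λ j j<i → dne λ ¬k → ¬suc (j , j<i , λ k j<k k<i → ¬k (k , j<k , k<i))) ih

    stage-fine : ∀ i → Fine (L i)
    stage-fine i = proj₁ (claim i)

    stage-strong : ∀ {j i} → j <ᴶ i → ∀ {n} (F : Vec I n) → L j ∪ᵛ F ≺ L i ∪ᵛ F
    stage-strong = proj₂ (claim _)

    module _ (lim : IsLimitOrder μ) (L∞ : Subset′) (L-sub : ∀ {i} → L i ⊆′ L∞) (L-cover : ∀ {x} → L∞ x → ∃[ i ] L i x) where
      union-fine : Fine L∞
      union-fine = limit-fine μ lim L L∞ L-mono L-lim L-sub L-cover stage-fine stage-strong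

      union-strong : ∀ i {n} (F : Vec I n) → L i ∪ᵛ F ≺ L∞ ∪ᵛ F
      union-strong = limit-strong μ lim L L∞ L-mono L-lim L-sub L-cover stage-fine stage-strong

-- The index order μ + 1 + μ*

module TwoSided {ℓ} (μ : WellOrder ℓ) where
  open WellOrder μ using (_<_) renaming (Carrier to J)
  private module O = IsStrictTotalOrder (WellOrder.isStrictTotalOrder μ)

  data Point : Set ℓ where
    lo  : J → Point
    mid : Point
    hi  : J → Point

  infix 4 _≺ᵖ_

  data _≺ᵖ_ : Point → Point → Set ℓ where
    lo<lo  : ∀ {i j} → i < j → lo i ≺ᵖ lo j
    lo<mid : ∀ {i} → lo i ≺ᵖ mid
    lo<hi  : ∀ {i j} → lo i ≺ᵖ hi j
    mid<hi : ∀ {j} → mid ≺ᵖ hi j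
    hi<hi  : ∀ {i j} → j < i → hi i ≺ᵖ hi j

  private
    ≺ᵖ-trans : ∀ {x y z} → x ≺ᵖ y → y ≺ᵖ z → x ≺ᵖ z
    ≺ᵖ-trans (lo<lo p) (lo<lo q) = lo<lo (O.trans p q)
    ≺ᵖ-trans (lo<lo _) lo<mid = lo<mid
    ≺ᵖ-trans (lo<lo _) lo<hi = lo<hi
    ≺ᵖ-trans lo<mid mid<hi = lo<hi
    ≺ᵖ-trans lo<hi (hi<hi _) = lo<hi
    ≺ᵖ-trans mid<hi (hi<hi _) = mid<hi
    ≺ᵖ-trans (hi<hi p) (hi<hi q) = hi<hi (O.trans q p)

    ≺ᵖ-irrefl : ∀ {x} → ¬ (x ≺ᵖ x)
    ≺ᵖ-irrefl (lo<lo p) = O.irrefl refl p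
    ≺ᵖ-irrefl (hi<hi p) = O.irrefl refl p

    less : ∀ {x y} → x ≺ᵖ y → Tri (x ≺ᵖ y) (x ≡ y) (y ≺ᵖ x)
    less l = tri< l (λ { refl → ≺ᵖ-irrefl l }) (λ g → ≺ᵖ-irrefl (≺ᵖ-trans l g))

    greater : ∀ {x y} → y ≺ᵖ x → Tri (x ≺ᵖ y) (x ≡ y) (y ≺ᵖ x)
    greater g = tri> (λ l → ≺ᵖ-irrefl (≺ᵖ-trans l g)) (λ { refl → ≺ᵖ-irrefl g }) g

    compare : ∀ x y → Tri (x ≺ᵖ y) (x ≡ y) (y ≺ᵖ x)
    compare (lo i) (lo j) with O.compare i j
    ... | tri< l _ _ = less (lo<lo l)
    ... | tri≈ _ refl _ = tri≈ ≺ᵖ-irrefl refl ≺ᵖ-irrefl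
    ... | tri> _ _ g = greater (lo<lo g)
    compare (lo i) mid = less lo<mid
    compare (lo i) (hi j) = less lo<hi
    compare mid (lo i) = greater lo<mid
    compare mid mid = tri≈ ≺ᵖ-irrefl refl ≺ᵖ-irrefl
    compare mid (hi j) = less mid<hi
    compare (hi i) (lo j) = greater lo<hi
    compare (hi i) mid = greater mid<hi
    compare (hi i) (hi j) with O.compare i j
    ... | tri< l _ _ = greater (hi<hi l)
    ... | tri≈ _ refl _ = tri≈ ≺ᵖ-irrefl refl ≺ᵖ-irrefl
    ... | tri> _ _ g = less (hi<hi g)

  strictTotalOrder : IsStrictTotalOrder _≡_ _≺ᵖ_
  strictTotalOrder = record
    { isStrictPartialOrder = record
      { isEquivalence = ≡-isEquivalence
      ; irrefl = λ { refl → ≺ᵖ-irrefl }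
      ; trans = ≺ᵖ-trans
      ; <-resp-≈ = (λ { refl l → l }) , (λ { refl l → l }) }
    ; compare = compare }

module _ {ℓ} (𝒦 : AEC ℓ) (𝕄 : Monster 𝒦) where
  open Monster 𝕄
  open InMonster 𝕄
  open TwoSided

  -- Copies d x of the members of the sequence c, indexed by x in μ + 1 + μ*, together
  -- with the models Q i generated over M by the points at distance < i from both ends.
  record TwoSidedChain (M : Model) {X : Set ℓ} (c : Stage → X → ⟦ ℭ ⟧) (μ : WellOrder ℓ) : Set (lsuc ℓ) where
    open WellOrder μ using () renaming (Carrier to J; _<_ to _<ᴶ_)
    field
      Q        : J → Model
      Q∞       : Model
      Q-mono   : ∀ i j → i <ᴶ j → Q i ≼ Q j
      Q-cont   : ∀ i → IsLimitElement μ i → ∀ x → x ∈ ∣ Q i ∣ → ∃[ j ] (j <ᴶ i × x ∈ ∣ Q j ∣)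
      Q-sub    : ∀ i → Q i ≼ Q∞
      Q-cover  : ∀ x → x ∈ ∣ Q∞ ∣ → ∃[ i ] x ∈ ∣ Q i ∣
      base≼Q   : ∀ i → M ≼ Q i
      d        : Point μ → X → ⟦ ℭ ⟧
      Left Right   : J → Model
      Left≼Q∞      : ∀ i → Left i ≼ Q∞
      Right≼Q∞     : ∀ i → Right i ≼ Q∞
      Q≼Left       : ∀ i → Q i ≼ Left i
      Q≼Right      : ∀ i → Q i ≼ Right i
      lo∈Left      : ∀ i ξ → d (lo i) ξ ∈ ∣ Left i ∣
      swap         : J → Automorphism
      swap-fixes   : ∀ i x → x ∈ ∣ Q i ∣ → swap i ⟨ x ⟩ ≡ x
      swap-Left    : ∀ i → swap i [ ∣ Left i ∣ ] ≐ ∣ Right i ∣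
      swap-point   : ∀ i ξ → swap i ⟨ d (lo i) ξ ⟩ ≡ d (hi i) ξ
      realize      : ∀ {x y} → _≺ᵖ_ μ x y → ∃[ i ] ∃[ j ] (i < j × (∃[ h ] ((∀ z → z ∈ ∣ M ∣ → h ⟨ z ⟩ ≡ z) ×
                       (∀ ξ → h ⟨ c i ξ ⟩ ≡ d x ξ) × (∀ ξ → h ⟨ c j ξ ⟩ ≡ d y ξ))))

-- Construction of the two-sided chain

module TwoSidedModel (lem : ∀ {a} → ExcludedMiddle a) (fe : ∀ {a b} → Extensionality a b)
             {ℓ} (𝒦 : AEC ℓ) (𝕄 : Monster 𝒦) (amalg : AEC.Amalgamation 𝒦)
             (M : InMonster.Model 𝕄) {X : Set ℓ} (c : Monster.Stage 𝕄 → X → ⟦ Monster.ℭ 𝕄 ⟧)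
             (μ : WellOrder ℓ) (μ-lim : IsLimitOrder μ) where
  open MonsterModel lem fe 𝒦 𝕄
  open Model using (str)
  open Descending _<_ using (Desc; []; _∷_)
  open TwoSided μ
  open Descending _≺ᵖ_ using () renaming (Desc to Descᵖ; [] to []ᵖ; _∷_ to _∷ᵖ_)
  open Homogeneity lem fe 𝒦 𝕄 amalg using (homogeneous)
  open Extension amalg using (extension)
  open WellOrder μ using () renaming (Carrier to J; _<_ to _<ᴶ_)
  open _↪_ using (injective)

  module Construction
             (s : ∀ n → Vec Stage n) (s-desc : ∀ n → Desc (s n)) (H : ℕ → Model)
             (𝓜-map : ∀ {m n} → m ⊑ n → str (H m) ↪ str (H n))
             (𝓜-map-strong : ∀ {m n} (f : m ⊑ n) → IsStrong (𝓜-map f))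
             (base : str M ↪ str (H 0)) (base-strong : IsStrong base) (pt : X → ⟦ str (H 1) ⟧)
             (base-map : ∀ {n} (f : 0 ⊑ n) m → elem (H n) (to (𝓜-map f) (to base m)) ≡ elem M m)
             (pt-map : ∀ {n} (f : 1 ⊑ n) {x} → select f (s n) ≡ x ∷ [] →
                       ∀ ξ → elem (H n) (to (𝓜-map f) (pt ξ)) ≡ c x ξ)
             (U : Structure τ ℓ) (ι : ∀ {n} (v : Vec Point n) → Descᵖ v → str (H n) ↪ U)
             (ι-map : ∀ {m n} {v : Vec Point m} (dv : Descᵖ v) (f : m ⊑ n) {w : Vec Point n} (dw : Descᵖ w) →
                      select f w ≡ v → ∀ x → to (ι v dv) x ≡ to (ι w dw) (to (𝓜-map f) x))
             (ι-cover : ∀ u → ∃[ n ] Σ[ v ∈ Vec Point n ] Σ[ dv ∈ Descᵖ v ] ∃[ x ] to (ι v dv) x ≡ u) where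
    private
      𝓜 : ℕ → Structure τ ℓ
      𝓜 n = str (H n)

      module O = WellOrders μ
      open Generation lem 𝒦 𝓜 𝓜-map 𝓜-map-strong strictTotalOrder U ι ι-map
      open LinearOrders strictTotalOrder using (_∈ᵛ_; ∈ᵛ-self)

      L : J → Subset′
      L k (lo j) = j <ᴶ k
      L k mid = Lift ℓ ⊥
      L k (hi j) = j <ᴶ k

      -- `mid` is left out: the copy at `mid` is the one whose freeness from this union is tested.
      L∞ : Subset′
      L∞ (lo _) = Lift ℓ ⊤
      L∞ mid = Lift ℓ ⊥
      L∞ (hi _) = Lift ℓ ⊤

      L-mono : ∀ {i j} → i <ᴶ j → L i ⊆′ L j
      L-mono i<j (lo k) k<i = O.<-trans k<i i<j
      L-mono i<j (hi k) k<i = O.<-trans k<i i<j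

      L-zero : ∀ {i} → (∀ j → ¬ (j <ᴶ i)) → ∀ {x} → ¬ L i x
      L-zero none {lo j} j<i = none j j<i
      L-zero none {hi j} j<i = none j j<i

      L-suc : ∀ {i j} → IsSuccessorOf μ i j → ∃[ n ] Σ[ F ∈ Vec Point n ] (L i ⊆′ L j ∪ᵛ F × L j ∪ᵛ F ⊆′ L i)
      L-suc {i} {j} (j<i , gap) = 2 , lo j ∷ hi j ∷ [] , split-off , put-back
        where
        split-off : L i ⊆′ L j ∪ᵛ (lo j ∷ hi j ∷ [])
        split-off (lo k) k<i with O.compare k j
        ... | tri< k<j _ _ = inj₁ k<j
        ... | tri≈ _ refl _ = inj₂ (here refl)
        ... | tri> _ _ j<k = ⊥-elim (gap k j<k k<i)
        split-off (hi k) k<i with O.compare k j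
        ... | tri< k<j _ _ = inj₁ k<j
        ... | tri≈ _ refl _ = inj₂ (there (here refl))
        ... | tri> _ _ j<k = ⊥-elim (gap k j<k k<i)
        put-back : L j ∪ᵛ (lo j ∷ hi j ∷ []) ⊆′ L i
        put-back x (inj₁ Lx) = L-mono j<i x Lx
        put-back _ (inj₂ (here refl)) = j<i
        put-back _ (inj₂ (there (here refl))) = j<i

      L-lim : ∀ {i} → IsLimitElement μ i → ∀ {x} → L i x → ∃[ j ] (j <ᴶ i × L j x)
      L-lim (_ , dense) {lo k} k<i = let (j , k<j , j<i) = dense k k<i in j , j<i , k<j
      L-lim (_ , dense) {hi k} k<i = let (j , k<j , j<i) = dense k k<i in j , j<i , k<j

      L-sub : ∀ {i} → L i ⊆′ L∞
      L-sub (lo _) _ = lift tt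
      L-sub (hi _) _ = lift tt

      L-cover : ∀ {x} → L∞ x → ∃[ i ] L i x
      L-cover {lo j} _ = proj₂ μ-lim j
      L-cover {hi j} _ = proj₂ μ-lim j

      module F = Filtration μ L L-mono L-zero L-suc (λ {i} lim {x} → L-lim lim {x})

      L∞-fine : Fine L∞
      L∞-fine = F.union-fine μ-lim L∞ L-sub (λ {x} → L-cover {x})

      L∞-strong : ∀ i {n} (G : Vec Point n) → L i ∪ᵛ G ≺ L∞ ∪ᵛ G
      L∞-strong = F.union-strong μ-lim L∞ L-sub (λ {x} → L-cover {x})

      Top : Subset′
      Top = L∞ ∪ᵛ (mid ∷ [])

      top : ∀ x → Top x
      top (lo _) = inj₁ (lift tt)
      top mid = inj₂ (here refl)
      top (hi _) = inj₁ (lift tt)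

      ≺-top : ∀ i {n} (G : Vec Point n) → L i ∪ᵛ G ≺ Top
      ≺-top i G = ≺-trans {L i ∪ᵛ G} {L∞ ∪ᵛ G} {Top} (L∞-strong i G)
        (≺-resp {L∞ ∪ᵛ G} {L∞ ∪ᵛ (mid ∷ G)} {L∞ ∪ᵛ G} {Top} (λ _ z → z) (λ _ z → z) (λ x _ → top x) back
          (L∞-fine G (mid ∷ G) (All.map there (∈ᵛ-self G))))
        where
        back : Top ⊆′ L∞ ∪ᵛ (mid ∷ G)
        back x (inj₁ z) = inj₁ z
        back x (inj₂ (here refl)) = inj₂ (here refl)

      -- At the least index `L o` is empty, so `L o ∪ᵛ v` is the finite set of entries of v, and
      -- finite subsets fall under `≺-top`.
      o : J
      o = proj₁ (O.least (λ _ → ⊤) (proj₁ μ-lim , tt))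

      L-o : ∀ {x} → ¬ L o x
      L-o {x} = L-zero (λ j j<o → proj₂ (proj₂ (O.least (λ _ → ⊤) (proj₁ μ-lim , tt))) j tt j<o) {x}

      finite : ∀ {n} (v : Vec Point n) (dv : Descᵖ v) → 𝓜 n ↪ E (L o ∪ᵛ v)
      finite v dv = ι-into {S = L o ∪ᵛ v} v dv (All.map inj₂ (∈ᵛ-self v))

      abstract
        finite-strong : ∀ {n} (v : Vec Point n) (dv : Descᵖ v) → IsStrong (finite v dv)
        finite-strong v dv = ι-into-strong {S = L o ∪ᵛ v} v dv (All.map inj₂ (∈ᵛ-self v))
            (λ { {x} (inj₁ z) → ⊥-elim (L-o {x} z) ; (inj₂ x∈) → x∈ })

      into-top : ∀ {n} (v : Vec Point n) (dv : Descᵖ v) → 𝓜 n ↪ E Top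
      into-top v dv = mono {L o ∪ᵛ v} {Top} (λ x _ → top x) ∘ᵉ finite v dv

      abstract
        into-top-strong : ∀ {n} (v : Vec Point n) (dv : Descᵖ v) → IsStrong (into-top v dv)
        into-top-strong v dv = strong-trans (finite-strong v dv)
          (≺⇒strong {L o ∪ᵛ v} {Top} (≺-top o v) (λ x _ → top x))

      abstract
        -- The colimit enters the monster over `M`, so that automorphisms fixing `M` can relate its
        -- points to the original sequence.
        embedding : ∃[ t ] Σ[ e ∈ E Top ↪ obj t ] IsStrong e ×
                    (∀ m → to (incl t) (to e (to (into-top [] []ᵖ) (to base m))) ≡ elem M m)
        embedding = extension M (into-top [] []ᵖ ∘ᵉ base) (strong-trans base-strong (into-top-strong [] []ᵖ))

        stg : Stage
        stg = proj₁ embedding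

        e : E Top ↪ obj stg
        e = proj₁ (proj₂ embedding)

        e-strong : IsStrong e
        e-strong = proj₁ (proj₂ (proj₂ embedding))

        in-top : ∀ u → Squash (Gen Top u)
        in-top u = let (n , v , dv , x , eq) = ι-cover u in squash (n , v , dv , All-universal top v , x , eq)

        θ : ⟦ U ⟧ → ⟦ ℭ ⟧
        θ u = to (incl stg) (to e (u , in-top u))

        θ-e : ∀ w → to (incl stg) (to e w) ≡ θ (proj₁ w)
        θ-e w = cong (to (incl stg) ∘ to e) (Σ-Squash-≡ refl)

        θ-base : ∀ m → θ (to (ι [] []ᵖ) (to base m)) ≡ elem M m
        θ-base m = trans (sym (θ-e _)) (proj₂ (proj₂ (proj₂ embedding)) m)

      model : ∀ S → S ≺ Top → Model
      model S st = record { stage = stg ; emb = e ∘ᵉ mono {S} {Top} (_≺_.sub st) ; strong = strong-trans (_≺_.strong st) e-strong }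

      elem-θ : ∀ S st w → elem (model S st) w ≡ θ (proj₁ w)
      elem-θ S st w = θ-e _

      model-mono : ∀ {S T} (p : S ≺ Top) (q : T ≺ Top) → S ⊆′ T → model S p ≼ model T q
      model-mono {S} {T} p q S⊆T _ (w , refl) = to (mono {S} {T} S⊆T) w , trans (elem-θ T q _) (sym (elem-θ S p w))

      ∅∪≺ : ∀ i → L i ∪ᵛ [] ≺ Top
      ∅∪≺ i = ≺-top i []

    Q : J → Model
    Q i = model (L i ∪ᵛ []) (∅∪≺ i)

    Q∞ : Model
    Q∞ = model (L∞ ∪ᵛ []) (L∞-fine [] (mid ∷ []) [])

    private
      Left Right : J → Model
      Left i = model (L i ∪ᵛ (lo i ∷ [])) (≺-top i (lo i ∷ []))
      Right i = model (L i ∪ᵛ (hi i ∷ [])) (≺-top i (hi i ∷ []))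

    d : Point → X → ⟦ ℭ ⟧
    d x ξ = θ (to (ι (x ∷ []) ([] ∷ᵖ []ᵖ)) (pt ξ))

    Q-mono : ∀ i j → i <ᴶ j → Q i ≼ Q j
    Q-mono i j i<j = model-mono (∅∪≺ i) (∅∪≺ j) (∪ᵛ-left (L-mono i<j))

    private
      ∈-generated : ∀ {S} {st : S ≺ Top} {u} → Gen S u → θ u ∈ ∣ model S st ∣
      ∈-generated {S} {st} {u} g = (u , squash g) , elem-θ S st _

      ∈-generated⁻ : ∀ {S} {st : S ≺ Top} {x} → x ∈ ∣ model S st ∣ → ∃[ u ] (Gen S u × θ u ≡ x)
      ∈-generated⁻ {S} {st} ((u , g) , refl) = u , unsquash g , sym (elem-θ S st (u , g))

      Q-common : ∀ {S : Subset′} {u} {p} (P : J → Set p) {j₀} → P j₀ → (∀ {x} → S x → ∃[ j ] (P j × L j x)) →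
                 Gen (S ∪ᵛ []) u → ∃[ j ] (P j × Gen (L j ∪ᵛ []) u)
      Q-common P p₀ find (n , v , dv , Sv , z) with common-stage μ L L-mono P p₀ {F = []}
                 (All.map (λ { (inj₁ Sx) → inj₁ (find Sx) ; (inj₂ ()) }) Sv)
      ... | j , pj , Lv = j , pj , n , v , dv , Lv , z

    Q-cont : ∀ i → IsLimitElement μ i → ∀ x → x ∈ ∣ Q i ∣ → ∃[ j ] (j <ᴶ i × x ∈ ∣ Q j ∣)
    Q-cont i lim x x∈ =
      let (u , g , eq) = ∈-generated⁻ {L i ∪ᵛ []} {∅∪≺ i} x∈
          (j , j<i , g′) = Q-common (_<ᴶ i) (proj₂ (proj₁ lim)) (λ {x} → L-lim lim {x}) g
      in j , j<i , subst (_∈ ∣ Q j ∣) eq (∈-generated {L j ∪ᵛ []} {∅∪≺ j} g′)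

    Q-cover : ∀ x → x ∈ ∣ Q∞ ∣ → ∃[ i ] x ∈ ∣ Q i ∣
    Q-cover x x∈ =
      let (u , g , eq) = ∈-generated⁻ {L∞ ∪ᵛ []} {L∞-fine [] (mid ∷ []) []} x∈
          (j , _ , g′) = Q-common (λ _ → ⊤) {proj₁ μ-lim} tt (λ {x} Lx → let (i , Li) = L-cover {x} Lx in i , tt , Li) g
      in j , subst (_∈ ∣ Q j ∣) eq (∈-generated {L j ∪ᵛ []} {∅∪≺ j} g′)

    base≼Q : ∀ i → M ≼ Q i
    base≼Q i _ (m , refl) = subst (_∈ ∣ Q i ∣) (θ-base m)
      (∈-generated {L i ∪ᵛ []} {∅∪≺ i} (0 , [] , []ᵖ , [] , to base m , refl))

    private
      ι-irrelevant : ∀ {n} {v w : Vec Point n} dv dw → v ≡ w → ∀ x → to (ι v dv) x ≡ to (ι w dw) x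
      ι-irrelevant {v = v} dv dw refl x = trans (ι-map dv ⊑-refl dw (select-refl v) x)
        (sym (ι-map dw ⊑-refl dw (select-refl v) x))

      module Swap (i : J) where
        S T : Subset′
        S = L i ∪ᵛ (lo i ∷ [])
        T = L i ∪ᵛ (hi i ∷ [])

        -- Moves lo i to hi i, which has the same cut over the points of L i.
        σ : Point → Point
        σ x with lem {P = x ≡ lo i}
        ... | yes _ = hi i
        ... | no _ = x

        σ-lo : σ (lo i) ≡ hi i
        σ-lo with lem {P = lo i ≡ lo i}
        ... | yes _ = refl
        ... | no ¬e = ⊥-elim (¬e refl)

        σ-L : ∀ {x} → L i x → σ x ≡ x
        σ-L {x} Lx with lem {P = x ≡ lo i}
        ... | yes refl = ⊥-elim (O.<-irrefl Lx)
        ... | no _ = refl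

        σ-mono : ∀ {x y} → S x → S y → x ≺ᵖ y → σ x ≺ᵖ σ y
        σ-mono {x} {y} (inj₁ Lx) (inj₁ Ly) l = subst₂ _≺ᵖ_ (sym (σ-L {x} Lx)) (sym (σ-L {y} Ly)) l
        σ-mono {x} (inj₁ Lx) (inj₂ (here refl)) (lo<lo _) = subst₂ _≺ᵖ_ (sym (σ-L {x} Lx)) (sym σ-lo) lo<hi
        σ-mono (inj₂ (here refl)) (inj₁ Ly) (lo<lo i<j) = ⊥-elim (O.<⇒≤ i<j Ly)
        σ-mono (inj₂ (here refl)) (inj₁ Ly) (lo<hi {j = j}) = subst₂ _≺ᵖ_ (sym σ-lo) (sym (σ-L {hi j} Ly)) (hi<hi Ly)
        σ-mono (inj₂ (here refl)) (inj₂ (here refl)) (lo<lo i<i) = ⊥-elim (O.<-irrefl i<i)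

        σ-reflects : ∀ {x y} → S x → S y → σ x ≺ᵖ σ y → x ≺ᵖ y
        σ-reflects {x} {y} (inj₁ Lx) (inj₁ Ly) l = subst₂ _≺ᵖ_ (σ-L {x} Lx) (σ-L {y} Ly) l
        σ-reflects {lo j} (inj₁ Lx) (inj₂ (here refl)) l = lo<lo Lx
        σ-reflects {hi j} (inj₁ Lx) (inj₂ (here refl)) l with subst (_≺ᵖ σ (lo i)) (σ-L {hi j} Lx) l
        ... | l′ with subst (hi j ≺ᵖ_) σ-lo l′
        ... | hi<hi i<j = ⊥-elim (O.<⇒≤ i<j Lx)
        σ-reflects {y = lo j} (inj₂ (here refl)) (inj₁ Ly) l with subst (_≺ᵖ σ (lo j)) σ-lo l
        ... | l′ with subst (hi i ≺ᵖ_) (σ-L {lo j} Ly) l′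
        ... | ()
        σ-reflects {y = hi j} (inj₂ (here refl)) (inj₁ Ly) l = lo<hi
        σ-reflects (inj₂ (here refl)) (inj₂ (here refl)) l with subst (λ z → z ≺ᵖ z) σ-lo l
        ... | hi<hi i<i = ⊥-elim (O.<-irrefl i<i)

        σ-into : ∀ {x} → S x → T (σ x)
        σ-into {x} (inj₁ Lx) = inj₁ (subst (L i) (sym (σ-L {x} Lx)) Lx)
        σ-into (inj₂ (here refl)) = inj₂ (here σ-lo)

        σ-onto : ∀ {y} → T y → ∃[ x ] (S x × σ x ≡ y)
        σ-onto {y} (inj₁ Ly) = y , inj₁ Ly , σ-L {y} Ly
        σ-onto (inj₂ (here refl)) = lo i , inj₂ (here refl) , σ-lo

        open Relabelling {S} {T} σ (λ {x} {y} → σ-mono {x} {y}) (λ {x} → σ-into {x})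

        -- `σ` fixes the points of `L i`, so relabelling is an isomorphism of `Left i` onto
        -- `Right i` over `Q i`; homogeneity extends it to ℭ.
        extends = homogeneous (Left i) (Right i) relabel
          (relabel-surjective (λ {y} → σ-onto {y}) (λ {x} {y} → σ-reflects {x} {y}))

        h : Automorphism
        h = proj₁ extends

        h-relabel : ∀ w → h ⟨ θ (proj₁ w) ⟩ ≡ θ (proj₁ (to relabel w))
        h-relabel w = trans (cong (h ⟨_⟩) (sym (elem-θ S (≺-top i (lo i ∷ [])) w)))
          (trans (proj₂ extends w) (elem-θ T (≺-top i (hi i ∷ [])) _))

        fixes : ∀ x → x ∈ ∣ Q i ∣ → h ⟨ x ⟩ ≡ x
        fixes x x∈ = fixes-generated (∈-generated⁻ {L i ∪ᵛ []} {∅∪≺ i} x∈)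
          where
          fixes-generated : ∃[ u ] (Gen (L i ∪ᵛ []) u × θ u ≡ x) → h ⟨ x ⟩ ≡ x
          fixes-generated (u , (n , v , dv , Lv , y , eq) , refl) =
              let Sv = All.map (λ { (inj₁ Lx) → inj₁ Lx ; (inj₂ ()) }) Lv
                  (d′ , r) = relabel-ι {d = dv} Sv y {u , squash (n , v , dv , Sv , y , eq)} eq
                  σv≡v = trans (map-cong-All (λ { {x} (inj₁ Lx) → σ-L {x} Lx ; (inj₂ ()) }) Lv) (map-id v)
              in trans (h-relabel _) (cong θ (trans r (trans (ι-irrelevant d′ dv σv≡v y) eq)))

        swaps : h [ ∣ Left i ∣ ] ≐ ∣ Right i ∣
        swaps = (λ { _ (w , refl) → to relabel w , sym (proj₂ extends w) }) ,
                (λ { _ (w , refl) → let (w′ , eq) = relabel-surjective (λ {y} → σ-onto {y}) (λ {x} {y} → σ-reflects {x} {y}) w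
                                    in w′ , trans (proj₂ extends w′) (cong (elem (Right i)) eq) })

        point : ∀ ξ → h ⟨ d (lo i) ξ ⟩ ≡ d (hi i) ξ
        point ξ = let (d′ , r) = relabel-ι {s = lo i ∷ []} {[] ∷ᵖ []ᵖ} (inj₂ (here refl) ∷ []) (pt ξ)
                                   {_ , squash (1 , lo i ∷ [] , [] ∷ᵖ []ᵖ , inj₂ (here refl) ∷ [] , pt ξ , refl)} refl
                  in trans (h-relabel _) (cong θ (trans r (ι-irrelevant d′ ([] ∷ᵖ []ᵖ) (cong (_∷ []) σ-lo) (pt ξ))))

      -- The colimit contains at {x, y} a copy of the hull `H 2` of an actual pair of stages, `s 2`.
      -- Homogeneity moves that hull to the copy, so a pair of new points has over `M` the type of
      -- an increasing pair of the original sequence. As in `s 2`, the larger point comes first in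
      -- `v`.
      module Realize {x y : Point} (x<y : x ≺ᵖ y) where
        v : Vec Point 2
        v = y ∷ x ∷ []

        dv : Descᵖ v
        dv = (x<y ∷ []) ∷ᵖ ([] ∷ᵖ []ᵖ)

        copy : Model
        copy = record { stage = stg ; emb = e ∘ᵉ into-top v dv ; strong = strong-trans (into-top-strong v dv) e-strong }

        extends = homogeneous (H 2) copy idᵉ (λ z → z , refl)

        h : Automorphism
        h = proj₁ extends

        h-ι : ∀ z → h ⟨ elem (H 2) z ⟩ ≡ θ (to (ι v dv) z)
        h-ι z = trans (proj₂ extends z) (θ-e _)

        fixes : ∀ z → z ∈ ∣ M ∣ → h ⟨ z ⟩ ≡ z
        fixes _ (m , refl) = trans (cong (h ⟨_⟩) (sym (base-map (drop (drop end)) m)))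
          (trans (h-ι _) (trans (cong θ (sym (ι-map []ᵖ (drop (drop end)) dv refl (to base m)))) (θ-base m)))

        h-point : ∀ (f : 1 ⊑ 2) {k z} → select f (s 2) ≡ k ∷ [] → select f v ≡ z ∷ [] → ∀ ξ → h ⟨ c k ξ ⟩ ≡ d z ξ
        h-point f eq eq′ ξ = trans (cong (h ⟨_⟩) (sym (pt-map f eq ξ)))
          (trans (h-ι _) (cong θ (sym (ι-map ([] ∷ᵖ []ᵖ) f dv eq′ (pt ξ)))))

        result : ∀ w → s 2 ≡ w → Desc w → ∃[ i ] ∃[ j ] (i < j × (∃[ h ] ((∀ z → z ∈ ∣ M ∣ → h ⟨ z ⟩ ≡ z) ×
                   (∀ ξ → h ⟨ c i ξ ⟩ ≡ d x ξ) × (∀ ξ → h ⟨ c j ξ ⟩ ≡ d y ξ))))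
        result (j ∷ i ∷ []) eq ((i<j ∷ []) ∷ _) = i , j , i<j , h , fixes ,
          h-point (drop (keep end)) (cong (select (drop (keep end))) eq) refl ,
          h-point (keep (drop end)) (cong (select (keep (drop end))) eq) refl

    twoSidedChain : TwoSidedChain 𝒦 𝕄 M c μ
    twoSidedChain = record
      { Q = Q ; Q∞ = Q∞ ; Q-mono = Q-mono ; Q-cont = Q-cont
      ; Q-sub = λ i → model-mono (∅∪≺ i) (L∞-fine [] (mid ∷ []) []) (∪ᵛ-left L-sub)
      ; Q-cover = Q-cover ; base≼Q = base≼Q ; d = d ; Left = Left ; Right = Right
      ; Left≼Q∞ = λ i → model-mono (≺-top i (lo i ∷ [])) (L∞-fine [] (mid ∷ []) []) (λ { x (inj₁ Lx) → inj₁ (L-sub x Lx) ; x (inj₂ (here refl)) → inj₁ (lift tt) })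
      ; Right≼Q∞ = λ i → model-mono (≺-top i (hi i ∷ [])) (L∞-fine [] (mid ∷ []) []) (λ { x (inj₁ Lx) → inj₁ (L-sub x Lx) ; x (inj₂ (here refl)) → inj₁ (lift tt) })
      ; Q≼Left = λ i → model-mono (∅∪≺ i) (≺-top i (lo i ∷ [])) (∪ᵛ-mono (λ _ z → z) [])
      ; Q≼Right = λ i → model-mono (∅∪≺ i) (≺-top i (hi i ∷ [])) (∪ᵛ-mono (λ _ z → z) [])
      ; lo∈Left = λ i ξ → ∈-generated {L i ∪ᵛ (lo i ∷ [])} {≺-top i (lo i ∷ [])} (1 , lo i ∷ [] , [] ∷ᵖ []ᵖ , inj₂ (here refl) ∷ [] , pt ξ , refl)
      ; swap = Swap.h ; swap-fixes = Swap.fixes ; swap-Left = Swap.swaps ; swap-point = Swap.point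
      ; realize = λ x<y → Realize.result x<y (s 2) refl (s-desc 2)
      }

module _ (lem : ∀ {a} → ExcludedMiddle a) (fe : ∀ {a b} → Extensionality a b)
         {ℓ} (𝒦 : AEC ℓ) (𝕄 : Monster 𝒦) (amalg : AEC.Amalgamation 𝒦)
         (M : InMonster.Model 𝕄) {X : Set ℓ} (c : Monster.Stage 𝕄 → X → ⟦ Monster.ℭ 𝕄 ⟧)
         (μ : WellOrder ℓ) (μ-lim : IsLimitOrder μ) where
  private
    module 𝓗 = Hulls lem fe 𝒦 𝕄 amalg M c
    module Col = Colimit lem fe 𝓗.𝓜 𝓗.𝓜-map 𝓗.𝓜-map-refl 𝓗.𝓜-map-trans (TwoSided.strictTotalOrder μ)

  abstract
    two-sided-chain : TwoSidedChain 𝒦 𝕄 M c μ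
    two-sided-chain = TwoSidedModel.Construction.twoSidedChain lem fe 𝒦 𝕄 amalg M c μ μ-lim 𝓗.s 𝓗.s-desc (λ n → 𝓗.H (𝓗.s n))
      𝓗.𝓜-map 𝓗.𝓜-map-strong 𝓗.base 𝓗.base-strong 𝓗.pt 𝓗.base-map 𝓗.pt-map
      Col.U Col.ι Col.ι-map Col.ι-cover

-- Comparison of two independence relations

module Canonicity (lem : ∀ {a} → ExcludedMiddle a) (fe : ∀ {a b} → Extensionality a b)
                  {ℓ} (𝒦 : AEC ℓ) (𝕄 : Monster 𝒦) (amalg : AEC.Amalgamation 𝒦) where
  open MonsterModel lem fe 𝒦 𝕄
  open Model using (str)
  open TwoSided using (lo; mid; hi; lo<mid; mid<hi)

  Fixes : Automorphism → Model → Set (lsuc ℓ)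
  Fixes h P = ∀ x → x ∈ ∣ P ∣ → h ⟨ x ⟩ ≡ x

  fixes-⁻¹ : ∀ {h P} → Fixes h P → Fixes (h ⁻¹) P
  fixes-⁻¹ {h} fix x x∈ = ⟨⟩-injective h (trans (⁻¹-right h x) (sym (fix x x∈)))

  fixes-∘ : ∀ {g h P} → Fixes g P → Fixes h P → Fixes (g ∘ᵃ h) P
  fixes-∘ {g} fg fh x x∈ = trans (cong (g ⟨_⟩) (fh x x∈)) (fg x x∈)

  fixes-≼ : ∀ {h P Q} → P ≼ Q → Fixes h Q → Fixes h P
  fixes-≼ P≼Q fix x x∈ = fix x (P≼Q x x∈)

  range : {X : Set ℓ} → (X → ⟦ ℭ ⟧) → Subset
  range p = record { elem = p }

  range-cong : ∀ {X : Set ℓ} {p q : X → ⟦ ℭ ⟧} → (∀ ξ → p ξ ≡ q ξ) → range p ⊆ range q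
  range-cong eq x (ξ , e) = ξ , trans (sym (eq ξ)) e

  module _ (ind : IndependenceRelation) where
    open IndependenceRelation ind

    resp : ∀ {A A′ M N} → A′ ⊆ A → A ↓[ M ] N → A′ ↓[ M ] N
    resp {N = N} A′⊆A free = monotonicity free A′⊆A (base-≼ free) (≼-refl {N})

    move : ∀ {X : Set ℓ} {p : X → ⟦ ℭ ⟧} {q M N N′} h → Fixes h M → (∀ ξ → h ⟨ p ξ ⟩ ≡ q ξ) →
           h [ ∣ N ∣ ] ≐ ∣ N′ ∣ → range p ↓[ M ] N → range q ↓[ M ] N′
    move {p = p} {q} {M} {N} {N′} h fix hp (hN⊆ , ⊆hN) free = Equivalence.to
      (invariance {range p} {M} {N} {range q} {M} {N′} (base-≼ free)
        (λ { x x∈ → subst (_∈ ∣ N′ ∣) (fix x x∈) (image∈ (base-≼ free x x∈)) })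
        (h , (λ { x (() , _) }) , λ { fzero → range-cong hp , range-cong (λ ξ → sym (hp ξ))
           ; (fsuc fzero) → (λ { x (m , refl) → m , sym (fix _ (m , refl)) }) , (λ { x (m , refl) → m , fix _ (m , refl) })
           ; (fsuc (fsuc fzero)) → hN⊆ , ⊆hN })) free
      where
      image∈ : ∀ {x} → x ∈ ∣ N ∣ → h ⟨ x ⟩ ∈ ∣ N′ ∣
      image∈ (n , refl) = hN⊆ _ (n , refl)

    fixed-image : ∀ {h N} → Fixes h N → h [ ∣ N ∣ ] ≐ ∣ N ∣
    fixed-image fix = (λ { x (n , refl) → n , sym (fix _ (n , refl)) }) , (λ { x (n , refl) → n , fix _ (n , refl) })

    -- Extension supplies the free copy as a bare set; the inverse of the accompanying automorphism
    -- turns it back into a family indexed like `p`.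
    extend : ∀ {M} → E₁-at M → ∀ {X : Set ℓ} (p : X → ⟦ ℭ ⟧) {N N′} → N ≼ N′ → range p ↓[ M ] N →
             ∃[ h ] (Fixes h N × range (λ ξ → h ⟨ p ξ ⟩) ↓[ M ] N′)
    extend {M} E₁ p {N} {N′} N≼N′ free =
      let (A′ , (f , fix , eq) , free′) = E₁ (range p) N N′ (base-≼ free) N≼N′ free
          back : range (λ ξ → f ⁻¹ ⟨ p ξ ⟩) ⊆ A′
          back = λ { x (ξ , refl) → let (i , e) = proj₂ (eq fzero) (p ξ) (ξ , refl)
                                    in i , trans (sym (⁻¹-left f _)) (cong (f ⁻¹ ⟨_⟩) e) }
      in f ⁻¹ , fixes-⁻¹ {f} {N} fix , resp back free′

    free-copy : ∀ {M} → E-at M → ∀ {X : Set ℓ} (p : X → ⟦ ℭ ⟧) {N} → M ≼ N →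
                ∃[ h ] (Fixes h M × range (λ ξ → h ⟨ p ξ ⟩) ↓[ M ] N)
    free-copy (E₀ , E₁) p M≼N = extend E₁ p M≼N (E₀ (range p))

    unique : ∀ {M} → U-at M → ∀ {X : Set ℓ} {p q : X → ⟦ ℭ ⟧} {N} h → Fixes h M → (∀ ξ → h ⟨ p ξ ⟩ ≡ q ξ) →
             range p ↓[ M ] N → range q ↓[ M ] N → ∃[ g ] (Fixes g N × (∀ ξ → g ⟨ p ξ ⟩ ≡ q ξ))
    unique U {p = p} {q} {N} h fix hp free free′ =
      let (g , (fixN , _) , agree) = U (range p) (range q) N free free′ h
            (fix , λ { fzero → range-cong hp , range-cong (λ ξ → sym (hp ξ)) })
      in g , fixN , λ ξ → trans (agree (p ξ) (ξ , refl)) (hp ξ)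

  -- Families may repeat elements, so the size is the index type modulo equality of values. It is
  -- shared by all automorphic images, which allows κ to be fixed before any copy is chosen.
  hasSize : ∀ {X : Set ℓ} (p : X → ⟦ ℭ ⟧) → ∃[ α ] ∀ g → HasSize (range (λ ξ → g ⟨ p ξ ⟩)) α
  hasSize {X} p = Quot , λ g → (λ q → g ⟨ p (proj₁ q) ⟩) , (λ eq → inj (⟨⟩-injective g eq)) ,
    (λ { x (ξ , refl) → [ ξ ] , cong (g ⟨_⟩) (sym (~-rep ξ)) }) , (λ { x (q , refl) → proj₁ q , refl })
    where
    open Quotient fe (λ ξ ζ → p ξ ≡ p ζ) refl sym trans
    inj : ∀ {q r : Quot} → p (proj₁ q) ≡ p (proj₁ r) → q ≡ r
    inj {q} {r} eq with []-surjective q | []-surjective r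
    ... | ξ , refl | ζ , refl = []-cong (trans (~-rep ξ) (trans eq (sym (~-rep ζ))))

  -- `R` stands for freeness and for its negation in turn, so it enters only through its invariance
  -- over `M`.
  module _ (ind : IndependenceRelation) (uniq : IndependenceRelation.U ind) (local : IndependenceRelation.L ind) (M : Model)
           {X Y : Set ℓ} (a : X → ⟦ ℭ ⟧)
           (R : (X → ⟦ ℭ ⟧) → (Y → ⟦ ℭ ⟧) → Set (lsuc ℓ))
           (R-inv : ∀ {p p′ q q′} h → Fixes h M → (∀ ξ → h ⟨ p ξ ⟩ ≡ p′ ξ) → (∀ ζ → h ⟨ q ζ ⟩ ≡ q′ ζ) → R p q → R p′ q′)
           (h : Stage → Automorphism) (n : Stage → Y → ⟦ ℭ ⟧) where
    open IndependenceRelation ind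

    private
      a′ : Stage → X → ⟦ ℭ ⟧
      a′ i ξ = h i ⟨ a ξ ⟩

      c : Stage → X ⊎ Y → ⟦ ℭ ⟧
      c i (inj₁ ξ) = a′ i ξ
      c i (inj₂ ζ) = n i ζ

    -- In a copy of μ + 1 + μ*, the middle point splits over every Q i, as it distinguishes
    -- two points with the same type over Q i.
    no-order-property : (∀ {i j} → i < j → R (a′ i) (n j)) → (∀ {i j} → i < j → ¬ R (a′ j) (n i)) → Lift (lsuc ℓ) ⊥
    no-order-property up down = lift (¬lo R-lo)
      where
      α = proj₁ (hasSize a)
      κ = proj₁ (local α)
      open RegularCardinal κ using () renaming (wellOrder to μ; isRegular to μ-regular)
      open TwoSidedChain (two-sided-chain lem fe 𝒦 𝕄 amalg M c μ (proj₁ μ-regular))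

      m : X → ⟦ ℭ ⟧
      m ξ = d mid (inj₁ ξ)

      y : TwoSided.Point μ → Y → ⟦ ℭ ⟧
      y x ζ = d x (inj₂ ζ)

      R-inv⁻ : ∀ {p p′ q q′} h → Fixes h M → (∀ ξ → h ⟨ p ξ ⟩ ≡ p′ ξ) → (∀ ζ → h ⟨ q ζ ⟩ ≡ q′ ζ) → R p′ q′ → R p q
      R-inv⁻ h fix hp hq = R-inv (h ⁻¹) (fixes-⁻¹ {h} {M} fix)
        (λ ξ → trans (cong (h ⁻¹ ⟨_⟩) (sym (hp ξ))) (⁻¹-left h _)) (λ ζ → trans (cong (h ⁻¹ ⟨_⟩) (sym (hq ζ))) (⁻¹-left h _))

      -- `realize` exhibits `m` as an automorphic image of `a`; any point to the left of `mid`
      -- serves for this.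
      size : HasSize (range m) α
      size = let (_ , j , _ , g , _ , _ , eq) = realize {lo (proj₁ (proj₁ μ-regular))} {mid} lo<mid
                 (e , inj , ⊆e , e⊆) = proj₂ (hasSize a) (g ∘ᵃ h j)
             in e , inj , (λ x x∈ → ⊆e x (range-cong (λ ξ → sym (eq (inj₁ ξ))) x x∈)) ,
                (λ x x∈ → range-cong (λ ξ → eq (inj₁ ξ)) x (e⊆ x x∈))

      located : ∃[ i ] range m ↓[ Q i ] Q∞
      located = proj₁ (proj₂ (local α)) κ (mk↣ {to = λ x → x} (λ eq → eq)) Q Q∞ Q-mono Q-cont Q-sub Q-cover (range m) size

      i = proj₁ located

      f = swap i

      free-Right : range m ↓[ Q i ] Right i
      free-Right = monotonicity (proj₂ located) (λ _ x∈ → x∈) (Q≼Right i) (Right≼Q∞ i)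

      free-swapped : range (λ ξ → f ⟨ m ξ ⟩) ↓[ Q i ] Right i
      free-swapped = move ind {N = Left i} {Right i} f (swap-fixes i) (λ _ → refl) (swap-Left i)
        (monotonicity (proj₂ located) (λ _ x∈ → x∈) (Q≼Left i) (Left≼Q∞ i))

      ¬lo : ¬ R m (y (lo i))
      ¬lo r = let (i′ , j′ , i<j , g , fix , e , e′) = realize {lo i} {mid} lo<mid
              in down i<j (R-inv⁻ g fix (λ ξ → e′ (inj₁ ξ)) (λ ζ → e (inj₂ ζ)) r)

      R-hi : R m (y (hi i))
      R-hi = let (i′ , j′ , i<j , g , fix , e , e′) = realize {mid} {hi i} mid<hi
             in R-inv g fix (λ ξ → e (inj₁ ξ)) (λ ζ → e′ (inj₂ ζ)) (up i<j)

      R-lo : R m (y (lo i))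
      R-lo =
        -- Uniqueness over `Q i` gives `g` fixing `Right i` and taking `m` to its image under `f`.
        -- Hence `g ⁻¹ ∘ᵃ f` fixes `m` pointwise and takes the point at `lo i` to the one at `hi i`.
        let (g , fixR , gm) = unique ind (uniq (Q i)) f (swap-fixes i) (λ _ → refl) free-Right free-swapped
            fixed : ∀ ζ → g ⁻¹ ⟨ d (hi i) ζ ⟩ ≡ d (hi i) ζ
            fixed ζ = fixes-⁻¹ {g} {Right i} fixR _ (subst (_∈ ∣ Right i ∣) (swap-point i ζ)
              (let (w , eq) = lo∈Left i ζ in proj₁ (swap-Left i) _ (w , cong (f ⟨_⟩) eq)))
        in R-inv⁻ (g ⁻¹ ∘ᵃ f)
             (fixes-∘ {g ⁻¹} {f} {M} (fixes-⁻¹ {g} {M} (fixes-≼ {g} {M} {Right i} (≼-trans {M} {Q i} {Right i} (base≼Q i) (Q≼Right i)) fixR))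
                      (fixes-≼ {f} {M} {Q i} (base≼Q i) (swap-fixes i)))
             (λ ξ → trans (cong (g ⁻¹ ⟨_⟩) (sym (gm ξ))) (⁻¹-left g _))
             (λ ζ → trans (cong (g ⁻¹ ⟨_⟩) (swap-point i (inj₂ ζ))) (fixed (inj₂ ζ))) R-hi

  module _ (↓₁ ↓₂ : IndependenceRelation) (M : Model)
           (E₁ : IndependenceRelation.E-at ↓₁ M) (U₁ : IndependenceRelation.U-at ↓₁ M)
           (E₂ : IndependenceRelation.E-at ↓₂ M) (U₂ : IndependenceRelation.U ↓₂) (L₂ : IndependenceRelation.L ↓₂) where
    private
      module ↓₁ = IndependenceRelation ↓₁
      module ↓₂ = IndependenceRelation ↓₂

    module Comparison (A : Subset) (N : Model) (M≼N : M ≼ N) where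
      X Y : Set ℓ
      X = Subset.Index A
      Y = ⟦ str N ⟧

      a : X → ⟦ ℭ ⟧
      a = Subset.elem A

      b : Y → ⟦ ℭ ⟧
      b = elem N

      -- Freeness of p from a copy q of N is pulled back to N, which makes it invariant.
      record Free (p : X → ⟦ ℭ ⟧) (q : Y → ⟦ ℭ ⟧) : Set (lsuc ℓ) where
        constructor free-via
        field
          k     : Automorphism
          fixes : Fixes k M
          copy  : ∀ ζ → k ⟨ b ζ ⟩ ≡ q ζ
          free  : range (λ ξ → k ⁻¹ ⟨ p ξ ⟩) ↓₂.↓[ M ] N

      Free-inv : ∀ {p p′ q q′} h → Fixes h M → (∀ ξ → h ⟨ p ξ ⟩ ≡ p′ ξ) → (∀ ζ → h ⟨ q ζ ⟩ ≡ q′ ζ) →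
                 Free p q → Free p′ q′
      Free-inv {p} {p′} h fix hp hq (free-via k fixk copy free) = free-via (h ∘ᵃ k) (fixes-∘ {h} {k} {M} fix fixk)
        (λ ζ → trans (cong (h ⟨_⟩) (copy ζ)) (hq ζ))
        (resp ↓₂ (range-cong λ ξ → ⟨⟩-injective (h ∘ᵃ k)
          (trans (⁻¹-right (h ∘ᵃ k) (p′ ξ)) (trans (sym (hp ξ)) (sym (cong (h ⟨_⟩) (⁻¹-right k (p ξ))))))) free)

      Free-inv⁻ : ∀ {p p′ q q′} h → Fixes h M → (∀ ξ → h ⟨ p ξ ⟩ ≡ p′ ξ) → (∀ ζ → h ⟨ q ζ ⟩ ≡ q′ ζ) →
                  Free p′ q′ → Free p q
      Free-inv⁻ h fix hp hq = Free-inv (h ⁻¹) (fixes-⁻¹ {h} {M} fix)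
        (λ ξ → trans (cong (h ⁻¹ ⟨_⟩) (sym (hp ξ))) (⁻¹-left h _)) (λ ζ → trans (cong (h ⁻¹ ⟨_⟩) (sym (hq ζ))) (⁻¹-left h _))

      -- Two automorphisms inducing the same copy of `N` differ by one that fixes `N` pointwise, so
      -- the witness `k` does not matter.
      Free-N : ∀ {p q} k → Fixes k M → (∀ ζ → k ⟨ b ζ ⟩ ≡ q ζ) → Free p q → range (λ ξ → k ⁻¹ ⟨ p ξ ⟩) ↓₂.↓[ M ] N
      Free-N {p} k fix copy (free-via k′ fix′ copy′ free) =
        move ↓₂ (k ⁻¹ ∘ᵃ k′) (fixes-≼ {k ⁻¹ ∘ᵃ k′} {M} {N} M≼N fixN) (λ ξ → cong (k ⁻¹ ⟨_⟩) (⁻¹-right k′ (p ξ))) (fixed-image ↓₂ {k ⁻¹ ∘ᵃ k′} {N} fixN) free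
        where
        fixN : Fixes (k ⁻¹ ∘ᵃ k′) N
        fixN _ (ζ , refl) = trans (cong (k ⁻¹ ⟨_⟩) (trans (copy′ ζ) (sym (copy ζ)))) (⁻¹-left k (b ζ))

      -- Nothing is recorded about how the copy of `A` was obtained, so the heirs of both sequences
      -- fall under `heir-uniform`.
      record Heir : Set (lsuc ℓ) where
        field
          h k   : Automorphism
          h-fix : Fixes h M
          k-fix : Fixes k M
          R     : Model
          a∈R   : ∀ ξ → h ⟨ a ξ ⟩ ∈ ∣ R ∣
          free  : range (λ ζ → k ⟨ b ζ ⟩) ↓₂.↓[ M ] R

        Value : Set (lsuc ℓ)
        Value = Free (λ ξ → h ⟨ a ξ ⟩) (λ ζ → k ⟨ b ζ ⟩)

      -- D is moved by `f` so that the two copies of `A` coincide. Both copies of `N` are then made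
      -- ↓₂-free from one stage `R*` containing both models, where uniqueness makes them conjugate
      -- by `w`, which fixes the copy of `A`. Freeness survives each of these automorphisms.
      heir-uniform : (D D′ : Heir) → Heir.Value D → Heir.Value D′
      heir-uniform D D′ val = Free-inv⁻ g₁ (λ x x∈ → g₁-fix x (M≼R′ x x∈)) (λ ξ → g₁-fix _ (D′.a∈R ξ)) (λ _ → refl)
        (Free-inv w (λ x x∈ → w-fix x (M≼R* x x∈)) (λ ξ → w-fix _ (R′≼R* _ (D′.a∈R ξ))) w-copy
          (Free-inv (g₂ ∘ᵃ f) (λ x x∈ → trans (cong (g₂ ⟨_⟩) (f-fix x x∈)) (g₂-fix x (M≼fR x x∈)))
            (λ ξ → trans (cong (g₂ ⟨_⟩) (fh ξ)) (g₂-fix _ (a∈fR ξ))) (λ _ → refl) val))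
        where
        module D = Heir D
        module D′ = Heir D′
        f = D′.h ∘ᵃ D.h ⁻¹
        f-fix = fixes-∘ {D′.h} {D.h ⁻¹} {M} D′.h-fix (fixes-⁻¹ {D.h} {M} D.h-fix)
        fh : ∀ ξ → f ⟨ D.h ⟨ a ξ ⟩ ⟩ ≡ D′.h ⟨ a ξ ⟩
        fh ξ = cong (D′.h ⟨_⟩) (⁻¹-left D.h (a ξ))
        fR = image f D.R
        f-image : f [ ∣ D.R ∣ ] ≐ ∣ fR ∣
        f-image = range-cong (λ x → sym (image-elem f D.R x)) , range-cong (image-elem f D.R)
        a∈fR : ∀ ξ → D′.h ⟨ a ξ ⟩ ∈ ∣ fR ∣
        a∈fR ξ = let (x , eq) = D.a∈R ξ in x , trans (image-elem f D.R x) (trans (cong (f ⟨_⟩) eq) (fh ξ))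
        top = bound₂ (Model.stage fR) (Model.stage D′.R)
        R* = stageModel (proj₁ top)
        fR≼R* : fR ≼ R*
        fR≼R* = ⊆-stage fR (<⇒≤ (proj₁ (proj₂ top)))
        R′≼R* : D′.R ≼ R*
        R′≼R* = ⊆-stage D′.R (<⇒≤ (proj₂ (proj₂ top)))
        moved : range (λ ζ → f ⟨ D.k ⟨ b ζ ⟩ ⟩) ↓₂.↓[ M ] fR
        moved = move ↓₂ f f-fix (λ _ → refl) f-image D.free
        M≼fR = ↓₂.base-≼ moved
        M≼R′ = ↓₂.base-≼ D′.free
        M≼R* = ≼-trans {M} {D′.R} {R*} M≼R′ R′≼R*
        ext₁ = extend ↓₂ (proj₂ E₂) (λ ζ → D′.k ⟨ b ζ ⟩) {D′.R} {R*} R′≼R* D′.free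
        g₁ = proj₁ ext₁
        g₁-fix = proj₁ (proj₂ ext₁)
        ext₂ = extend ↓₂ (proj₂ E₂) (λ ζ → f ⟨ D.k ⟨ b ζ ⟩ ⟩) {fR} {R*} fR≼R* moved
        g₂ = proj₁ ext₂
        g₂-fix = proj₁ (proj₂ ext₂)
        v = g₂ ∘ᵃ f ∘ᵃ D.k
        v-fix : Fixes v M
        v-fix = fixes-∘ {g₂} {f ∘ᵃ D.k} {M} (fixes-≼ {g₂} {M} {fR} M≼fR g₂-fix) (fixes-∘ {f} {D.k} {M} f-fix D.k-fix)
        u = (g₁ ∘ᵃ D′.k) ∘ᵃ v ⁻¹
        u-fix : Fixes u M
        u-fix = fixes-∘ {g₁ ∘ᵃ D′.k} {v ⁻¹} {M} (fixes-∘ {g₁} {D′.k} {M} (fixes-≼ {g₁} {M} {D′.R} M≼R′ g₁-fix) D′.k-fix) (fixes-⁻¹ {v} {M} v-fix)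
        same = unique ↓₂ (U₂ M) u u-fix (λ ζ → cong ((g₁ ∘ᵃ D′.k) ⟨_⟩) (⁻¹-left v (b ζ))) (proj₂ (proj₂ ext₂)) (proj₂ (proj₂ ext₁))
        w = proj₁ same
        w-fix = proj₁ (proj₂ same)
        w-copy = proj₂ (proj₂ same)

      -- A sequence of copies of A and N: a copy of A is ↓-free from everything before it,
      -- and the next copy of N is ↓₂-free from everything before it.
      module Sequence (ind : IndependenceRelation) (E : IndependenceRelation.E-at ind M) where
        open IndependenceRelation ind using (_↓[_]_; monotonicity)

        abstract
          -- The choices at i do not refer to earlier ones: each copy is made free from a whole
          -- stage beyond i, and `sparse` later selects indices for which the earlier copies lie in
          -- that stage.
          r : Stage → Stage
          r i = proj₁ (bound₂ i (Model.stage M))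

          M≼r : ∀ i → M ≼ stageModel (r i)
          M≼r i = ⊆-stage M (<⇒≤ (proj₂ (proj₂ (bound₂ i (Model.stage M)))))

          copyA : ∀ i → ∃[ h ] (Fixes h M × range (λ ξ → h ⟨ a ξ ⟩) ↓[ M ] stageModel (r i))
          copyA i = free-copy ind E a (M≼r i)

          in-A : ∀ i → ∃[ s ] ∀ {j} → s ≤ j → ∀ ξ → In j (proj₁ (copyA i) ⟨ a ξ ⟩)
          in-A i = In-bounded (λ ξ → proj₁ (copyA i) ⟨ a ξ ⟩)

          r′ : Stage → Stage
          r′ i = proj₁ (bound₂ (r i) (proj₁ (in-A i)))

          r<r′ : ∀ i → r i < r′ i
          r<r′ i = proj₁ (proj₂ (bound₂ (r i) (proj₁ (in-A i))))

          a∈r′ : ∀ i ξ → In (r′ i) (proj₁ (copyA i) ⟨ a ξ ⟩)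
          a∈r′ i = proj₂ (in-A i) (<⇒≤ (proj₂ (proj₂ (bound₂ (r i) (proj₁ (in-A i))))))

          copyN : ∀ i → ∃[ k ] (Fixes k M × range (λ ζ → k ⟨ b ζ ⟩) ↓₂.↓[ M ] stageModel (r′ i))
          copyN i = free-copy ↓₂ E₂ b (≼-trans {M} {stageModel (r i)} {stageModel (r′ i)} (M≼r i) (mono-stage (<⇒≤ (r<r′ i))))

        Nᵢ : Stage → Model
        Nᵢ i = image (proj₁ (copyN i)) N

        abstract
          after : Stage → Stage
          after i = proj₁ (bound₂ (r′ i) (Model.stage (Nᵢ i)))

          i<r : ∀ i → i < r i
          i<r i = proj₁ (proj₂ (bound₂ i (Model.stage M)))

        module Along (u : Stage → Stage) (u-sparse : ∀ {i j} → i < j → after (u i) < u j) where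
          private
            abstract
              r′<u : ∀ {i j} → i < j → r′ (u i) < u j
              r′<u {i} i<j = <-trans (proj₁ (proj₂ (bound₂ (r′ (u i)) (Model.stage (Nᵢ (u i)))))) (u-sparse i<j)

              N<u : ∀ {i j} → i < j → Model.stage (Nᵢ (u i)) < u j
              N<u {i} i<j = <-trans (proj₂ (proj₂ (bound₂ (r′ (u i)) (Model.stage (Nᵢ (u i)))))) (u-sparse i<j)

          h k : Stage → Automorphism
          h i = proj₁ (copyA (u i))
          k i = proj₁ (copyN (u i))

          h-fix : ∀ i → Fixes (h i) M
          h-fix i = proj₁ (proj₂ (copyA (u i)))

          k-fix : ∀ i → Fixes (k i) M
          k-fix i = proj₁ (proj₂ (copyN (u i)))

          heir : ∀ {i j} → i < j → Heir
          heir {i} {j} i<j = record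
            { h = h i ; k = k j ; h-fix = h-fix i ; k-fix = k-fix j ; R = stageModel (r′ (u j))
            ; a∈R = λ ξ → In-≤ (<⇒≤ (<-trans (r′<u i<j) (<-trans (i<r (u j)) (r<r′ (u j))))) (a∈r′ (u i) ξ)
            ; free = proj₂ (proj₂ (copyN (u j))) }

          free-after : ∀ {i j} → i < j → range (λ ξ → k i ⁻¹ ⟨ h j ⟨ a ξ ⟩ ⟩) ↓[ M ] N
          free-after {i} {j} i<j = move ind (k i ⁻¹) (fixes-⁻¹ {k i} {M} (k-fix i)) (λ _ → refl)
            ((λ { x (ζ , refl) → ζ , sym (trans (cong (k i ⁻¹ ⟨_⟩) (image-elem (k i) N ζ)) (⁻¹-left (k i) _)) }) ,
             (λ { x (ζ , refl) → ζ , trans (cong (k i ⁻¹ ⟨_⟩) (image-elem (k i) N ζ)) (⁻¹-left (k i) _) }))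
            (monotonicity {N′ = Nᵢ (u i)} (proj₂ (proj₂ (copyA (u j)))) (λ _ x∈ → x∈)
              (λ { x x∈ → let (ζ , eq) = M≼N x x∈ in ζ , trans (image-elem (k i) N ζ) (trans (cong (k i ⟨_⟩) eq) (k-fix i x x∈)) })
              (⊆-stage (Nᵢ (u i)) (<⇒≤ (<-trans (N<u i<j) (i<r (u j))))))

      private
        module T₁ = Sequence ↓₁ E₁
        module T₂ = Sequence ↓₂ E₂
        module S₁ = T₁.Along (proj₁ (sparse T₁.after)) (proj₂ (sparse T₁.after))
        module S₂ = T₂.Along (proj₁ (sparse T₂.after)) (proj₂ (sparse T₂.after))

      -- Pulled back along `S₁.k i`, the later copy of `A` is ↓₁-free from `N`, hence conjugate to
      -- `A` over `N`; were it ↓₂-free, so would be `A`.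
      not-free₁ : A ↓₁.↓[ M ] N → ¬ (A ↓₂.↓[ M ] N) →
                  ∀ {i j} → i < j → ¬ Free (λ ξ → S₁.h j ⟨ a ξ ⟩) (λ ζ → S₁.k i ⟨ b ζ ⟩)
      not-free₁ free₁ ¬free₂ {i} {j} i<j free =
        let g = S₁.k i ⁻¹ ∘ᵃ S₁.h j
            (w , w-fix , wa) = unique ↓₁ U₁ g (fixes-∘ {S₁.k i ⁻¹} {S₁.h j} {M} (fixes-⁻¹ {S₁.k i} {M} (S₁.k-fix i)) (S₁.h-fix j))
                                 (λ _ → refl) free₁ (S₁.free-after i<j)
            w⁻¹-fix = fixes-⁻¹ {w} {N} w-fix
        in ¬free₂ (move ↓₂ (w ⁻¹) (fixes-≼ {w ⁻¹} {M} {N} M≼N w⁻¹-fix)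
             (λ ξ → trans (cong (w ⁻¹ ⟨_⟩) (sym (wa ξ))) (⁻¹-left w (a ξ)))
             (fixed-image ↓₂ {w ⁻¹} {N} w⁻¹-fix) (Free-N (S₁.k i) (S₁.k-fix i) (λ _ → refl) free))

      free₂ : ∀ {i j} → i < j → Free (λ ξ → S₂.h j ⟨ a ξ ⟩) (λ ζ → S₂.k i ⟨ b ζ ⟩)
      free₂ {i} {j} i<j = free-via (S₂.k i) (S₂.k-fix i) (λ _ → refl) (S₂.free-after i<j)

      ↓₁⇒↓₂ : A ↓₁.↓[ M ] N → A ↓₂.↓[ M ] N
      ↓₁⇒↓₂ free₁ = dne λ ¬free₂ → contradiction ¬free₂ lem
        where
        -- Whether the heirs are free or not, one of the two sequences has the order property.
        contradiction : ¬ (A ↓₂.↓[ M ] N) → Dec (∃[ D ] Heir.Value D) → ⊥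
        contradiction ¬free₂ (yes (D , val)) = lower (no-order-property ↓₂ U₂ L₂ M a Free Free-inv S₁.h (λ j ζ → S₁.k j ⟨ b ζ ⟩)
          (λ i<j → heir-uniform D (S₁.heir i<j) val) (not-free₁ free₁ ¬free₂))
        contradiction ¬free₂ (no none) = lower (no-order-property ↓₂ U₂ L₂ M a (λ p q → ¬ Free p q)
          (λ h fix hp hq ¬f f → ¬f (Free-inv⁻ h fix hp hq f)) S₂.h (λ j ζ → S₂.k j ⟨ b ζ ⟩)
          (λ i<j val → none (S₂.heir i<j , val)) (λ i<j ¬f → ¬f (free₂ i<j)))

    ↓₁⇔↓₂ : ∀ A N → (A ↓₁.↓[ M ] N) ⇔ (A ↓₂.↓[ M ] N)
    ↓₁⇔↓₂ A N = mk⇔ (λ free → Comparison.↓₁⇒↓₂ A N (↓₁.base-≼ free) free) λ free →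
      let a = Subset.elem A
          M≼N = ↓₂.base-≼ free
          (h , h-fix , h-free) = free-copy ↓₁ E₁ a M≼N
          (g , g-fix , ga) = unique ↓₂ (U₂ M) h h-fix (λ _ → refl) free (Comparison.↓₁⇒↓₂ _ N M≼N h-free)
          g⁻¹-fix = fixes-⁻¹ {g} {N} g-fix
      in move ↓₁ (g ⁻¹) (fixes-≼ {g ⁻¹} {M} {N} M≼N g⁻¹-fix) (λ ξ → trans (cong (g ⁻¹ ⟨_⟩) (sym (ga ξ))) (⁻¹-left g (a ξ)))
           (fixed-image ↓₁ {g ⁻¹} {N} g⁻¹-fix) h-free

corollary5p19 : (∀ {a} → ExcludedMiddle a) →
    (∀ {a b} → Extensionality a b) →
    ∀ {ℓ} (𝒦 : AEC ℓ) →
    AEC.Amalgamation 𝒦 → AEC.JointEmbedding 𝒦 → AEC.NoMaximalModels 𝒦 →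
    (𝕄 : Monster 𝒦) →
    let open InMonster 𝕄
    in
    (↓₁ ↓₂ : IndependenceRelation) →
    let module ↓₁ = IndependenceRelation ↓₁
        module ↓₂ = IndependenceRelation ↓₂
    in
    (∀ M →
      ↓₁.E-at M → ↓₁.U-at M →
      ↓₂.E-at M → ↓₂.U → ↓₂.L →
      ∀ A N → (A ↓₁.↓[ M ] N) ⇔ (A ↓₂.↓[ M ] N))
    ×
    (↓₁.E → ↓₁.U → ↓₁.L →
     ↓₂.E → ↓₂.U → ↓₂.L →
     ∀ A M N → (A ↓₁.↓[ M ] N) ⇔ (A ↓₂.↓[ M ] N))
corollary5p19 lem fe 𝒦 amalg _ _ 𝕄 ↓₁ ↓₂ =
  ↓₁⇔↓₂ ↓₁ ↓₂ ,
  λ E₁ U₁ _ E₂ U₂ L₂ A M → ↓₁⇔↓₂ ↓₁ ↓₂ M (E₁ M) (U₁ M) (E₂ M) U₂ L₂ A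
  where open Canonicity lem fe 𝒦 𝕄 amalg
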